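{- Let $W$ be an irreducible $T$-module with endpoint $r$ and diameter $d=D-2r$. Let $u\in E_rW$, $u^*\in E_r^*W$, $u^{\varepsilon}\in E_r^{\varepsilon}W$ be nonzero vectors. Consider the $(d+1)\times(d+1)$ tridiagonal matrix $$B=\mathbf{i}\begin{pmatrix}0&-d&&&&0\\1&0&1-d&&&\\&2&\cdot&\cdot&&\\&&\cdot&\cdot&\cdot&\\&&&\cdot&\cdot&-1\\0&&&&d&0\end{pmatrix},$$ i.e. $B_{i,i-1}=\mathbf{i}\,i$ for $1\le i\le d$, $B_{i,i+1}=\mathbf{i}(i-d)$ for $0\le i\le d-1$, and all other entries are $0$. Then the following hold. (i) $B$ represents $A$ with respect to the basis $E^*_ru^{\varepsilon},\ldots,E^*_{r+d}u^{\varepsilon}$ of $W$. (ii) $B$ represents $A^*$ with respect to the basis $E^{\varepsilon}_ru,\ldots,E^{\varepsilon}_{r+d}u$ of $W$. (iii) $B$ represents $A^{\varepsilon}$ with respect to the basis $E_ru^*,\ldots,E_{r+d}u^*$ of $W$.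
   Context: Let $D$ be a positive integer and let $Q_D$ be the $D$-cube: the graph with vertex set $X=\{0,1\}^D$, two vertices being adjacent iff they differ in exactly one coordinate; $\partial$ denotes path-length distance. $\mathrm{Mat}_X(\mathbb{C})$ is the algebra of complex matrices with rows and columns indexed by $X$, acting on $V=\mathbb{C}^X$ (column vectors) by left multiplication. Write $\mathbf{i}^2=-1$ (the bold $\mathbf{i}$ is the imaginary unit; the plain $i$ is an index). Let $A$ be the adjacency matrix of $Q_D$. Fix $x=(0,0,\ldots,0)\in X$. Let $A^*$ be the diagonal matrix in $\mathrm{Mat}_X(\mathbb{C})$ with $(y,y)$-entry $D-2\partial(x,y)$ for $y\in X$, and let $A^{\varepsilon}=-\mathbf{i}(AA^*-A^*A)/2$. Let $T$ be the subalgebra of $\mathrm{Mat}_X(\mathbb{C})$ generated by $A$ and $A^*$. The eigenvalues of $A$ are $\theta_i=D-2i$ $(0\le i\le D)$. For $0\le i\le D$: $E_i=\prod_{0\le j\le D,\,j\ne i}\frac{A-\theta_jI}{\theta_i-\theta_j}$ is the primitive idempotent of $A$ for $\theta_i$ (the orthogonal projection onto the $\theta_i$-eigenspace of $A$); $E_i^*$ is the diagonal matrix with $(y,y)$-entry $1$ if $\partial(x,y)=i$ and $0$ otherwise; and $E_i^{\varepsilon}=P^{ -1}E_iP$, where $P=P_1^{\otimes D}$ (Kronecker power, $P_{yz}=\prod_{k=1}^D(P_1)_{y_kz_k}$, invertible) with $P_1=\begin{pmatrix}1&1\\-\mathbf{i}&\mathbf{i}\end{pmatrix}$, rows and columns indexed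 by $0,1$ in that order. ($E_i^*$ and $E_i^{\varepsilon}$ are the primitive idempotents of $A^*$ and $A^{\varepsilon}$ for the eigenvalue $D-2i$.) A $T$-module is a subspace $W\subseteq V$ with $BW\subseteq W$ for all $B\in T$; it is irreducible if $W\ne0$ and it contains no $T$-modules other than $0$ and $W$. The endpoint of an irreducible $T$-module $W$ is $r=\min\{i\mid 0\le i\le D,\ E_i^*W\neq0\}$ (it is known that also $r=\min\{i\mid E_iW\ne0\}$), and its diameter is $d=|\{i\mid 0\le i\le D,\ E_i^*W\ne0\}|-1$; it is known that $d=D-2r$ and $0\le r\le D/2$. For nonzero $u\in E_rW$, $u^*\in E^*_rW$, $u^{\varepsilon}\in E^{\varepsilon}_rW$, each of the six sequences $(E^*_{r+i}u)_{i=0}^d$, $(E^{\varepsilon}_{r+i}u)_{i=0}^d$, $(E^{\varepsilon}_{r+i}u^*)_{i=0}^d$, $(E_{r+i}u^*)_{i=0}^d$, $(E_{r+i}u^{\varepsilon})_{i=0}^d$, $(E^*_{r+i}u^{\varepsilon})_{i=0}^d$ is a basis of $W$. Convention: a $(d+1)\times(d+1)$ matrix $B$ (rows and columns indexed $0,\ldots,d$) represents $Y\in T$ with respect to a basis $v_0,\ldots,v_d$ of $W$ if $Yv_j=\sum_{i=0}^dB_{ij}v_i$ for $0\le j\le d$. -}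

module Defs where

open import Algebra.Bundles using (CommutativeRing)
open import Data.Bool.Base using (if_then_else_)
open import Data.Fin.Base as Fin using (Fin; zero; suc; toℕ)
import Data.Fin.Properties as Finₚ
open import Data.Fin.Subset as Subset using (Subset)
open import Data.Integer.Base as Z using (ℤ; +_; +0; +[1+_]; -[1+_])
open import Data.List.Base as List using (List)
open import Data.Nat.Base as N using (ℕ; zero; suc; _⊔_)
import Data.Nat.Properties as ℕₚ
open import Data.Product.Base using (∃; _×_; _,_; proj₁)
open import Data.Rational.Base as Q using (ℚ; 0ℚ; 1ℚ; ½; ∣_∣)
import Data.Rational.Properties as ℚₚ
open import Data.Sum.Base using (_⊎_)
open import Data.Vec.Base as Vec using (Vec; []; _∷_)
import Data.Vec.Properties as Vecₚ
open import Function.Bundles using (_⇔_)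
open import Level using (0ℓ)
open import Relation.Binary.Bundles using (Setoid)
open import Relation.Binary.PropositionalEquality as ≡ using (_≡_)
open import Relation.Binary.Structures using (IsEquivalence)
open import Relation.Nullary.Decidable using (does; yes; no; dec⇒maybe; ¬?)
open import Relation.Nullary.Negation using (¬_; contradiction)
open import Relation.Unary using (Pred; _∈_; _⊆_; _≐_)
open import Tactic.RingSolver using (solve-∀)
open import Tactic.RingSolver.Core.AlmostCommutativeRing using (AlmostCommutativeRing; fromCommutativeRing)

-- The real numbers: Cauchy sequences of rationals, where two sequences whose
-- difference tends to 0 are equal for the setoid equality _≈_.
module Real where

  open Q using (_+_; _*_; -_; _-_; _<_; _≤_)

  ℚ-solver : AlmostCommutativeRing 0ℓ 0ℓ
  ℚ-solver = fromCommutativeRing ℚₚ.+-*-commutativeRing (λ p → dec⇒maybe (0ℚ ℚₚ.≟ p))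

  IsCauchy : (ℕ → ℚ) → Set
  IsCauchy x = ∀ ε → 0ℚ < ε → ∃ λ N → ∀ m n → N N.≤ m → N N.≤ n → ∣ x m - x n ∣ < ε

  record ℝ : Set where
    no-eta-equality
    constructor mkℝ
    field
      seq    : ℕ → ℚ
      cauchy : IsCauchy seq

  open ℝ public

  infix 4 _≈_

  record _≈_ (x y : ℝ) : Set where
    no-eta-equality
    pattern
    constructor mk≈
    field
      close : ∀ ε → 0ℚ < ε → ∃ λ N → ∀ n → N N.≤ n → ∣ seq x n - seq y n ∣ < ε

  open _≈_ public

  half>0 : ∀ {ε} → 0ℚ < ε → 0ℚ < ½ * ε
  half>0 {ε} 0<ε = ≡.subst (_< ½ * ε) (ℚₚ.*-zeroʳ ½) (ℚₚ.*-monoʳ-<-pos ½ 0<ε)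

  half+half : ∀ ε → ½ * ε + ½ * ε ≡ ε
  half+half ε = ≡.trans (≡.sym (ℚₚ.*-distribʳ-+ ε ½ ½)) (ℚₚ.*-identityˡ ε)

  triangle : ∀ {p q ε} → ∣ p ∣ < ½ * ε → ∣ q ∣ < ½ * ε → ∣ p + q ∣ < ε
  triangle {p} {q} {ε} p< q< = ℚₚ.≤-<-trans (ℚₚ.∣p+q∣≤∣p∣+∣q∣ p q)
    (≡.subst (_ <_) (half+half ε) (ℚₚ.+-mono-< p< q<))

  small-0 : ∀ {p ε} → p ≡ 0ℚ → 0ℚ < ε → ∣ p ∣ < ε
  small-0 ≡.refl 0<ε = 0<ε

  +-close : ∀ {a a′ b b′ ε} → ∣ a - a′ ∣ < ½ * ε → ∣ b - b′ ∣ < ½ * ε →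
            ∣ (a + b) - (a′ + b′) ∣ < ε
  +-close {a} {a′} {b} {b′} {ε} p q =
    ≡.subst (λ z → ∣ z ∣ < ε) (eq a a′ b b′) (triangle {a - a′} p q)
    where
    eq : ∀ a a′ b b′ → (a + - a′) + (b + - b′) ≡ (a + b) + - (a′ + b′)
    eq = solve-∀ ℚ-solver

  neg-close : ∀ {a a′ ε} → ∣ a - a′ ∣ < ε → ∣ - a - - a′ ∣ < ε
  neg-close {a} {a′} {ε} = ≡.subst (_< ε)
    (≡.trans (≡.sym (ℚₚ.∣-p∣≡∣p∣ (a - a′))) (≡.cong ∣_∣ (eq a a′)))
    where
    eq : ∀ a a′ → - (a + - a′) ≡ - a + - (- a′)
    eq = solve-∀ ℚ-solver

  quotient : ∀ M ε → 0ℚ < M → 0ℚ < ε → ∃ λ δ → 0ℚ < δ × M * δ ≡ ε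
  quotient M ε 0<M 0<ε = M⁻¹ * ε
    , ≡.subst (_< M⁻¹ * ε) (ℚₚ.*-zeroʳ M⁻¹) (ℚₚ.*-monoʳ-<-pos M⁻¹ 0<ε)
    , ≡.trans (≡.sym (ℚₚ.*-assoc M M⁻¹ ε))
        (≡.trans (≡.cong (_* ε) (ℚₚ.*-inverseʳ M)) (ℚₚ.*-identityˡ ε))
    where
    instance
      M>0 : Q.Positive M
      M>0 = Q.positive 0<M
      M≢0 : Q.NonZero M
      M≢0 = ℚₚ.pos⇒nonZero M
    M⁻¹ : ℚ
    M⁻¹ = Q.1/ M
    instance
      M⁻¹>0 : Q.Positive M⁻¹
      M⁻¹>0 = ℚₚ.1/pos⇒pos M

  ∣*∣-small : ∀ {p q M δ ε} → 0ℚ < M → M * δ ≡ ε → ∣ p ∣ < M → ∣ q ∣ < δ → ∣ p * q ∣ < ε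
  ∣*∣-small {p} {q} {M} {δ} 0<M ≡.refl p<M q<δ =
    ≡.subst (_< M * δ) (≡.sym (ℚₚ.∣p*q∣≡∣p∣*∣q∣ p q))
      (ℚₚ.≤-<-trans (ℚₚ.*-monoʳ-≤-nonNeg ∣ q ∣ {{Q.nonNegative (ℚₚ.0≤∣p∣ q)}} (ℚₚ.<⇒≤ p<M))
                    (ℚₚ.*-monoʳ-<-pos M {{Q.positive 0<M}} q<δ))

  *-close : ∀ {a a′ b b′ M M′ δ δ′ ε} → 0ℚ < M → 0ℚ < M′ → M * δ ≡ ½ * ε → M′ * δ′ ≡ ½ * ε →
            ∣ a ∣ < M → ∣ b′ ∣ < M′ → ∣ b - b′ ∣ < δ → ∣ a - a′ ∣ < δ′ →
            ∣ a * b - a′ * b′ ∣ < ε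
  *-close {a} {a′} {b} {b′} {ε = ε} 0<M 0<M′ e e′ a<M b′<M′ b∼ a∼ =
    ≡.subst (λ z → ∣ z ∣ < ε) (eq a a′ b b′)
      (triangle {a * (b - b′)} (∣*∣-small {a} {b - b′} 0<M e a<M b∼)
                               (∣*∣-small {b′} {a - a′} 0<M′ e′ b′<M′ a∼))
    where
    eq : ∀ a a′ b b′ → a * (b + - b′) + b′ * (a + - a′) ≡ a * b + - (a′ * b′)
    eq = solve-∀ ℚ-solver

  bound : (x : ℝ) → ∃ λ M → 0ℚ < M × ∃ λ N → ∀ n → N N.≤ n → ∣ seq x n ∣ < M
  bound x with cauchy x 1ℚ (Q.*<* (Z.+<+ (N.s≤s N.z≤n)))
  ... | N , c = 1ℚ + ∣ seq x N ∣
    , ℚₚ.<-≤-trans (ℚₚ.positive⁻¹ 1ℚ)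
        (≡.subst (_≤ 1ℚ + ∣ seq x N ∣) (ℚₚ.+-identityʳ 1ℚ) (ℚₚ.+-monoʳ-≤ 1ℚ (ℚₚ.0≤∣p∣ (seq x N))))
    , N , λ n N≤n → ℚₚ.≤-<-trans
        (≡.subst (λ z → ∣ z ∣ ≤ ∣ seq x n - seq x N ∣ + ∣ seq x N ∣) (eq (seq x n) (seq x N))
          (ℚₚ.∣p+q∣≤∣p∣+∣q∣ (seq x n - seq x N) (seq x N)))
        (ℚₚ.+-mono-<-≤ (c n N N≤n ℕₚ.≤-refl) ℚₚ.≤-refl)
    where
    eq : ∀ a b → (a + - b) + b ≡ a
    eq = solve-∀ ℚ-solver

  ⊔≤ˡ : ∀ {m n o} → m ⊔ n N.≤ o → m N.≤ o
  ⊔≤ˡ {m} {n} = ℕₚ.≤-trans (ℕₚ.m≤m⊔n m n)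

  ⊔≤ʳ : ∀ {m n o} → m ⊔ n N.≤ o → n N.≤ o
  ⊔≤ʳ {m} {n} = ℕₚ.≤-trans (ℕₚ.m≤n⊔m m n)

  fromℚ : ℚ → ℝ
  fromℚ q = mkℝ (λ _ → q) λ ε 0<ε → 0 , λ _ _ _ _ → small-0 (ℚₚ.+-inverseʳ q) 0<ε

  infixl 6 _⊕_
  infixl 7 _⊗_

  private
    abstract
      ⊕-cauchy : ∀ x y → IsCauchy (λ n → seq x n + seq y n)
      ⊕-cauchy x y ε 0<ε =
        let N , p = cauchy x (½ * ε) (half>0 0<ε)
            K , q = cauchy y (½ * ε) (half>0 0<ε)
        in N ⊔ K , λ m n m≥ n≥ → +-close {seq x m} {seq x n}
             (p m n (⊔≤ˡ m≥) (⊔≤ˡ n≥)) (q m n (⊔≤ʳ {N} m≥) (⊔≤ʳ {N} n≥))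

      ⊝-cauchy : ∀ x → IsCauchy (λ n → - seq x n)
      ⊝-cauchy x ε 0<ε =
        let N , p = cauchy x ε 0<ε
        in N , λ m n m≥ n≥ → neg-close {seq x m} (p m n m≥ n≥)

      ⊗-cauchy : ∀ x y → IsCauchy (λ n → seq x n * seq y n)
      ⊗-cauchy x y ε 0<ε =
        let M  , 0<M  , N₁ , bx = bound x
            M′ , 0<M′ , N₂ , by = bound y
            δ  , 0<δ  , e  = quotient M  (½ * ε) 0<M  (half>0 0<ε)
            δ′ , 0<δ′ , e′ = quotient M′ (½ * ε) 0<M′ (half>0 0<ε)
            N₃ , p = cauchy x δ′ 0<δ′
            N₄ , q = cauchy y δ  0<δ
        in (N₁ ⊔ N₂) ⊔ (N₃ ⊔ N₄) , λ m n m≥ n≥ →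
             *-close {seq x m} {seq x n} 0<M 0<M′ e e′
               (bx m (⊔≤ˡ {N₁} (⊔≤ˡ m≥))) (by n (⊔≤ʳ {N₁} (⊔≤ˡ n≥)))
               (q m n (⊔≤ʳ {N₃} (⊔≤ʳ {N₁ ⊔ N₂} m≥)) (⊔≤ʳ {N₃} (⊔≤ʳ {N₁ ⊔ N₂} n≥)))
               (p m n (⊔≤ˡ {N₃} (⊔≤ʳ {N₁ ⊔ N₂} m≥)) (⊔≤ˡ {N₃} (⊔≤ʳ {N₁ ⊔ N₂} n≥)))

  _⊕_ _⊗_ : ℝ → ℝ → ℝ
  x ⊕ y = mkℝ (λ n → seq x n + seq y n) (⊕-cauchy x y)
  x ⊗ y = mkℝ (λ n → seq x n * seq y n) (⊗-cauchy x y)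

  ⊝_ : ℝ → ℝ
  ⊝ x = mkℝ (λ n → - seq x n) (⊝-cauchy x)

  pointwise : ∀ {x y} → (∀ n → seq x n ≡ seq y n) → x ≈ y
  pointwise {x} {y} p = mk≈ λ ε 0<ε → 0 , λ n _ →
    small-0 (≡.trans (≡.cong (_- seq y n) (p n)) (ℚₚ.+-inverseʳ (seq y n))) 0<ε

  ≈-refl : ∀ {x} → x ≈ x
  ≈-refl = pointwise λ _ → ≡.refl

  ≈-sym : ∀ {x y} → x ≈ y → y ≈ x
  ≈-sym {x} {y} (mk≈ p) = mk≈ λ ε 0<ε → let N , c = p ε 0<ε in
    N , λ n n≥ → ≡.subst (_< ε)
      (≡.trans (≡.sym (ℚₚ.∣-p∣≡∣p∣ (seq x n - seq y n))) (≡.cong ∣_∣ (eq (seq x n) (seq y n))))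
      (c n n≥)
    where
    eq : ∀ a b → - (a + - b) ≡ b + - a
    eq = solve-∀ ℚ-solver

  ≈-trans : ∀ {x y z} → x ≈ y → y ≈ z → x ≈ z
  ≈-trans {x} {y} {z} (mk≈ p) (mk≈ q) = mk≈ λ ε 0<ε →
    let N , c = p (½ * ε) (half>0 0<ε)
        K , d = q (½ * ε) (half>0 0<ε)
    in N ⊔ K , λ n n≥ → ≡.subst (λ t → ∣ t ∣ < ε) (eq (seq x n) (seq y n) (seq z n))
         (triangle {seq x n - seq y n} (c n (⊔≤ˡ n≥)) (d n (⊔≤ʳ {N} n≥)))
    where
    eq : ∀ a b c → (a + - b) + (b + - c) ≡ a + - c
    eq = solve-∀ ℚ-solver

  ⊕-cong : ∀ {x x′ y y′} → x ≈ x′ → y ≈ y′ → x ⊕ y ≈ x′ ⊕ y′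
  ⊕-cong {x} {x′} (mk≈ p) (mk≈ q) = mk≈ λ ε 0<ε →
    let N , c = p (½ * ε) (half>0 0<ε)
        K , d = q (½ * ε) (half>0 0<ε)
    in N ⊔ K , λ n n≥ → +-close {seq x n} {seq x′ n} (c n (⊔≤ˡ n≥)) (d n (⊔≤ʳ {N} n≥))

  ⊝-cong : ∀ {x x′} → x ≈ x′ → ⊝ x ≈ ⊝ x′
  ⊝-cong {x} (mk≈ p) = mk≈ λ ε 0<ε →
    let N , c = p ε 0<ε in N , λ n n≥ → neg-close {seq x n} (c n n≥)

  ⊗-cong : ∀ {x x′ y y′} → x ≈ x′ → y ≈ y′ → x ⊗ y ≈ x′ ⊗ y′
  ⊗-cong {x} {x′} {y} {y′} (mk≈ p) (mk≈ q) = mk≈ λ ε 0<ε →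
    let M  , 0<M  , N₁ , bx = bound x
        M′ , 0<M′ , N₂ , by = bound y′
        δ  , 0<δ  , e  = quotient M  (½ * ε) 0<M  (half>0 0<ε)
        δ′ , 0<δ′ , e′ = quotient M′ (½ * ε) 0<M′ (half>0 0<ε)
        N₃ , c = p δ′ 0<δ′
        N₄ , d = q δ  0<δ
    in (N₁ ⊔ N₂) ⊔ (N₃ ⊔ N₄) , λ n n≥ →
         *-close {seq x n} {seq x′ n} 0<M 0<M′ e e′
           (bx n (⊔≤ˡ {N₁} (⊔≤ˡ n≥))) (by n (⊔≤ʳ {N₁} (⊔≤ˡ n≥)))
           (d n (⊔≤ʳ {N₃} (⊔≤ʳ {N₁ ⊔ N₂} n≥)))
           (c n (⊔≤ˡ {N₃} (⊔≤ʳ {N₁ ⊔ N₂} n≥)))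

  ≈-isEquivalence : IsEquivalence _≈_
  ≈-isEquivalence = record { refl = ≈-refl ; sym = ≈-sym ; trans = ≈-trans }

  ≈-setoid : Setoid 0ℓ 0ℓ
  ≈-setoid = record { isEquivalence = ≈-isEquivalence }

  0ℝ 1ℝ : ℝ
  0ℝ = fromℚ 0ℚ
  1ℝ = fromℚ 1ℚ

  ⊕-assoc : ∀ x y z → (x ⊕ y) ⊕ z ≈ x ⊕ (y ⊕ z)
  ⊕-assoc x y z = pointwise λ n → ℚₚ.+-assoc (seq x n) (seq y n) (seq z n)

  ⊕-comm : ∀ x y → x ⊕ y ≈ y ⊕ x
  ⊕-comm x y = pointwise λ n → ℚₚ.+-comm (seq x n) (seq y n)

  ⊕-identityˡ : ∀ x → 0ℝ ⊕ x ≈ x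
  ⊕-identityˡ x = pointwise λ n → ℚₚ.+-identityˡ (seq x n)

  ⊕-inverseˡ : ∀ x → ⊝ x ⊕ x ≈ 0ℝ
  ⊕-inverseˡ x = pointwise λ n → ℚₚ.+-inverseˡ (seq x n)

  ⊗-assoc : ∀ x y z → (x ⊗ y) ⊗ z ≈ x ⊗ (y ⊗ z)
  ⊗-assoc x y z = pointwise λ n → ℚₚ.*-assoc (seq x n) (seq y n) (seq z n)

  ⊗-comm : ∀ x y → x ⊗ y ≈ y ⊗ x
  ⊗-comm x y = pointwise λ n → ℚₚ.*-comm (seq x n) (seq y n)

  ⊗-identityˡ : ∀ x → 1ℝ ⊗ x ≈ x
  ⊗-identityˡ x = pointwise λ n → ℚₚ.*-identityˡ (seq x n)

  ⊗-distribˡ-⊕ : ∀ x y z → x ⊗ (y ⊕ z) ≈ (x ⊗ y) ⊕ (x ⊗ z)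
  ⊗-distribˡ-⊕ x y z = pointwise λ n → ℚₚ.*-distribˡ-+ (seq x n) (seq y n) (seq z n)

  commutativeRing : CommutativeRing 0ℓ 0ℓ
  commutativeRing = record
    { Carrier = ℝ ; _≈_ = _≈_ ; _+_ = _⊕_ ; _*_ = _⊗_ ; -_ = ⊝_ ; 0# = 0ℝ ; 1# = 1ℝ
    ; isCommutativeRing = record
      { isRing = record
        { +-isAbelianGroup = record
          { isGroup = record
            { isMonoid = record
              { isSemigroup = record
                { isMagma = record { isEquivalence = ≈-isEquivalence ; ∙-cong = ⊕-cong }
                ; assoc = ⊕-assoc }
              ; identity = comm∧idˡ⇒id ⊕-comm ⊕-identityˡ }
            ; inverse = comm∧invˡ⇒inv ⊕-comm ⊕-inverseˡ
            ; ⁻¹-cong = ⊝-cong }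
          ; comm = ⊕-comm }
        ; *-cong = ⊗-cong
        ; *-assoc = ⊗-assoc
        ; *-identity = comm∧idˡ⇒id ⊗-comm ⊗-identityˡ
        ; distrib = comm∧distrˡ⇒distr ⊕-cong ⊗-comm ⊗-distribˡ-⊕ }
      ; *-comm = ⊗-comm } }
    where
    open import Algebra.Consequences.Setoid ≈-setoid

module Complex where

  open Real using (ℝ; seq; 0ℝ; 1ℝ; _≈_) renaming (_⊕_ to _+_; _⊗_ to _*_; ⊝_ to -_)
  open CommutativeRing Real.commutativeRing hiding (Carrier; _≈_; _+_; _*_; -_; 0#; 1#)

  record ℂ : Set where
    no-eta-equality
    pattern
    constructor _+i_
    field
      re im : ℝ

  open ℂ public

  record _≈ᶜ_ (z w : ℂ) : Set where
    constructor mk≈ᶜ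
    field
      re≈ : re z ≈ re w
      im≈ : im z ≈ im w

  _+ᶜ_ _*ᶜ_ : ℂ → ℂ → ℂ
  (a +i b) +ᶜ (c +i d) = (a + c) +i (b + d)
  (a +i b) *ᶜ (c +i d) = (a * c + - (b * d)) +i (a * d + b * c)

  -ᶜ_ : ℂ → ℂ
  -ᶜ (a +i b) = (- a) +i (- b)

  fromℚ : ℚ → ℂ
  fromℚ q = Real.fromℚ q +i 0ℝ

  𝐢 : ℂ
  𝐢 = 0ℝ +i 1ℝ

  private
    assoc-re : ∀ a b c d e f → (a * c + - (b * d)) * e + - ((a * d + b * c) * f) ≈ a * (c * e + - (d * f)) + - (b * (c * f + d * e))
    assoc-re a b c d e f = Real.pointwise λ n → eq (seq a n) (seq b n) (seq c n) (seq d n) (seq e n) (seq f n)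
      where
      eq : ∀ a b c d e f → (a Q.* c Q.+ Q.- (b Q.* d)) Q.* e Q.+ Q.- ((a Q.* d Q.+ b Q.* c) Q.* f) ≡ a Q.* (c Q.* e Q.+ Q.- (d Q.* f)) Q.+ Q.- (b Q.* (c Q.* f Q.+ d Q.* e))
      eq = solve-∀ Real.ℚ-solver

    assoc-im : ∀ a b c d e f → (a * c + - (b * d)) * f + (a * d + b * c) * e ≈ a * (c * f + d * e) + b * (c * e + - (d * f))
    assoc-im a b c d e f = Real.pointwise λ n → eq (seq a n) (seq b n) (seq c n) (seq d n) (seq e n) (seq f n)
      where
      eq : ∀ a b c d e f → (a Q.* c Q.+ Q.- (b Q.* d)) Q.* f Q.+ (a Q.* d Q.+ b Q.* c) Q.* e ≡ a Q.* (c Q.* f Q.+ d Q.* e) Q.+ b Q.* (c Q.* e Q.+ Q.- (d Q.* f))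
      eq = solve-∀ Real.ℚ-solver

    distribˡ-re : ∀ a b c d e f → a * (c + e) + - (b * (d + f)) ≈ (a * c + - (b * d)) + (a * e + - (b * f))
    distribˡ-re a b c d e f = Real.pointwise λ n → eq (seq a n) (seq b n) (seq c n) (seq d n) (seq e n) (seq f n)
      where
      eq : ∀ a b c d e f → a Q.* (c Q.+ e) Q.+ Q.- (b Q.* (d Q.+ f)) ≡ (a Q.* c Q.+ Q.- (b Q.* d)) Q.+ (a Q.* e Q.+ Q.- (b Q.* f))
      eq = solve-∀ Real.ℚ-solver

    distribˡ-im : ∀ a b c d e f → a * (d + f) + b * (c + e) ≈ (a * d + b * c) + (a * f + b * e)
    distribˡ-im a b c d e f = Real.pointwise λ n → eq (seq a n) (seq b n) (seq c n) (seq d n) (seq e n) (seq f n)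
      where
      eq : ∀ a b c d e f → a Q.* (d Q.+ f) Q.+ b Q.* (c Q.+ e) ≡ (a Q.* d Q.+ b Q.* c) Q.+ (a Q.* f Q.+ b Q.* e)
      eq = solve-∀ Real.ℚ-solver

    comm-re : ∀ a b c d → a * c + - (b * d) ≈ c * a + - (d * b)
    comm-re a b c d = Real.pointwise λ n → eq (seq a n) (seq b n) (seq c n) (seq d n)
      where
      eq : ∀ a b c d → a Q.* c Q.+ Q.- (b Q.* d) ≡ c Q.* a Q.+ Q.- (d Q.* b)
      eq = solve-∀ Real.ℚ-solver

    comm-im : ∀ a b c d → a * d + b * c ≈ c * b + d * a
    comm-im a b c d = Real.pointwise λ n → eq (seq a n) (seq b n) (seq c n) (seq d n)
      where
      eq : ∀ a b c d → a Q.* d Q.+ b Q.* c ≡ c Q.* b Q.+ d Q.* a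
      eq = solve-∀ Real.ℚ-solver

    identityˡ-re : ∀ a b → 1ℝ * a + - (0ℝ * b) ≈ a
    identityˡ-re a b = Real.pointwise λ n → eq (seq a n) (seq b n)
      where
      eq : ∀ a b → 1ℚ Q.* a Q.+ Q.- (0ℚ Q.* b) ≡ a
      eq = solve-∀ Real.ℚ-solver

    identityˡ-im : ∀ a b → 1ℝ * b + 0ℝ * a ≈ b
    identityˡ-im a b = Real.pointwise λ n → eq (seq a n) (seq b n)
      where
      eq : ∀ a b → 1ℚ Q.* b Q.+ 0ℚ Q.* a ≡ b
      eq = solve-∀ Real.ℚ-solver

    ≈ᶜ-trans : ∀ {x y z} → x ≈ᶜ y → y ≈ᶜ z → x ≈ᶜ z
    ≈ᶜ-trans (mk≈ᶜ p q) (mk≈ᶜ p′ q′) = mk≈ᶜ (trans p p′) (trans q q′)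

    ≈ᶜ-isEquivalence : IsEquivalence _≈ᶜ_
    ≈ᶜ-isEquivalence = record
      { refl  = mk≈ᶜ refl refl
      ; sym   = λ (mk≈ᶜ p q) → mk≈ᶜ (sym p) (sym q)
      ; trans = ≈ᶜ-trans }

    +ᶜ-cong : ∀ {x x′ y y′} → x ≈ᶜ x′ → y ≈ᶜ y′ → (x +ᶜ y) ≈ᶜ (x′ +ᶜ y′)
    +ᶜ-cong {_ +i _} {_ +i _} {_ +i _} {_ +i _} (mk≈ᶜ p q) (mk≈ᶜ p′ q′) = mk≈ᶜ (+-cong p p′) (+-cong q q′)

    -ᶜ-cong : ∀ {x x′} → x ≈ᶜ x′ → (-ᶜ x) ≈ᶜ (-ᶜ x′)
    -ᶜ-cong {_ +i _} {_ +i _} (mk≈ᶜ p q) = mk≈ᶜ (-‿cong p) (-‿cong q)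

    *ᶜ-cong : ∀ {x x′ y y′} → x ≈ᶜ x′ → y ≈ᶜ y′ → (x *ᶜ y) ≈ᶜ (x′ *ᶜ y′)
    *ᶜ-cong {_ +i _} {_ +i _} {_ +i _} {_ +i _} (mk≈ᶜ p q) (mk≈ᶜ p′ q′) =
      mk≈ᶜ (+-cong (*-cong p p′) (-‿cong (*-cong q q′))) (+-cong (*-cong p q′) (*-cong q p′))

    +ᶜ-assoc : ∀ x y z → ((x +ᶜ y) +ᶜ z) ≈ᶜ (x +ᶜ (y +ᶜ z))
    +ᶜ-assoc (a +i b) (c +i d) (e +i f) = mk≈ᶜ (+-assoc a c e) (+-assoc b d f)

    +ᶜ-comm : ∀ x y → (x +ᶜ y) ≈ᶜ (y +ᶜ x)
    +ᶜ-comm (a +i b) (c +i d) = mk≈ᶜ (+-comm a c) (+-comm b d)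

    +ᶜ-identityˡ : ∀ x → (fromℚ 0ℚ +ᶜ x) ≈ᶜ x
    +ᶜ-identityˡ (a +i b) = mk≈ᶜ (+-identityˡ a) (+-identityˡ b)

    -ᶜ-inverseˡ : ∀ x → ((-ᶜ x) +ᶜ x) ≈ᶜ fromℚ 0ℚ
    -ᶜ-inverseˡ (a +i b) = mk≈ᶜ (-‿inverseˡ a) (-‿inverseˡ b)

    *ᶜ-assoc : ∀ x y z → ((x *ᶜ y) *ᶜ z) ≈ᶜ (x *ᶜ (y *ᶜ z))
    *ᶜ-assoc (a +i b) (c +i d) (e +i f) = mk≈ᶜ (assoc-re a b c d e f) (assoc-im a b c d e f)

    *ᶜ-comm : ∀ x y → (x *ᶜ y) ≈ᶜ (y *ᶜ x)
    *ᶜ-comm (a +i b) (c +i d) = mk≈ᶜ (comm-re a b c d) (comm-im a b c d)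

    *ᶜ-distribˡ : ∀ x y z → (x *ᶜ (y +ᶜ z)) ≈ᶜ ((x *ᶜ y) +ᶜ (x *ᶜ z))
    *ᶜ-distribˡ (a +i b) (c +i d) (e +i f) = mk≈ᶜ (distribˡ-re a b c d e f) (distribˡ-im a b c d e f)

    *ᶜ-identityˡ : ∀ x → (fromℚ 1ℚ *ᶜ x) ≈ᶜ x
    *ᶜ-identityˡ (a +i b) = mk≈ᶜ (identityˡ-re a b) (identityˡ-im a b)

  commutativeRing : CommutativeRing 0ℓ 0ℓ
  commutativeRing = record
    { Carrier = ℂ ; _≈_ = _≈ᶜ_ ; _+_ = _+ᶜ_ ; _*_ = _*ᶜ_ ; -_ = -ᶜ_
    ; 0# = fromℚ 0ℚ ; 1# = fromℚ 1ℚ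
    ; isCommutativeRing = record
      { isRing = record
        { +-isAbelianGroup = record
          { isGroup = record
            { isMonoid = record
              { isSemigroup = record
                { isMagma = record { isEquivalence = ≈ᶜ-isEquivalence ; ∙-cong = +ᶜ-cong }
                ; assoc = +ᶜ-assoc }
              ; identity = +ᶜ-identityˡ , λ x → ≈ᶜ-trans (+ᶜ-comm x (fromℚ 0ℚ)) (+ᶜ-identityˡ x) }
            ; inverse = -ᶜ-inverseˡ , λ x → ≈ᶜ-trans (+ᶜ-comm x (-ᶜ x)) (-ᶜ-inverseˡ x)
            ; ⁻¹-cong = -ᶜ-cong }
          ; comm = +ᶜ-comm }
        ; *-cong = *ᶜ-cong
        ; *-assoc = *ᶜ-assoc
        ; *-identity = *ᶜ-identityˡ , λ x → ≈ᶜ-trans (*ᶜ-comm x (fromℚ 1ℚ)) (*ᶜ-identityˡ x)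
        ; distrib = *ᶜ-distribˡ , λ x y z → ≈ᶜ-trans (*ᶜ-comm (y +ᶜ z) x)
            (≈ᶜ-trans (*ᶜ-distribˡ x y z) (+ᶜ-cong (*ᶜ-comm x y) (*ᶜ-comm x z))) }
      ; *-comm = *ᶜ-comm } }

open Complex using (ℂ; re; im; 𝐢; fromℚ) public
module C = CommutativeRing Complex.commutativeRing
open C using (_+_; _*_; -_; 0#; 1#; _≈_)
open import Algebra.Properties.Monoid.Sum C.+-monoid using (sum)

fromℤ : ℤ → ℂ
fromℤ n = fromℚ (n Q./ 1)

-- The value at 0 is a placeholder: below, only differences of distinct
-- eigenvalues are inverted.
reciprocal : ℤ → ℚ
reciprocal +0       = 0ℚ
reciprocal +[1+ n ] = + 1 Q./ suc n
reciprocal -[1+ n ] = -[1+ 0 ] Q./ suc n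

X : ℕ → Set
X D = Vec (Fin 2) D

V : ℕ → Set
V D = X D → ℂ

Mat : ℕ → Set
Mat D = X D → X D → ℂ

∑X : ∀ {D} → V D → ℂ
∑X {zero}  f = f []
∑X {suc D} f = ∑X (λ y → f (zero ∷ y)) + ∑X (λ y → f (suc zero ∷ y))

infix  4 _≈ᵥ_ _≉ᵥ_ _≈ₘ_
infixl 6 _+ᵥ_ _+ₘ_ _-ₘ_
infixr 7 _•ᵥ_ _•ₘ_
infixr 8 _·ᵥ_ _·ₘ_

_≈ᵥ_ _≉ᵥ_ : ∀ {D} → V D → V D → Set
u ≈ᵥ v = ∀ y → u y ≈ v y
u ≉ᵥ v = ¬ u ≈ᵥ v

0ᵥ : ∀ {D} → V D
0ᵥ _ = 0#

_+ᵥ_ : ∀ {D} → V D → V D → V D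
(u +ᵥ v) y = u y + v y

_•ᵥ_ : ∀ {D} → ℂ → V D → V D
(c •ᵥ v) y = c * v y

lincomb : ∀ {D n} → (Fin n → ℂ) → (Fin n → V D) → V D
lincomb c v y = sum (λ i → c i * v i y)

_≈ₘ_ : ∀ {D} → Mat D → Mat D → Set
M ≈ₘ N = ∀ y z → M y z ≈ N y z

_+ₘ_ _-ₘ_ _·ₘ_ : ∀ {D} → Mat D → Mat D → Mat D
(M +ₘ N) y z = M y z + N y z
(M -ₘ N) y z = M y z + - N y z
(M ·ₘ N) y z = ∑X (λ w → M y w * N w z)

_•ₘ_ : ∀ {D} → ℂ → Mat D → Mat D
(c •ₘ M) y z = c * M y z

_·ᵥ_ : ∀ {D} → Mat D → V D → V D
(M ·ᵥ v) y = ∑X (λ z → M y z * v z)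

diag : ∀ {D} → V D → Mat D
diag f y z = if does (Vecₚ.≡-dec Finₚ._≟_ y z) then f y else 0#

I : ∀ {D} → Mat D
I = diag (λ _ → 1#)

-- The number of coordinates in which two vertices differ.
differences : ∀ {D} → X D → X D → ℕ
differences []      []      = 0
differences (a ∷ y) (b ∷ z) = if does (a Finₚ.≟ b) then differences y z else suc (differences y z)

Adjacent : ∀ {D} → X D → X D → Set
Adjacent y z = differences y z ≡ 1

data Walk {D} : X D → X D → ℕ → Set where
  stop : ∀ {y} → Walk y y 0
  step : ∀ {y w z n} → Adjacent y w → Walk w z n → Walk y z (suc n)

IsDistance : ∀ {D} → X D → X D → ℕ → Set
IsDistance y z n = Walk y z n × (∀ m → Walk y z m → n N.≤ m)

differences-refl : ∀ {D} (y : X D) → differences y y ≡ 0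
differences-refl []      = ≡.refl
differences-refl (a ∷ y) with a Finₚ.≟ a
... | yes _  = differences-refl y
... | no a≢a = contradiction ≡.refl a≢a

differences-triangle : ∀ {D} (y w z : X D) → differences y z N.≤ differences y w N.+ differences w z
differences-triangle []      []      []      = N.z≤n
differences-triangle (a ∷ y) (b ∷ w) (c ∷ z)
  with differences-triangle y w z | a Finₚ.≟ b | b Finₚ.≟ c | a Finₚ.≟ c
... | h | yes _      | yes _      | yes _  = h
... | h | yes ≡.refl | yes ≡.refl | no a≢a = contradiction ≡.refl a≢a
... | h | yes ≡.refl | no b≢c     | yes eq = contradiction eq b≢c
... | h | yes _      | no _       | no _   = ℕₚ.≤-trans (N.s≤s h) (ℕₚ.≤-reflexive (≡.sym (ℕₚ.+-suc _ _)))
... | h | no _       | yes _      | yes _  = ℕₚ.m≤n⇒m≤1+n h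
... | h | no _       | yes _      | no _   = N.s≤s h
... | h | no _       | no _       | yes _  = ℕₚ.m≤n⇒m≤1+n (ℕₚ.≤-trans h (ℕₚ.+-monoʳ-≤ _ (ℕₚ.n≤1+n _)))
... | h | no _       | no _       | no _   = N.s≤s (ℕₚ.≤-trans h (ℕₚ.+-monoʳ-≤ _ (ℕₚ.n≤1+n _)))

distance : ∀ {D} (y z : X D) → ∃ (IsDistance y z)
distance y z = differences y z , shortest y z , λ m → minimal y z
  where
  extend : ∀ {D} a {y z : X D} {n} → Walk y z n → Walk (a ∷ y) (a ∷ z) n
  extend a stop = stop
  extend a (step {y} {w} adj p) = step adj′ (extend a p)
    where
    adj′ : differences (a ∷ y) (a ∷ w) ≡ 1
    adj′ with a Finₚ.≟ a
    ... | yes _  = adj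
    ... | no a≢a = contradiction ≡.refl a≢a

  shortest : ∀ {D} (y z : X D) → Walk y z (differences y z)
  shortest []      []      = stop
  shortest (a ∷ y) (b ∷ z) with a Finₚ.≟ b in eq
  ... | yes ≡.refl = extend a (shortest y z)
  ... | no _       = step adj (extend b (shortest y z))
    where
    adj : differences (a ∷ y) (b ∷ y) ≡ 1
    adj rewrite eq = ≡.cong suc (differences-refl y)

  minimal : ∀ {D} (y z : X D) {m} → Walk y z m → differences y z N.≤ m
  minimal y .y stop = ℕₚ.≤-reflexive (differences-refl y)
  minimal y z (step {w = w} adj p) = ℕₚ.≤-trans (differences-triangle y w z)
    (ℕₚ.+-mono-≤ (ℕₚ.≤-reflexive adj) (minimal w z p))

∂ : ∀ {D} → X D → X D → ℕ
∂ y z = proj₁ (distance y z)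

x₀ : ∀ {D} → X D
x₀ = Vec.replicate _ zero

θ : ℕ → ℕ → ℤ
θ D i = + D Z.- + (2 N.* i)

A : ∀ {D} → Mat D
A y z = if does (differences y z ℕₚ.≟ 1) then 1# else 0#

A* : ∀ {D} → Mat D
A* {D} = diag (λ y → fromℤ (θ D (∂ x₀ y)))

Aᵋ : ∀ {D} → Mat D
Aᵋ = (- 𝐢 * fromℚ ½) •ₘ (A ·ₘ A* -ₘ A* ·ₘ A)

-- Only meaningful for i ≤ D.
E : ∀ {D} → ℕ → Mat D
E {D} i = List.foldr _·ₘ_ I (List.map factor (List.filter (λ j → ¬? (j ℕₚ.≟ i)) (List.upTo (suc D))))
  where
  factor : ℕ → Mat D
  factor j = fromℚ (reciprocal (θ D i Z.- θ D j)) •ₘ (A -ₘ fromℤ (θ D j) •ₘ I)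

E* : ∀ {D} → ℕ → Mat D
E* i = diag (λ y → if does (∂ x₀ y ℕₚ.≟ i) then 1# else 0#)

Mat₂ : Set
Mat₂ = Fin 2 → Fin 2 → ℂ

kroneckerPower : ∀ {D} → Mat₂ → Mat D
kroneckerPower M []      []      = 1#
kroneckerPower M (a ∷ y) (b ∷ z) = M a b * kroneckerPower M y z

P₁ P₁⁻¹ : Mat₂
P₁ zero       zero       = 1#
P₁ zero       (suc zero) = 1#
P₁ (suc zero) zero       = - 𝐢
P₁ (suc zero) (suc zero) = 𝐢

P₁⁻¹ zero       zero       = fromℚ ½
P₁⁻¹ zero       (suc zero) = fromℚ ½ * 𝐢
P₁⁻¹ (suc zero) zero       = fromℚ ½
P₁⁻¹ (suc zero) (suc zero) = fromℚ ½ * - 𝐢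

P P⁻¹ : ∀ {D} → Mat D
P   = kroneckerPower P₁
P⁻¹ = kroneckerPower P₁⁻¹

∑X-cong : ∀ {D} {f g : V D} → f ≈ᵥ g → ∑X f ≈ ∑X g
∑X-cong {zero}  p = p []
∑X-cong {suc D} p = C.+-cong (∑X-cong λ y → p (zero ∷ y)) (∑X-cong λ y → p (suc zero ∷ y))

∑X-*ˡ : ∀ {D} c (f : V D) → ∑X (λ y → c * f y) ≈ c * ∑X f
∑X-*ˡ {zero}  c f = C.refl
∑X-*ˡ {suc D} c f = C.trans
  (C.+-cong (∑X-*ˡ c λ y → f (zero ∷ y)) (∑X-*ˡ c λ y → f (suc zero ∷ y)))
  (C.sym (C.distribˡ c _ _))

private
  _·₂_ : Mat₂ → Mat₂ → Mat₂
  (M ·₂ N) a b = M a zero * N zero b + M a (suc zero) * N (suc zero) b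

  I₂ : Mat₂
  I₂ a b = if does (a Finₚ.≟ b) then 1# else 0#

  interchange : ∀ a b c d → (a * b) * (c * d) ≈ (a * c) * (b * d)
  interchange = CommutativeSemigroupProperties.interchange
    where import Algebra.Properties.CommutativeSemigroup C.*-commutativeSemigroup as CommutativeSemigroupProperties

  kroneckerPower-· : ∀ {D} (M N : Mat₂) →
    kroneckerPower {D} M ·ₘ kroneckerPower N ≈ₘ kroneckerPower (M ·₂ N)
  kroneckerPower-· M N []      []      = C.*-identityˡ 1#
  kroneckerPower-· M N (a ∷ y) (b ∷ z) = C.trans (C.+-cong (half zero) (half (suc zero)))
    (C.sym (C.distribʳ (kroneckerPower (M ·₂ N) y z) _ _))
    where
    half : ∀ c → ∑X (λ w → (M a c * kroneckerPower M y w) * (N c b * kroneckerPower N w z))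
               ≈ (M a c * N c b) * kroneckerPower (M ·₂ N) y z
    half c = C.trans (∑X-cong λ w → interchange (M a c) (kroneckerPower M y w) (N c b) (kroneckerPower N w z))
      (C.trans (∑X-*ˡ (M a c * N c b) (λ w → kroneckerPower M y w * kroneckerPower N w z))
        (C.*-congˡ (kroneckerPower-· M N y z)))

  kroneckerPower-I : ∀ {D} (M : Mat₂) → (∀ a b → M a b ≈ I₂ a b) → kroneckerPower {D} M ≈ₘ I
  kroneckerPower-I M p []      []      = C.refl
  kroneckerPower-I M p (a ∷ y) (b ∷ z) with a Finₚ.≟ b | p a b
  ... | no _  | q = C.trans (C.*-congʳ q) (C.zeroˡ _)
  ... | yes _ | q with Vecₚ.≡-dec Finₚ._≟_ y z | kroneckerPower-I M p y z
  ...   | yes _ | r = C.trans (C.*-cong q r) (C.*-identityˡ _)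
  ...   | no _  | r = C.trans (C.*-cong q r) (C.zeroʳ _)

  byComputation : ∀ {z w} → (∀ n → Real.seq (re z) n ≡ Real.seq (re w) n) →
                            (∀ n → Real.seq (im z) n ≡ Real.seq (im w) n) → z ≈ w
  byComputation p q = Complex.mk≈ᶜ (Real.pointwise p) (Real.pointwise q)

  P₁P₁⁻¹ : ∀ a b → (P₁ ·₂ P₁⁻¹) a b ≈ I₂ a b
  P₁P₁⁻¹ zero       zero       = byComputation (λ _ → ≡.refl) (λ _ → ≡.refl)
  P₁P₁⁻¹ zero       (suc zero) = byComputation (λ _ → ≡.refl) (λ _ → ≡.refl)
  P₁P₁⁻¹ (suc zero) zero       = byComputation (λ _ → ≡.refl) (λ _ → ≡.refl)
  P₁P₁⁻¹ (suc zero) (suc zero) = byComputation (λ _ → ≡.refl) (λ _ → ≡.refl)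

  P₁⁻¹P₁ : ∀ a b → (P₁⁻¹ ·₂ P₁) a b ≈ I₂ a b
  P₁⁻¹P₁ zero       zero       = byComputation (λ _ → ≡.refl) (λ _ → ≡.refl)
  P₁⁻¹P₁ zero       (suc zero) = byComputation (λ _ → ≡.refl) (λ _ → ≡.refl)
  P₁⁻¹P₁ (suc zero) zero       = byComputation (λ _ → ≡.refl) (λ _ → ≡.refl)
  P₁⁻¹P₁ (suc zero) (suc zero) = byComputation (λ _ → ≡.refl) (λ _ → ≡.refl)

P-inverseʳ : ∀ {D} → P {D} ·ₘ P⁻¹ ≈ₘ I
P-inverseʳ y z = C.trans (kroneckerPower-· P₁ P₁⁻¹ y z) (kroneckerPower-I (P₁ ·₂ P₁⁻¹) P₁P₁⁻¹ y z)

P-inverseˡ : ∀ {D} → P⁻¹ {D} ·ₘ P ≈ₘ I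
P-inverseˡ y z = C.trans (kroneckerPower-· P₁⁻¹ P₁ y z) (kroneckerPower-I (P₁⁻¹ ·₂ P₁) P₁⁻¹P₁ y z)

Eᵋ : ∀ {D} → ℕ → Mat D
Eᵋ i = P⁻¹ ·ₘ E i ·ₘ P

data T {D} : Pred (Mat D) 0ℓ where
  equal    : ∀ {M N} → M ≈ₘ N → M ∈ T → N ∈ T
  unit     : I ∈ T
  gen-A    : A ∈ T
  gen-A*   : A* ∈ T
  sums     : ∀ {M N} → M ∈ T → N ∈ T → M +ₘ N ∈ T
  scalars  : ∀ c {M} → M ∈ T → c •ₘ M ∈ T
  products : ∀ {M N} → M ∈ T → N ∈ T → M ·ₘ N ∈ T

record IsSubspace {D} (W : Pred (V D) 0ℓ) : Set where
  field
    resp     : ∀ {u v} → u ≈ᵥ v → u ∈ W → v ∈ W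
    0∈       : 0ᵥ ∈ W
    +-closed : ∀ {u v} → u ∈ W → v ∈ W → u +ᵥ v ∈ W
    •-closed : ∀ c {v} → v ∈ W → c •ᵥ v ∈ W

IsTModule : ∀ {D} → Pred (V D) 0ℓ → Set
IsTModule W = IsSubspace W × (∀ {M w} → M ∈ T → w ∈ W → M ·ᵥ w ∈ W)

zeroSubspace : ∀ {D} → Pred (V D) 0ℓ
zeroSubspace v = v ≈ᵥ 0ᵥ

IsNonzero : ∀ {D} → Pred (V D) 0ℓ → Set
IsNonzero W = ∃ λ w → w ∈ W × w ≉ᵥ 0ᵥ

-- This is the classical notion: as the disjunction is a genuine choice, applying
-- it to U = {v ∈ W | v = 0 or Q} yields excluded middle for every Q : Set.
IsIrreducible : ∀ {D} → Pred (V D) 0ℓ → Set₁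
IsIrreducible W = IsTModule W × IsNonzero W ×
  (∀ U → IsTModule U → U ⊆ W → (U ≐ zeroSubspace) ⊎ (U ≐ W))

image : ∀ {D} → Mat D → Pred (V D) 0ℓ → Pred (V D) 0ℓ
image M W v = ∃ λ w → w ∈ W × v ≈ᵥ M ·ᵥ w

IsEndpoint : ∀ {D} → Pred (V D) 0ℓ → ℕ → Set
IsEndpoint {D} W r = r N.≤ D × IsNonzero (image (E* r) W) ×
  (∀ i → i N.≤ D → IsNonzero (image (E* i) W) → r N.≤ i)

-- d + 1 is the cardinality of {i | 0 ≤ i ≤ D, E*ᵢ W ≠ 0}.
IsDiameter : ∀ {D} → Pred (V D) 0ℓ → ℕ → Set
IsDiameter {D} W d = ∃ λ (S : Subset (suc D)) →
  (∀ i → i Subset.∈ S ⇔ IsNonzero (image (E* (toℕ i)) W)) × Subset.∣ S ∣ ≡ suc d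

record IsBasis {D n} (W : Pred (V D) 0ℓ) (v : Fin n → V D) : Set where
  field
    members     : ∀ i → v i ∈ W
    independent : ∀ c → lincomb c v ≈ᵥ 0ᵥ → ∀ i → c i ≈ 0#
    spanning    : ∀ {w} → w ∈ W → ∃ λ c → w ≈ᵥ lincomb c v

Represents : ∀ {D n} → Pred (V D) 0ℓ → (Fin n → Fin n → ℂ) → Mat D → (Fin n → V D) → Set
Represents W M Y v = IsBasis W v × (∀ j → Y ·ᵥ v j ≈ᵥ lincomb (λ i → M i j) v)

B : ∀ d → Fin (suc d) → Fin (suc d) → ℂ
B d i j =
  if does (toℕ i ℕₚ.≟ suc (toℕ j)) then 𝐢 * fromℤ (+ toℕ i)
  else if does (toℕ j ℕₚ.≟ suc (toℕ i)) then 𝐢 * fromℤ (+ toℕ i Z.- + d)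
  else 0#

{-# OPTIONS --safe #-}
-- A and A* are the sums over the D coordinates of the Pauli matrices σx and σz,
-- so A, A* and Aᵋ satisfy the cyclic commutation relations of 𝔰𝔩₂, and
-- conjugation by P carries Aᵋ to A and A to A*. Let (X, Y, Z) be a rotation of
-- (A, A*, Aᵋ), take Y for the Cartan element and X = raise + lower. A vector of
-- the lowest A*-index r in W is a highest weight vector, and its divided powers
-- w₀, …, w_m span W, with D = m + 2r. The sum of the wₖ is a highest weight vector
-- for X; hence A, A* and Aᵋ all have the same weights on W. Now write a highest
-- weight vector u for Z as Σ aₖ wₖ: it is annihilated by the raising operator of Z,
-- which says aₖ₊₁ = -𝐢 aₖ, so the Y-components of u are (-𝐢)ᵏ a₀ wₖ and B is read
-- off from X = raise + lower. Excluded middle, which the division by nonzero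
-- scalars needs, is extracted from the irreducibility of W.
module Submission where

open import Defs
open import Algebra.Bundles using (CommutativeRing; RawRing)
import Algebra.Properties.AbelianGroup
import Algebra.Solver.Ring
open import Algebra.Solver.Ring.AlmostCommutativeRing
  using (AlmostCommutativeRing; fromCommutativeRing; _-Raw-AlmostCommutative⟶_; Induced-equivalence)
open import Data.Bool.Base using (if_then_else_; true; false)
open import Data.Fin.Base using (Fin; zero; suc; toℕ; fromℕ<)
import Data.Fin.Properties as Finₚ
open import Data.Fin.Subset as Subset using (Subset)
open import Data.Fin.Subset.Properties using (drop-there)
open import Data.Integer.Base as Z using (+_; -[1+_]; +0; +[1+_])
import Data.Integer.Properties as ℤₚ
open import Data.List.Base as List using (List)
open import Data.List.Membership.Propositional using () renaming (_∈_ to _∈ˡ_)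
open import Data.List.Membership.Propositional.Properties using (∈-filter⁺; ∈-upTo⁺)
open import Data.List.Relation.Unary.All as All using (All)
open import Data.List.Relation.Unary.All.Properties using (all-filter)
open import Data.List.Relation.Unary.Any using () renaming (here to hereˡ; there to thereˡ)
open import Data.Maybe.Base using (just; nothing)
open import Data.Nat.Base as N using (ℕ; zero; suc; NonZero)
import Data.Nat.Properties as ℕₚ
open import Data.Product.Base using (∃; _×_; _,_; proj₁; proj₂)
open import Data.Rational.Base as Q using (ℚ; 0ℚ; 1ℚ; ½)
import Data.Rational.Properties as ℚₚ
import Data.Rational.Unnormalised.Base as ℚᵘ
import Data.Rational.Unnormalised.Properties as ℚᵘₚ
open import Data.Sum.Base as Sum using (_⊎_; inj₁; inj₂; [_,_])
open import Data.Vec.Base using ([]; _∷_; here; there)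
import Data.Vec.Properties as Vecₚ
open import Function.Base using (id; _∘_)
open import Function.Bundles using (Equivalence)
open import Level using (0ℓ)
open import Relation.Binary.Definitions using (WeaklyDecidable)
open import Relation.Binary.PropositionalEquality as ≡ using (_≡_; _≢_)
import Relation.Binary.Reasoning.Setoid
open import Relation.Nullary.Decidable using (Dec; does; yes; no; ¬?; decidable-stable)
open import Relation.Nullary.Negation using (¬_; contradiction)
open import Relation.Unary using (Pred; _∈_; _⊆_)

-- The hypotheses fix the endpoint and the diameter through `A*` alone, while the three parts also
-- project with `E` and `Eᵋ`, so the same `r` and `d` have to be recovered for `A` and `Aᵋ`. What
-- transports them is D = m + 2r: once a highest weight vector of weight θᵣ is found, the length of
-- its string is forced. The factor -𝐢 arises as follows. Put e = (X - 𝐢Z)/2. A highest weight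
-- vector u for Z satisfies Zu = θᵣu and (Y - 𝐢X)u = 0; by the second equation e acts on u as
-- -(𝐢/2)(Y + Z), so eu = -(𝐢/2)(Y + θᵣ)u. On wₖ the operator Y + θᵣ is 2(m - k), while e takes wₖ₊₁
-- to (m - k)wₖ. Comparing coefficients gives (m - k)aₖ₊₁ = -𝐢(m - k)aₖ, and m - k cancels for k <
-- m. Divided powers keep factorials out of every coefficient: this is why the plain sum of the wₖ
-- is the rotated highest weight vector, and why the entries of `B` are linear in the index.

open C using (_+_; _*_; -_; 0#; 1#; _≈_)
module ℤ-group = Algebra.Properties.AbelianGroup ℤₚ.+-0-abelianGroup
module ℚ-group = Algebra.Properties.AbelianGroup ℚₚ.+-0-abelianGroup

-- Complex scalars

-- With coefficients in ℚ(𝐢) the ring solver also knows 𝐢² = -1 and ½ + ½ = 1.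
ℚ[i] : RawRing 0ℓ 0ℓ
ℚ[i] = record
  { Carrier = ℚ × ℚ
  ; _≈_ = _≡_
  ; _+_ = λ (a , b) (c , d) → a Q.+ c , b Q.+ d
  ; _*_ = λ (a , b) (c , d) → a Q.* c Q.+ Q.- (b Q.* d) , a Q.* d Q.+ b Q.* c
  ; -_ = λ (a , b) → Q.- a , Q.- b
  ; 0# = 0ℚ , 0ℚ
  ; 1# = 1ℚ , 0ℚ
  }

ℂ-ring : AlmostCommutativeRing 0ℓ 0ℓ
ℂ-ring = fromCommutativeRing Complex.commutativeRing

gaussian : ℚ × ℚ → ℂ
gaussian (a , b) = Real.fromℚ a Complex.+i Real.fromℚ b

constants : ∀ {a a′ b b′} → (∀ n → Real.seq a n ≡ Real.seq a′ n) → (∀ n → Real.seq b n ≡ Real.seq b′ n) →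
            (a Complex.+i b) ≈ (a′ Complex.+i b′)
constants p q = Complex.mk≈ᶜ (Real.pointwise p) (Real.pointwise q)

gaussian-homomorphism : ℚ[i] -Raw-AlmostCommutative⟶ ℂ-ring
gaussian-homomorphism = record
  { ⟦_⟧    = gaussian
  ; +-homo = λ _ _ → constants (λ _ → ≡.refl) (λ _ → ≡.refl)
  ; *-homo = λ _ _ → constants (λ _ → ≡.refl) (λ _ → ≡.refl)
  ; -‿homo = λ _ → constants (λ _ → ≡.refl) (λ _ → ≡.refl)
  ; 0-homo = C.refl
  ; 1-homo = C.refl
  }

gaussian≟ : WeaklyDecidable (Induced-equivalence gaussian-homomorphism)
gaussian≟ (a , b) (c , d) with a ℚₚ.≟ c | b ℚₚ.≟ d
... | yes ≡.refl | yes ≡.refl = just C.refl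
... | _          | _          = nothing

module Solver = Algebra.Solver.Ring ℚ[i] ℂ-ring gaussian-homomorphism gaussian≟
open Solver using (solve; con; _:=_; _:+_; _:*_; :-_; _:-_; Polynomial)

:𝐢 :½ :0 :1 : ∀ {n} → Polynomial n
:𝐢 = con (0ℚ , 1ℚ)
:½ = con (½ , 0ℚ)
:0 = con (0ℚ , 0ℚ)
:1 = con (1ℚ , 0ℚ)


fromℚ-+ : ∀ p q → fromℚ (p Q.+ q) ≈ fromℚ p + fromℚ q
fromℚ-+ p q = constants (λ _ → ≡.refl) (λ _ → ≡.refl)

fromℚ-* : ∀ p q → fromℚ (p Q.* q) ≈ fromℚ p * fromℚ q
fromℚ-* p q = constants
  (λ _ → ≡.sym (ℚₚ.+-identityʳ (p Q.* q)))
  (λ _ → ≡.sym (≡.cong₂ Q._+_ (ℚₚ.*-zeroʳ p) (ℚₚ.*-zeroˡ q)))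

-- Two constant sequences keep the distance |p - q|, so taking that number as the tolerance refutes
-- their equality unless it is 0.
fromℚ-injective : ∀ {p q} → fromℚ p ≈ fromℚ q → p ≡ q
fromℚ-injective {p} {q} (Complex.mk≈ᶜ (Real.mk≈ c) _) = decidable-stable (p ℚₚ.≟ q) λ p≢q →
  let N , small = c Q.∣ p Q.- q ∣ (distinct p≢q) in
  ℚₚ.<-irrefl ≡.refl (small N ℕₚ.≤-refl)
  where
  distinct : p ≢ q → 0ℚ Q.< Q.∣ p Q.- q ∣
  distinct p≢q = ℚₚ.≰⇒> λ ≤0 → p≢q
    (≡.trans (≡.sym (ℚₚ.+-identityʳ p)) (≡.trans (≡.cong (p Q.+_) (≡.sym (ℚₚ.+-inverseˡ q)))
      (≡.trans (≡.sym (ℚₚ.+-assoc p (Q.- q) q))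
        (≡.trans (≡.cong (Q._+ q) (ℚₚ.∣p∣≡0⇒p≡0 (p Q.- q) (ℚₚ.≤-antisym ≤0 (ℚₚ.0≤∣p∣ (p Q.- q))))) (ℚₚ.+-identityˡ q)))))

-- `Q._/_` normalises by a gcd and does not compute on variables, hence the detour through
-- unnormalised fractions.
/1-+ : ∀ m n → (m Z.+ n) Q./ 1 ≡ m Q./ 1 Q.+ n Q./ 1
/1-+ m n = ℚₚ.toℚᵘ-injective (begin
  Q.toℚᵘ ((m Z.+ n) Q./ 1)                 ≈⟨ ℚₚ.toℚᵘ-fromℚᵘ (ℚᵘ.mkℚᵘ (m Z.+ n) 0) ⟩
  ℚᵘ.mkℚᵘ (m Z.+ n) 0                      ≈⟨ ℚᵘ.*≡* (≡.cong (Z._* + 1) (≡.sym (≡.cong₂ Z._+_ (ℤₚ.*-identityʳ m) (ℤₚ.*-identityʳ n)))) ⟩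
  ℚᵘ.mkℚᵘ m 0 ℚᵘ.+ ℚᵘ.mkℚᵘ n 0             ≈⟨ ℚᵘₚ.+-cong (ℚₚ.toℚᵘ-fromℚᵘ (ℚᵘ.mkℚᵘ m 0)) (ℚₚ.toℚᵘ-fromℚᵘ (ℚᵘ.mkℚᵘ n 0)) ⟨
  Q.toℚᵘ (m Q./ 1) ℚᵘ.+ Q.toℚᵘ (n Q./ 1)   ≈⟨ ℚₚ.toℚᵘ-homo-+ (m Q./ 1) (n Q./ 1) ⟨
  Q.toℚᵘ (m Q./ 1 Q.+ n Q./ 1)             ∎)
  where open ℚᵘₚ.≃-Reasoning

/1-injective : ∀ {m n} → m Q./ 1 ≡ n Q./ 1 → m ≡ n
/1-injective {m} {n} eq with ℚᵘₚ.≃-trans (ℚᵘₚ.≃-sym (ℚₚ.toℚᵘ-fromℚᵘ (ℚᵘ.mkℚᵘ m 0)))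
                   (ℚᵘₚ.≃-trans (ℚₚ.toℚᵘ-cong eq) (ℚₚ.toℚᵘ-fromℚᵘ (ℚᵘ.mkℚᵘ n 0)))
... | ℚᵘ.*≡* e = ≡.trans (≡.sym (ℤₚ.*-identityʳ m)) (≡.trans e (ℤₚ.*-identityʳ n))

reciprocal-inverse : ∀ n → n ≢ +0 → reciprocal n Q.* (n Q./ 1) ≡ 1ℚ
reciprocal-inverse +0 n≢0 = contradiction ≡.refl n≢0
reciprocal-inverse n@(+[1+ k ]) _ = ℚₚ.toℚᵘ-injective (begin
  Q.toℚᵘ (reciprocal n Q.* (n Q./ 1))           ≈⟨ ℚₚ.toℚᵘ-homo-* (reciprocal n) (n Q./ 1) ⟩
  Q.toℚᵘ (reciprocal n) ℚᵘ.* Q.toℚᵘ (n Q./ 1)   ≈⟨ ℚᵘₚ.*-cong (ℚₚ.toℚᵘ-fromℚᵘ (ℚᵘ.mkℚᵘ (+ 1) k)) (ℚₚ.toℚᵘ-fromℚᵘ (ℚᵘ.mkℚᵘ n 0)) ⟩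
  ℚᵘ.mkℚᵘ (+ 1) k ℚᵘ.* ℚᵘ.mkℚᵘ n 0              ≈⟨ ℚᵘ.*≡* (≡.trans (ℤₚ.*-identityʳ (+ 1 Z.* n)) (≡.cong (λ x → + 1 Z.* +[1+ x ]) (≡.sym (ℕₚ.*-identityʳ k)))) ⟩
  ℚᵘ.1ℚᵘ                                        ∎)
  where open ℚᵘₚ.≃-Reasoning
reciprocal-inverse n@(-[1+ k ]) _ = ℚₚ.toℚᵘ-injective (begin
  Q.toℚᵘ (reciprocal n Q.* (n Q./ 1))           ≈⟨ ℚₚ.toℚᵘ-homo-* (reciprocal n) (n Q./ 1) ⟩
  Q.toℚᵘ (reciprocal n) ℚᵘ.* Q.toℚᵘ (n Q./ 1)   ≈⟨ ℚᵘₚ.*-cong (ℚₚ.toℚᵘ-fromℚᵘ (ℚᵘ.mkℚᵘ -[1+ 0 ] k)) (ℚₚ.toℚᵘ-fromℚᵘ (ℚᵘ.mkℚᵘ n 0)) ⟩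
  ℚᵘ.mkℚᵘ -[1+ 0 ] k ℚᵘ.* ℚᵘ.mkℚᵘ n 0           ≈⟨ ℚᵘ.*≡* (≡.trans (ℤₚ.*-identityʳ (-[1+ 0 ] Z.* n)) (≡.cong (λ x → + 1 Z.* +[1+ x ]) (≡.sym (ℕₚ.*-identityʳ k)))) ⟩
  ℚᵘ.1ℚᵘ                                        ∎)
  where open ℚᵘₚ.≃-Reasoning

fromℤ-+ : ∀ m n → fromℤ (m Z.+ n) ≈ fromℤ m + fromℤ n
fromℤ-+ m n = C.trans (C.reflexive (≡.cong fromℚ (/1-+ m n))) (fromℚ-+ (m Q./ 1) (n Q./ 1))

fromℤ-neg : ∀ n → fromℤ (Z.- n) ≈ - fromℤ n
fromℤ-neg n = begin
  fromℤ (Z.- n)                            ≈⟨ solve 2 (λ x y → x := (x :+ y) :- y) C.refl (fromℤ (Z.- n)) (fromℤ n) ⟩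
  (fromℤ (Z.- n) + fromℤ n) + - fromℤ n    ≈⟨ C.+-congʳ (fromℤ-+ (Z.- n) n) ⟨
  fromℤ (Z.- n Z.+ n) + - fromℤ n          ≈⟨ C.+-congʳ (C.reflexive (≡.cong fromℤ (ℤₚ.+-inverseˡ n))) ⟩
  0# + - fromℤ n                           ≈⟨ C.+-identityˡ _ ⟩
  - fromℤ n                                ∎
  where open Relation.Binary.Reasoning.Setoid C.setoid

fromℤ-injective : ∀ {m n} → fromℤ m ≈ fromℤ n → m ≡ n
fromℤ-injective eq = /1-injective (fromℚ-injective eq)

fromℤ-reciprocal : ∀ n → n ≢ +0 → fromℚ (reciprocal n) * fromℤ n ≈ 1#
fromℤ-reciprocal n n≢0 = C.trans (C.sym (fromℚ-* (reciprocal n) (n Q./ 1)))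
  (C.reflexive (≡.cong fromℚ (reciprocal-inverse n n≢0)))

ι : ℕ → ℂ
ι n = fromℤ (+ n)

ι-suc : ∀ n → ι (suc n) ≈ 1# + ι n
ι-suc n = fromℤ-+ (+ 1) (+ n)

ι-+ : ∀ m n → ι (m N.+ n) ≈ ι m + ι n
ι-+ m n = fromℤ-+ (+ m) (+ n)

ι-injective : ∀ {m n} → ι m ≈ ι n → m ≡ n
ι-injective eq = ℤₚ.+-injective (fromℤ-injective eq)

ϑ : ℕ → ℕ → ℂ
ϑ D j = fromℤ (θ D j)

ϑ-value : ∀ D j → ϑ D j ≈ ι D + - (ι j + ι j)
ϑ-value D j = C.trans (fromℤ-+ (+ D) (Z.- + (2 N.* j)))
  (C.+-congˡ (C.trans (fromℤ-neg (+ (2 N.* j)))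
    (C.-‿cong (C.trans (C.reflexive (≡.cong (λ k → ι (j N.+ k)) (ℕₚ.+-identityʳ j))) (ι-+ j j)))))

ϑ-injective : ∀ D {i j} → ϑ D i ≈ ϑ D j → i ≡ j
ϑ-injective D {i} {j} eq = ℕₚ.*-cancelˡ-≡ i j 2 (ℤₚ.+-injective (ℤₚ.neg-injective
  (ℤ-group.∙-cancelˡ (+ D) _ _ (fromℤ-injective eq))))

-- Excluded middle and the absence of zero divisors in ℂ

LEM : Set₁
LEM = ∀ (Q : Set) → Dec Q

module RealDomain (lem : LEM) where

  open Real using (ℝ; seq; cauchy; 0ℝ; _⊕_; _⊗_; ⊝_; mk≈; half>0; half+half) renaming (_≈_ to _≈ʳ_)

  -- If the sequence does not tend to 0, some δ is not eventually an upper bound. Beyond the point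
  -- where all terms are within δ/2 of each other, one term below δ/2 would keep all later terms
  -- below δ; so every term there is at least δ/2.
  apart : ∀ x → ¬ x ≈ʳ 0ℝ → ∃ λ δ → 0ℚ Q.< δ × ∃ λ N → ∀ n → N N.≤ n → δ Q.≤ Q.∣ seq x n ∣
  apart x x≉0 with lem (∃ λ δ → 0ℚ Q.< δ × ¬ ∃ λ N → ∀ n → N N.≤ n → Q.∣ seq x n Q.- 0ℚ ∣ Q.< δ)
  ... | no none = contradiction (mk≈ λ ε 0<ε → decidable-stable (lem _) λ not → none (ε , 0<ε , not)) x≉0
  ... | yes (δ , 0<δ , far) with cauchy x (½ Q.* δ) (half>0 0<δ)
  ...   | N , c = ½ Q.* δ , half>0 0<δ , N , λ n N≤n → ℚₚ.≮⇒≥ λ small →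
          far (N , λ m N≤m → ≡.subst (λ t → Q.∣ t ∣ Q.< δ) (eq (seq x m) (seq x n))
            (Real.triangle {seq x m Q.- seq x n} (c m n N≤m N≤n) small))
    where
    eq : ∀ a b → (a Q.- b) Q.+ b ≡ a Q.- 0ℚ
    eq a b = ≡.trans (ℚₚ.+-assoc a (Q.- b) b) (≡.cong (a Q.+_) (ℚₚ.+-inverseˡ b))

  -- Two nonzero factors are eventually bounded away from 0 by δ and δ′, so their product stays at
  -- least δδ′.
  domainʳ : ∀ x y → x ⊗ y ≈ʳ 0ℝ → x ≈ʳ 0ℝ ⊎ y ≈ʳ 0ℝ
  domainʳ x y (mk≈ xy≈0) with lem (x ≈ʳ 0ℝ) | lem (y ≈ʳ 0ℝ)
  ... | yes x≈0 | _       = inj₁ x≈0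
  ... | no _    | yes y≈0 = inj₂ y≈0
  ... | no x≉0  | no y≉0 with apart x x≉0 | apart y y≉0
  ...   | δ , 0<δ , N , fx | δ′ , 0<δ′ , N′ , fy = contradiction (ℚₚ.<-≤-trans small large) (ℚₚ.<-irrefl ≡.refl)
    where
    instance
      δ′≥0 : Q.NonNegative δ′
      δ′≥0 = Q.nonNegative (ℚₚ.<⇒≤ 0<δ′)
      δ>0 : Q.Positive δ
      δ>0 = Q.positive 0<δ
    δδ′>0 : 0ℚ Q.< δ Q.* δ′
    δδ′>0 = ≡.subst (Q._< δ Q.* δ′) (ℚₚ.*-zeroʳ δ) (ℚₚ.*-monoʳ-<-pos δ 0<δ′)
    M = proj₁ (xy≈0 (δ Q.* δ′) δδ′>0)
    n = (N N.⊔ N′) N.⊔ M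
    small : Q.∣ seq x n Q.* seq y n Q.- 0ℚ ∣ Q.< δ Q.* δ′
    small = proj₂ (xy≈0 (δ Q.* δ′) δδ′>0) n (ℕₚ.m≤n⊔m (N N.⊔ N′) M)
    large : δ Q.* δ′ Q.≤ Q.∣ seq x n Q.* seq y n Q.- 0ℚ ∣
    large = begin
      δ Q.* δ′                                ≤⟨ ℚₚ.*-monoʳ-≤-nonNeg δ′ (fx n (ℕₚ.≤-trans (ℕₚ.m≤m⊔n N N′) (ℕₚ.m≤m⊔n _ M))) ⟩
      Q.∣ seq x n ∣ Q.* δ′                    ≤⟨ ℚₚ.*-monoˡ-≤-nonNeg Q.∣ seq x n ∣ {{Q.nonNegative (ℚₚ.0≤∣p∣ (seq x n))}} (fy n (ℕₚ.≤-trans (ℕₚ.m≤n⊔m N N′) (ℕₚ.m≤m⊔n _ M))) ⟩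
      Q.∣ seq x n ∣ Q.* Q.∣ seq y n ∣         ≡⟨ ℚₚ.∣p*q∣≡∣p∣*∣q∣ (seq x n) (seq y n) ⟨
      Q.∣ seq x n Q.* seq y n ∣               ≡⟨ ≡.cong Q.∣_∣ (ℚₚ.+-identityʳ _) ⟨
      Q.∣ seq x n Q.* seq y n Q.- 0ℚ ∣        ∎
      where open ℚₚ.≤-Reasoning

  -- Squares are nonnegative, so a² is dominated by a² + b² and tends to 0 with it; then a = 0
  -- because ℝ has no zero divisors.
  squares : ∀ a b → (a ⊗ a) ⊕ (b ⊗ b) ≈ʳ 0ℝ → a ≈ʳ 0ℝ
  squares a b (mk≈ p) = [ id , id ] (domainʳ a a (mk≈ λ ε 0<ε → let N , c = p ε 0<ε in
    N , λ n N≤n → ℚₚ.≤-<-trans (bound (seq a n) (seq b n)) (c n N≤n)))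
    where
    sq≥0 : ∀ x → 0ℚ Q.≤ x Q.* x
    sq≥0 x with ℚₚ.≤-total 0ℚ x
    ... | inj₁ 0≤x = ≡.subst (Q._≤ x Q.* x) (ℚₚ.*-zeroˡ x) (ℚₚ.*-monoʳ-≤-nonNeg x {{Q.nonNegative 0≤x}} 0≤x)
    ... | inj₂ x≤0 = ≡.subst (Q._≤ x Q.* x) (ℚₚ.*-zeroˡ x) (ℚₚ.*-monoʳ-≤-nonPos x {{Q.nonPositive x≤0}} x≤0)
    bound : ∀ x y → Q.∣ x Q.* x Q.- 0ℚ ∣ Q.≤ Q.∣ x Q.* x Q.+ y Q.* y Q.- 0ℚ ∣
    bound x y = begin
      Q.∣ x Q.* x Q.- 0ℚ ∣               ≡⟨ ≡.cong Q.∣_∣ (ℚₚ.+-identityʳ (x Q.* x)) ⟩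
      Q.∣ x Q.* x ∣                      ≡⟨ ℚₚ.0≤p⇒∣p∣≡p (sq≥0 x) ⟩
      x Q.* x                            ≡⟨ ℚₚ.+-identityʳ _ ⟨
      x Q.* x Q.+ 0ℚ                     ≤⟨ ℚₚ.+-monoʳ-≤ (x Q.* x) (sq≥0 y) ⟩
      x Q.* x Q.+ y Q.* y                ≡⟨ ℚₚ.0≤p⇒∣p∣≡p (ℚₚ.+-mono-≤ (sq≥0 x) (sq≥0 y)) ⟨
      Q.∣ x Q.* x Q.+ y Q.* y ∣          ≡⟨ ≡.cong Q.∣_∣ (ℚₚ.+-identityʳ _) ⟨
      Q.∣ x Q.* x Q.+ y Q.* y Q.- 0ℚ ∣   ∎
      where open ℚₚ.≤-Reasoning

  private
    norm : ℂ → ℂ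
    norm z = ((re z ⊗ re z) ⊕ (im z ⊗ im z)) Complex.+i 0ℝ

    module R = CommutativeRing Real.commutativeRing

  norm-0 : ∀ z → (re z ⊗ re z) ⊕ (im z ⊗ im z) ≈ʳ 0ℝ → z ≈ 0#
  norm-0 (a Complex.+i b) e = Complex.mk≈ᶜ (squares a b e) (squares b a (R.trans (R.+-comm _ _) e))

  private
    conj : ℂ → ℂ
    conj (a Complex.+i b) = a Complex.+i (⊝ b)

    conj-* : ∀ z → z * conj z ≈ norm z
    conj-* (a Complex.+i b) = constants (λ n → re-eq (seq a n) (seq b n)) (λ n → im-eq (seq a n) (seq b n))
      where
      re-eq : ∀ a b → a Q.* a Q.+ Q.- (b Q.* Q.- b) ≡ a Q.* a Q.+ b Q.* b
      re-eq a b = ≡.cong (a Q.* a Q.+_) (≡.trans (≡.cong Q.-_ (≡.sym (ℚₚ.neg-distribʳ-* b b))) (ℚ-group.⁻¹-involutive (b Q.* b)))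
      im-eq : ∀ a b → a Q.* Q.- b Q.+ b Q.* a ≡ 0ℚ
      im-eq a b = ≡.trans (≡.cong₂ Q._+_ (≡.sym (ℚₚ.neg-distribʳ-* a b)) (ℚₚ.*-comm b a)) (ℚₚ.+-inverseˡ (a Q.* b))

    real-* : ∀ a b → (a Complex.+i 0ℝ) * (b Complex.+i 0ℝ) ≈ ((a ⊗ b) Complex.+i 0ℝ)
    real-* a b = constants (λ n → ℚₚ.+-identityʳ _)
      (λ n → ≡.cong₂ Q._+_ (ℚₚ.*-zeroʳ (seq a n)) (ℚₚ.*-zeroˡ (seq b n)))

  -- The squared modulus is multiplicative, which reduces the claim to real numbers.
  domain : ∀ z w → z * w ≈ 0# → z ≈ 0# ⊎ w ≈ 0#
  domain z w zw≈0 = Sum.map (norm-0 z) (norm-0 w)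
    (domainʳ ((re z ⊗ re z) ⊕ (im z ⊗ im z)) ((re w ⊗ re w) ⊕ (im w ⊗ im w)) (Complex._≈ᶜ_.re≈ norms))
    where
    open Relation.Binary.Reasoning.Setoid C.setoid
    norms : ((((re z ⊗ re z) ⊕ (im z ⊗ im z)) ⊗ ((re w ⊗ re w) ⊕ (im w ⊗ im w))) Complex.+i 0ℝ) ≈ 0#
    norms = begin
      _                              ≈⟨ real-* _ _ ⟨
      norm z * norm w                ≈⟨ C.*-cong (conj-* z) (conj-* w) ⟨
      (z * conj z) * (w * conj w)    ≈⟨ solve 4 (λ a b c d → (a :* b) :* (c :* d) := (a :* c) :* (b :* d)) C.refl z (conj z) w (conj w) ⟩
      (z * w) * (conj z * conj w)    ≈⟨ C.*-congʳ zw≈0 ⟩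
      0# * (conj z * conj w)         ≈⟨ C.zeroˡ _ ⟩
      0#                             ∎

open Relation.Binary.Reasoning.Setoid C.setoid

-- The cube as a tensor power

Op : ℕ → Set
Op D = V D → V D

record IsLinear {D D′} (F : V D → V D′) : Set where
  field
    cong  : ∀ {u v} → u ≈ᵥ v → F u ≈ᵥ F v
    add   : ∀ u v → F (u +ᵥ v) ≈ᵥ F u +ᵥ F v
    scale : ∀ c v → F (c •ᵥ v) ≈ᵥ c •ᵥ F v

open IsLinear

∑X-+ : ∀ {D} (f g : V D) → ∑X (λ y → f y + g y) ≈ ∑X f + ∑X g
∑X-+ {zero}  f g = C.refl
∑X-+ {suc D} f g = C.trans (C.+-cong (∑X-+ (λ y → f (zero ∷ y)) (λ y → g (zero ∷ y))) (∑X-+ (λ y → f (suc zero ∷ y)) (λ y → g (suc zero ∷ y))))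
  (solve 4 (λ a b c d → (a :+ b) :+ (c :+ d) := (a :+ c) :+ (b :+ d)) C.refl _ _ _ _)

∑X-comm : ∀ {D D′} (f : X D → X D′ → ℂ) → ∑X (λ y → ∑X (f y)) ≈ ∑X (λ z → ∑X (λ y → f y z))
∑X-comm {zero}  f = C.refl
∑X-comm {suc D} f = C.trans (C.+-cong (∑X-comm λ y → f (zero ∷ y)) (∑X-comm λ y → f (suc zero ∷ y)))
  (C.sym (∑X-+ (λ z → ∑X (λ y → f (zero ∷ y) z)) (λ z → ∑X (λ y → f (suc zero ∷ y) z))))

·ᵥ-linear : ∀ {D} (M : Mat D) → IsLinear (M ·ᵥ_)
·ᵥ-linear M .cong u≈v y = ∑X-cong λ z → C.*-congˡ (u≈v z)
·ᵥ-linear M .add u v y = C.trans (∑X-cong λ z → C.distribˡ (M y z) (u z) (v z)) (∑X-+ (λ z → M y z * u z) (λ z → M y z * v z))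
·ᵥ-linear M .scale c v y = C.trans
  (∑X-cong λ z → solve 3 (λ m c v → m :* (c :* v) := c :* (m :* v)) C.refl (M y z) c (v z)) (∑X-*ˡ c λ z → M y z * v z)

·ₘ-assoc-·ᵥ : ∀ {D} (M N : Mat D) v → (M ·ₘ N) ·ᵥ v ≈ᵥ M ·ᵥ (N ·ᵥ v)
·ₘ-assoc-·ᵥ M N v y = begin
  ∑X (λ z → ∑X (λ w → M y w * N w z) * v z)   ≈⟨ ∑X-cong (λ z → C.trans (C.*-comm _ _) (C.sym (∑X-*ˡ (v z) λ w → M y w * N w z))) ⟩
  ∑X (λ z → ∑X (λ w → v z * (M y w * N w z))) ≈⟨ ∑X-comm (λ z w → v z * (M y w * N w z)) ⟩
  ∑X (λ w → ∑X (λ z → v z * (M y w * N w z))) ≈⟨ ∑X-cong (λ w → C.trans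
      (∑X-cong λ z → solve 3 (λ v m n → v :* (m :* n) := m :* (n :* v)) C.refl (v z) (M y w) (N w z)) (∑X-*ˡ (M y w) λ z → N w z * v z)) ⟩
  ∑X (λ w → M y w * ∑X (λ z → N w z * v z))   ∎

≈ₘ⇒≈ᵥ : ∀ {D} {M N : Mat D} → M ≈ₘ N → ∀ v → M ·ᵥ v ≈ᵥ N ·ᵥ v
≈ₘ⇒≈ᵥ M≈N v y = ∑X-cong λ z → C.*-congʳ (M≈N y z)

+ₘ-·ᵥ : ∀ {D} (M N : Mat D) v → (M +ₘ N) ·ᵥ v ≈ᵥ M ·ᵥ v +ᵥ N ·ᵥ v
+ₘ-·ᵥ M N v y = C.trans (∑X-cong λ z → C.distribʳ (v z) (M y z) (N y z)) (∑X-+ (λ z → M y z * v z) (λ z → N y z * v z))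

•ₘ-·ᵥ : ∀ {D} c (M : Mat D) v → (c •ₘ M) ·ᵥ v ≈ᵥ c •ᵥ (M ·ᵥ v)
•ₘ-·ᵥ c M v y = C.trans (∑X-cong λ z → C.*-assoc c (M y z) (v z)) (∑X-*ˡ c λ z → M y z * v z)

-ₘ-as-+ₘ : ∀ {D} (M N : Mat D) → M +ₘ (- 1#) •ₘ N ≈ₘ M -ₘ N
-ₘ-as-+ₘ M N y z = solve 2 (λ m n → m :+ (:- :1) :* n := m :- n) C.refl (M y z) (N y z)

-ₘ-·ᵥ : ∀ {D} (M N : Mat D) v → (M -ₘ N) ·ᵥ v ≈ᵥ λ y → (M ·ᵥ v) y + - (N ·ᵥ v) y
-ₘ-·ᵥ M N v y = begin
  ((M -ₘ N) ·ᵥ v) y                     ≈⟨ ≈ₘ⇒≈ᵥ (-ₘ-as-+ₘ M N) v y ⟨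
  ((M +ₘ (- 1#) •ₘ N) ·ᵥ v) y           ≈⟨ +ₘ-·ᵥ M ((- 1#) •ₘ N) v y ⟩
  (M ·ᵥ v) y + (((- 1#) •ₘ N) ·ᵥ v) y   ≈⟨ C.+-congˡ (•ₘ-·ᵥ (- 1#) N v y) ⟩
  (M ·ᵥ v) y + (- 1#) * (N ·ᵥ v) y      ≈⟨ solve 2 (λ m n → m :+ (:- :1) :* n := m :- n) C.refl _ _ ⟩
  (M ·ᵥ v) y + - (N ·ᵥ v) y             ∎

∑X-zero : ∀ {D} {f : V D} → (∀ y → f y ≈ 0#) → ∑X f ≈ 0#
∑X-zero {zero}  p = p []
∑X-zero {suc D} p = C.trans (C.+-cong (∑X-zero λ y → p (zero ∷ y)) (∑X-zero λ y → p (suc zero ∷ y))) (C.+-identityˡ 0#)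

∑X-diag : ∀ {D} (f v : V D) y → ∑X (λ z → (if does (Vecₚ.≡-dec Finₚ._≟_ y z) then f y else 0#) * v z) ≈ f y * v y
∑X-diag f v []             = C.refl
∑X-diag f v (zero ∷ y)     = C.trans (C.+-cong (∑X-diag (λ z → f (zero ∷ z)) (λ z → v (zero ∷ z)) y) (∑X-zero {f = λ z → 0# * v (suc zero ∷ z)} λ z → C.zeroˡ _)) (C.+-identityʳ _)
∑X-diag f v (suc zero ∷ y) = C.trans (C.+-cong (∑X-zero {f = λ z → 0# * v (zero ∷ z)} λ z → C.zeroˡ _) (∑X-diag (λ z → f (suc zero ∷ z)) (λ z → v (suc zero ∷ z)) y)) (C.+-identityˡ _)

diag-·ᵥ : ∀ {D} (f v : V D) → diag f ·ᵥ v ≈ᵥ λ y → f y * v y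
diag-·ᵥ f v y = ∑X-diag f v y

I-·ᵥ : ∀ {D} (v : V D) → I ·ᵥ v ≈ᵥ v
I-·ᵥ v y = C.trans (diag-·ᵥ (λ _ → 1#) v y) (C.*-identityˡ _)

-- The derivation action of 𝔤𝔩₂ on the D-th tensor power of ℂ²: the sum over k
-- of M acting on the k-th tensor factor.
lift : ∀ {D} → Mat₂ → Op D
lift M v []      = 0#
lift M v (a ∷ y) = (M a zero * v (zero ∷ y) + M a (suc zero) * v (suc zero ∷ y)) + lift M (λ z → v (a ∷ z)) y

lift-linear : ∀ {D} M → IsLinear (lift {D} M)
lift-linear M .cong p []      = C.refl
lift-linear M .cong p (a ∷ y) =
  C.+-cong (C.+-cong (C.*-congˡ (p _)) (C.*-congˡ (p _))) (lift-linear M .cong (λ z → p (a ∷ z)) y)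
lift-linear M .add u v []      = C.sym (C.+-identityˡ 0#)
lift-linear M .add u v (a ∷ y) = C.trans (C.+-congˡ (lift-linear M .add (λ z → u (a ∷ z)) (λ z → v (a ∷ z)) y))
  (solve 8 (λ m n a b c d e f → (m :* (a :+ b) :+ n :* (c :+ d)) :+ (e :+ f) := ((m :* a :+ n :* c) :+ e) :+ ((m :* b :+ n :* d) :+ f)) C.refl
    (M a zero) (M a (suc zero)) (u (zero ∷ y)) (v (zero ∷ y)) (u (suc zero ∷ y)) (v (suc zero ∷ y)) _ _)
lift-linear M .scale c v []      = C.sym (C.zeroʳ c)
lift-linear M .scale c v (a ∷ y) = C.trans (C.+-congˡ (lift-linear M .scale c (λ z → v (a ∷ z)) y))
  (solve 6 (λ m n c x y z → (m :* (c :* x) :+ n :* (c :* y)) :+ c :* z := c :* ((m :* x :+ n :* y) :+ z)) C.refl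
    (M a zero) (M a (suc zero)) c (v (zero ∷ y)) (v (suc zero ∷ y)) _)

linear₃ : ∀ {D D′} {F : V D → V D′} → IsLinear F → ∀ a u b v w →
          F ((a •ᵥ u +ᵥ b •ᵥ v) +ᵥ w) ≈ᵥ (a •ᵥ F u +ᵥ b •ᵥ F v) +ᵥ F w
linear₃ L a u b v w y = C.trans (L .add _ w y) (C.+-congʳ
  (C.trans (L .add _ _ y) (C.+-cong (L .scale a u y) (L .scale b v y))))

-- Matrices acting on different tensor factors commute, so only the commutators within one factor
-- survive.
lift-commutator : ∀ {D} (M N K : Mat₂) →
  (∀ a b → (M a zero * N zero b + M a (suc zero) * N (suc zero) b) + - (N a zero * M zero b + N a (suc zero) * M (suc zero) b) ≈ K a b) →
  ∀ (v : V D) y → lift M (lift N v) y + - lift N (lift M v) y ≈ lift K v y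
lift-commutator M N K eq v []      = C.trans (C.+-identityˡ _) (solve 0 (:- :0 := :0) C.refl)
lift-commutator M N K eq v (a ∷ y) = begin
  _ ≈⟨ C.+-cong (C.+-congˡ (linear₃ (lift-linear M) _ _ _ _ _ y))
                (C.-‿cong (C.+-congˡ (linear₃ (lift-linear N) _ _ _ _ _ y))) ⟩
  -- The mixed terms, with one matrix on the first factor and the other on the rest, occur in both
  -- products and cancel.
  _ ≈⟨ solve 20 (λ m0 m1 n0 n1 m00 m01 m10 m11 n00 n01 n10 n11 v0 v1 ln0 ln1 lm0 lm1 lmn lnm →
         ((m0 :* ((n00 :* v0 :+ n01 :* v1) :+ ln0) :+ m1 :* ((n10 :* v0 :+ n11 :* v1) :+ ln1)) :+ ((n0 :* lm0 :+ n1 :* lm1) :+ lmn))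
         :- ((n0 :* ((m00 :* v0 :+ m01 :* v1) :+ lm0) :+ n1 :* ((m10 :* v0 :+ m11 :* v1) :+ lm1)) :+ ((m0 :* ln0 :+ m1 :* ln1) :+ lnm))
         := (((m0 :* n00 :+ m1 :* n10) :- (n0 :* m00 :+ n1 :* m10)) :* v0 :+ ((m0 :* n01 :+ m1 :* n11) :- (n0 :* m01 :+ n1 :* m11)) :* v1)
         :+ (lmn :- lnm)) C.refl
       (M a zero) (M a (suc zero)) (N a zero) (N a (suc zero))
       (M zero zero) (M zero (suc zero)) (M (suc zero) zero) (M (suc zero) (suc zero))
       (N zero zero) (N zero (suc zero)) (N (suc zero) zero) (N (suc zero) (suc zero))
       (v (zero ∷ y)) (v (suc zero ∷ y))
       (lift N (λ z → v (zero ∷ z)) y) (lift N (λ z → v (suc zero ∷ z)) y)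
       (lift M (λ z → v (zero ∷ z)) y) (lift M (λ z → v (suc zero ∷ z)) y)
       (lift M (lift N (λ z → v (a ∷ z))) y) (lift N (lift M (λ z → v (a ∷ z))) y) ⟩
  _ ≈⟨ C.+-cong (C.+-cong (C.*-congʳ (eq a zero)) (C.*-congʳ (eq a (suc zero))))
                (lift-commutator M N K eq (λ z → v (a ∷ z)) y) ⟩
  _ ∎

-- Pauli matrices and the cyclic commutation relations

σx σz -σy : Mat₂
σx zero       zero       = 0#
σx zero       (suc zero) = 1#
σx (suc zero) zero       = 1#
σx (suc zero) (suc zero) = 0#

σz zero       zero       = 1#
σz zero       (suc zero) = 0#
σz (suc zero) zero       = 0#
σz (suc zero) (suc zero) = - 1#

-σy zero       zero       = 0#
-σy zero       (suc zero) = 𝐢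
-σy (suc zero) zero       = - 𝐢
-σy (suc zero) (suc zero) = 0#

private
  -- The identity matrix in the form in which it occurs as a block of `A` between the two values of
  -- the first coordinate: there the test `suc n ≟ 1` computes to `n ≟ 0`.
  equal? : ∀ {D} → Mat D
  equal? y z = if does (differences y z ℕₚ.≟ 0) then 1# else 0#

  equal?-·ᵥ : ∀ {D} (v : V D) y → ∑X (λ z → equal? y z * v z) ≈ v y
  equal?-·ᵥ v []             = C.*-identityˡ _
  equal?-·ᵥ v (zero ∷ y)     = C.trans (C.+-cong (equal?-·ᵥ (λ z → v (zero ∷ z)) y)
    (∑X-zero {f = λ z → 0# * v (suc zero ∷ z)} λ z → C.zeroˡ _)) (C.+-identityʳ _)
  equal?-·ᵥ v (suc zero ∷ y) = C.trans (C.+-cong (∑X-zero {f = λ z → 0# * v (zero ∷ z)} λ z → C.zeroˡ _)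
    (equal?-·ᵥ (λ z → v (suc zero ∷ z)) y)) (C.+-identityˡ _)

-- A neighbour either shares the first coordinate and is adjacent in the rest, or flips it and
-- agrees in the rest; the flip is σx on the first factor.
A-·ᵥ : ∀ {D} (v : V D) → A ·ᵥ v ≈ᵥ lift σx v
A-·ᵥ v []             = C.zeroˡ _
A-·ᵥ v (zero ∷ y)     = C.trans
  (C.+-cong (A-·ᵥ (λ z → v (zero ∷ z)) y) (equal?-·ᵥ (λ z → v (suc zero ∷ z)) y))
  (solve 3 (λ a b c → a :+ b := (:0 :* c :+ :1 :* b) :+ a) C.refl _ _ (v (zero ∷ y)))
A-·ᵥ v (suc zero ∷ y) = C.trans
  (C.+-cong (equal?-·ᵥ (λ z → v (zero ∷ z)) y) (A-·ᵥ (λ z → v (suc zero ∷ z)) y))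
  (solve 3 (λ a b c → b :+ a := (:1 :* b :+ :0 :* c) :+ a) C.refl _ _ (v (suc zero ∷ y)))

ϑ-suc : ∀ D j → ϑ D (suc j) ≈ ϑ D j + - (1# + 1#)
ϑ-suc D j = C.trans (ϑ-value D (suc j)) (C.trans (C.+-congˡ (C.-‿cong (C.+-cong (ι-suc j) (ι-suc j))))
  (C.trans (solve 2 (λ d j → d :- ((:1 :+ j) :+ (:1 :+ j)) := (d :- (j :+ j)) :- (:1 :+ :1)) C.refl (ι D) (ι j))
    (C.+-congʳ (C.sym (ϑ-value D j)))))

ϑ-dim-suc : ∀ D j → ϑ (suc D) j ≈ 1# + ϑ D j
ϑ-dim-suc D j = C.trans (ϑ-value (suc D) j) (C.trans (C.+-congʳ (ι-suc D))
  (C.trans (C.+-assoc 1# (ι D) _) (C.+-congˡ (C.sym (ϑ-value D j)))))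

A*-·ᵥ : ∀ {D} (v : V D) → A* ·ᵥ v ≈ᵥ λ y → ϑ D (∂ x₀ y) * v y
A*-·ᵥ v = diag-·ᵥ _ v

E*-·ᵥ : ∀ {D} i (v : V D) → E* i ·ᵥ v ≈ᵥ λ y → (if does (∂ x₀ y ℕₚ.≟ i) then 1# else 0#) * v y
E*-·ᵥ i v = diag-·ᵥ _ v

-- Each coordinate 0 contributes 1 and each coordinate 1 contributes -1, which makes D - 2∂ in
-- total.
lift-σz : ∀ {D} (v : V D) y → lift σz v y ≈ ϑ D (∂ x₀ y) * v y
lift-σz v []                       = C.sym (C.zeroˡ _)
lift-σz {suc D} v (zero ∷ y)       = begin
  _                                                       ≈⟨ C.+-congˡ (lift-σz (λ z → v (zero ∷ z)) y) ⟩
  _                                                       ≈⟨ solve 3 (λ a b t → (:1 :* a :+ :0 :* b) :+ t :* a := (:1 :+ t) :* a) C.refl (v (zero ∷ y)) (v (suc zero ∷ y)) (ϑ D (differences x₀ y)) ⟩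
  (1# + ϑ D (differences x₀ y)) * v (zero ∷ y)            ≈⟨ C.*-congʳ (ϑ-dim-suc D (differences x₀ y)) ⟨
  ϑ (suc D) (differences x₀ y) * v (zero ∷ y)             ∎
lift-σz {suc D} v (suc zero ∷ y)   = begin
  _                                                       ≈⟨ C.+-congˡ (lift-σz (λ z → v (suc zero ∷ z)) y) ⟩
  _                                                       ≈⟨ solve 3 (λ a b t → (:0 :* a :+ (:- :1) :* b) :+ t :* b := ((:1 :+ t) :- (:1 :+ :1)) :* b) C.refl (v (zero ∷ y)) (v (suc zero ∷ y)) (ϑ D (differences x₀ y)) ⟩
  ((1# + ϑ D k) + - (1# + 1#)) * v (suc zero ∷ y)         ≈⟨ C.*-congʳ (C.+-congʳ (ϑ-dim-suc D k)) ⟨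
  (ϑ (suc D) k + - (1# + 1#)) * v (suc zero ∷ y)          ≈⟨ C.*-congʳ (ϑ-suc (suc D) k) ⟨
  ϑ (suc D) (suc k) * v (suc zero ∷ y)                    ∎
  where k = differences x₀ y

2𝐢 : ℂ
2𝐢 = 𝐢 + 𝐢

lift-scaled : ∀ {D} c M (v : V D) y → lift (λ a b → c * M a b) v y ≈ c * lift M v y
lift-scaled c M v []      = C.sym (C.zeroʳ _)
lift-scaled c M v (a ∷ y) = C.trans (C.+-congˡ (lift-scaled c M (λ z → v (a ∷ z)) y))
  (solve 6 (λ i a b c d e → ((i :* a) :* b :+ (i :* c) :* d) :+ i :* e := i :* ((a :* b :+ c :* d) :+ e)) C.refl _ _ _ _ _ _)

-- The sign of `-σy` is dictated by the definition of `Aᵋ`, as σxσz - σzσx = -2𝐢σy. With it, all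
-- three cyclic commutators carry the same factor 2𝐢, and the relations are invariant under
-- rotation.
σxσz : ∀ {D} (v : V D) y → lift σx (lift σz v) y + - lift σz (lift σx v) y ≈ 2𝐢 * lift -σy v y
σxσz v y = C.trans (lift-commutator σx σz (λ a b → 2𝐢 * -σy a b) eq v y) (lift-scaled 2𝐢 -σy v y)
  where
  eq : ∀ a b → (σx a zero * σz zero b + σx a (suc zero) * σz (suc zero) b) + - (σz a zero * σx zero b + σz a (suc zero) * σx (suc zero) b) ≈ 2𝐢 * -σy a b
  eq zero       zero       = solve 0 ((:0 :* :1 :+ :1 :* :0) :- (:1 :* :0 :+ :0 :* :1) := (:𝐢 :+ :𝐢) :* :0) C.refl
  eq zero       (suc zero) = solve 0 ((:0 :* :0 :+ :1 :* (:- :1)) :- (:1 :* :1 :+ :0 :* :0) := (:𝐢 :+ :𝐢) :* :𝐢) C.refl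
  eq (suc zero) zero       = solve 0 ((:1 :* :1 :+ :0 :* :0) :- (:0 :* :0 :+ (:- :1) :* :1) := (:𝐢 :+ :𝐢) :* (:- :𝐢)) C.refl
  eq (suc zero) (suc zero) = solve 0 ((:1 :* :0 :+ :0 :* (:- :1)) :- (:0 :* :1 :+ (:- :1) :* :0) := (:𝐢 :+ :𝐢) :* :0) C.refl

σzσy : ∀ {D} (v : V D) y → lift σz (lift -σy v) y + - lift -σy (lift σz v) y ≈ 2𝐢 * lift σx v y
σzσy v y = C.trans (lift-commutator σz -σy (λ a b → 2𝐢 * σx a b) eq v y) (lift-scaled 2𝐢 σx v y)
  where
  eq : ∀ a b → (σz a zero * -σy zero b + σz a (suc zero) * -σy (suc zero) b) + - (-σy a zero * σz zero b + -σy a (suc zero) * σz (suc zero) b) ≈ 2𝐢 * σx a b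
  eq zero       zero       = solve 0 ((:1 :* :0 :+ :0 :* (:- :𝐢)) :- (:0 :* :1 :+ :𝐢 :* :0) := (:𝐢 :+ :𝐢) :* :0) C.refl
  eq zero       (suc zero) = solve 0 ((:1 :* :𝐢 :+ :0 :* :0) :- (:0 :* :0 :+ :𝐢 :* (:- :1)) := (:𝐢 :+ :𝐢) :* :1) C.refl
  eq (suc zero) zero       = solve 0 ((:0 :* :0 :+ (:- :1) :* (:- :𝐢)) :- ((:- :𝐢) :* :1 :+ :0 :* :0) := (:𝐢 :+ :𝐢) :* :1) C.refl
  eq (suc zero) (suc zero) = solve 0 ((:0 :* :𝐢 :+ (:- :1) :* :0) :- ((:- :𝐢) :* :0 :+ :0 :* (:- :1)) := (:𝐢 :+ :𝐢) :* :0) C.refl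

σyσx : ∀ {D} (v : V D) y → lift -σy (lift σx v) y + - lift σx (lift -σy v) y ≈ 2𝐢 * lift σz v y
σyσx v y = C.trans (lift-commutator -σy σx (λ a b → 2𝐢 * σz a b) eq v y) (lift-scaled 2𝐢 σz v y)
  where
  eq : ∀ a b → (-σy a zero * σx zero b + -σy a (suc zero) * σx (suc zero) b) + - (σx a zero * -σy zero b + σx a (suc zero) * -σy (suc zero) b) ≈ 2𝐢 * σz a b
  eq zero       zero       = solve 0 ((:0 :* :0 :+ :𝐢 :* :1) :- (:0 :* :0 :+ :1 :* (:- :𝐢)) := (:𝐢 :+ :𝐢) :* :1) C.refl
  eq zero       (suc zero) = solve 0 ((:0 :* :1 :+ :𝐢 :* :0) :- (:0 :* :𝐢 :+ :1 :* :0) := (:𝐢 :+ :𝐢) :* :0) C.refl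
  eq (suc zero) zero       = solve 0 (((:- :𝐢) :* :0 :+ :0 :* :1) :- (:1 :* :0 :+ :0 :* (:- :𝐢)) := (:𝐢 :+ :𝐢) :* :0) C.refl
  eq (suc zero) (suc zero) = solve 0 (((:- :𝐢) :* :1 :+ :0 :* :0) :- (:1 :* :𝐢 :+ :0 :* :0) := (:𝐢 :+ :𝐢) :* (:- :1)) C.refl

-- Conjugation by Kronecker powers

kron-∷ : ∀ {D} (Q : Mat₂) (v : V (suc D)) a y → (kroneckerPower Q ·ᵥ v) (a ∷ y) ≈
  Q a zero * (kroneckerPower Q ·ᵥ λ z → v (zero ∷ z)) y + Q a (suc zero) * (kroneckerPower Q ·ᵥ λ z → v (suc zero ∷ z)) y
kron-∷ Q v a y = C.+-cong (half zero) (half (suc zero))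
  where
  half : ∀ b → ∑X (λ z → (Q a b * kroneckerPower Q y z) * v (b ∷ z)) ≈ Q a b * (kroneckerPower Q ·ᵥ λ z → v (b ∷ z)) y
  half b = C.trans (∑X-cong λ z → C.*-assoc (Q a b) (kroneckerPower Q y z) (v (b ∷ z))) (∑X-*ˡ (Q a b) λ z → kroneckerPower Q y z * v (b ∷ z))

-- An intertwiner QM = NQ on one factor, applied in every factor at once, intertwines the two
-- derivations.
kron-lift : ∀ {D} (Q M N : Mat₂) →
  (∀ a b → Q a zero * M zero b + Q a (suc zero) * M (suc zero) b ≈ N a zero * Q zero b + N a (suc zero) * Q (suc zero) b) →
  ∀ (v : V D) → kroneckerPower Q ·ᵥ lift M v ≈ᵥ lift N (kroneckerPower Q ·ᵥ v)
kron-lift Q M N eq v []      = C.zeroʳ _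
kron-lift Q M N eq v (a ∷ y) = begin
  _ ≈⟨ kron-∷ Q (lift M v) a y ⟩
  _ ≈⟨ C.+-cong (C.*-congˡ (half zero)) (C.*-congˡ (half (suc zero))) ⟩
  _ ≈⟨ solve 10 (λ q0 q1 m00 m01 m10 m11 k0 k1 l0 l1 →
         q0 :* ((m00 :* k0 :+ m01 :* k1) :+ l0) :+ q1 :* ((m10 :* k0 :+ m11 :* k1) :+ l1)
         := ((q0 :* m00 :+ q1 :* m10) :* k0 :+ (q0 :* m01 :+ q1 :* m11) :* k1) :+ (q0 :* l0 :+ q1 :* l1)) C.refl
       (Q a zero) (Q a (suc zero)) (M zero zero) (M zero (suc zero)) (M (suc zero) zero) (M (suc zero) (suc zero))
       (K zero y) (K (suc zero) y) (lift N (K zero) y) (lift N (K (suc zero)) y) ⟩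
  _ ≈⟨ C.+-congʳ (C.+-cong (C.*-congʳ (eq a zero)) (C.*-congʳ (eq a (suc zero)))) ⟩
  _ ≈⟨ solve 10 (λ n0 n1 q00 q01 q10 q11 k0 k1 x y →
         ((n0 :* q00 :+ n1 :* q10) :* k0 :+ (n0 :* q01 :+ n1 :* q11) :* k1) :+ (x :+ y)
         := (n0 :* (q00 :* k0 :+ q01 :* k1) :+ n1 :* (q10 :* k0 :+ q11 :* k1)) :+ (x :+ y)) C.refl
       (N a zero) (N a (suc zero)) (Q zero zero) (Q zero (suc zero)) (Q (suc zero) zero) (Q (suc zero) (suc zero))
       (K zero y) (K (suc zero) y) _ _ ⟩
  _ ≈⟨ C.+-cong (C.+-cong (C.*-congˡ (kron-∷ Q v zero y)) (C.*-congˡ (kron-∷ Q v (suc zero) y))) rest ⟨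
  _ ∎
  where
  K : Fin 2 → V _
  K b = kroneckerPower Q ·ᵥ λ z → v (b ∷ z)
  half : ∀ b → (kroneckerPower Q ·ᵥ λ z → lift M v (b ∷ z)) y ≈ (M b zero * K zero y + M b (suc zero) * K (suc zero) y) + lift N (K b) y
  half b = C.trans (linear₃ (·ᵥ-linear (kroneckerPower Q)) _ _ _ _ _ y) (C.+-congˡ (kron-lift Q M N eq (λ z → v (b ∷ z)) y))
  rest : lift N (λ z → (kroneckerPower Q ·ᵥ v) (a ∷ z)) y ≈ Q a zero * lift N (K zero) y + Q a (suc zero) * lift N (K (suc zero)) y
  rest = C.trans (lift-linear N .cong (kron-∷ Q v a) y) (C.trans (lift-linear N .add _ _ y)
    (C.+-cong (lift-linear N .scale _ (K zero) y) (lift-linear N .scale _ (K (suc zero)) y)))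

P-σx : ∀ {D} (v : V D) → P ·ᵥ lift σx v ≈ᵥ lift σz (P ·ᵥ v)
P-σx = kron-lift P₁ σx σz eq
  where
  eq : ∀ a b → P₁ a zero * σx zero b + P₁ a (suc zero) * σx (suc zero) b ≈ σz a zero * P₁ zero b + σz a (suc zero) * P₁ (suc zero) b
  eq zero       zero       = solve 0 (:1 :* :0 :+ :1 :* :1 := :1 :* :1 :+ :0 :* (:- :𝐢)) C.refl
  eq zero       (suc zero) = solve 0 (:1 :* :1 :+ :1 :* :0 := :1 :* :1 :+ :0 :* :𝐢) C.refl
  eq (suc zero) zero       = solve 0 ((:- :𝐢) :* :0 :+ :𝐢 :* :1 := :0 :* :1 :+ (:- :1) :* (:- :𝐢)) C.refl
  eq (suc zero) (suc zero) = solve 0 ((:- :𝐢) :* :1 :+ :𝐢 :* :0 := :0 :* :1 :+ (:- :1) :* :𝐢) C.refl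

P-σy : ∀ {D} (v : V D) → P ·ᵥ lift -σy v ≈ᵥ lift σx (P ·ᵥ v)
P-σy = kron-lift P₁ -σy σx eq
  where
  eq : ∀ a b → P₁ a zero * -σy zero b + P₁ a (suc zero) * -σy (suc zero) b ≈ σx a zero * P₁ zero b + σx a (suc zero) * P₁ (suc zero) b
  eq zero       zero       = solve 0 (:1 :* :0 :+ :1 :* (:- :𝐢) := :0 :* :1 :+ :1 :* (:- :𝐢)) C.refl
  eq zero       (suc zero) = solve 0 (:1 :* :𝐢 :+ :1 :* :0 := :0 :* :1 :+ :1 :* :𝐢) C.refl
  eq (suc zero) zero       = solve 0 ((:- :𝐢) :* :0 :+ :𝐢 :* (:- :𝐢) := :1 :* :1 :+ :0 :* (:- :𝐢)) C.refl
  eq (suc zero) (suc zero) = solve 0 ((:- :𝐢) :* :𝐢 :+ :𝐢 :* :0 := :1 :* :1 :+ :0 :* :𝐢) C.refl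

A*-lift : ∀ {D} (v : V D) → A* ·ᵥ v ≈ᵥ lift σz v
A*-lift v y = C.trans (A*-·ᵥ v y) (C.sym (lift-σz v y))

Aᵋ-·ᵥ : ∀ {D} (v : V D) → Aᵋ ·ᵥ v ≈ᵥ lift -σy v
Aᵋ-·ᵥ v y = begin
  (Aᵋ ·ᵥ v) y                                                                  ≈⟨ •ₘ-·ᵥ _ (A ·ₘ A* -ₘ A* ·ₘ A) v y ⟩
  (- 𝐢 * fromℚ ½) * ((A ·ₘ A* -ₘ A* ·ₘ A) ·ᵥ v) y                              ≈⟨ C.*-congˡ (-ₘ-·ᵥ (A ·ₘ A*) (A* ·ₘ A) v y) ⟩
  (- 𝐢 * fromℚ ½) * (((A ·ₘ A*) ·ᵥ v) y + - ((A* ·ₘ A) ·ᵥ v) y)                ≈⟨ C.*-congˡ (C.+-cong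
      (C.trans (·ₘ-assoc-·ᵥ A A* v y) (C.trans (A-·ᵥ _ y) (lift-linear σx .cong (A*-lift v) y)))
      (C.-‿cong (C.trans (·ₘ-assoc-·ᵥ A* A v y) (C.trans (A*-lift _ y) (lift-linear σz .cong (A-·ᵥ v) y))))) ⟩
  (- 𝐢 * fromℚ ½) * (lift σx (lift σz v) y + - lift σz (lift σx v) y)          ≈⟨ C.*-congˡ (σxσz v y) ⟩
  (- 𝐢 * fromℚ ½) * (2𝐢 * lift -σy v y)                                        ≈⟨ solve 1 (λ x → ((:- :𝐢) :* :½) :* ((:𝐢 :+ :𝐢) :* x) := x) C.refl _ ⟩
  lift -σy v y                                                                 ∎

Commutator : ∀ {D} → Mat D → Mat D → Mat D → Set
Commutator X Y Z = ∀ v y → (X ·ᵥ (Y ·ᵥ v)) y + - (Y ·ᵥ (X ·ᵥ v)) y ≈ 2𝐢 * (Z ·ᵥ v) y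

private
  transfer : ∀ {D} {X Y Z : Mat D} {M N K} → (∀ v → X ·ᵥ v ≈ᵥ lift M v) → (∀ v → Y ·ᵥ v ≈ᵥ lift N v) → (∀ v → Z ·ᵥ v ≈ᵥ lift K v) →
    (∀ v y → lift M (lift N v) y + - lift N (lift M v) y ≈ 2𝐢 * lift K v y) → Commutator X Y Z
  transfer {M = M} {N} x y z eq v w = C.trans
    (C.+-cong (C.trans (x _ w) (lift-linear M .cong (y v) w)) (C.-‿cong (C.trans (y _ w) (lift-linear N .cong (x v) w))))
    (C.trans (eq v w) (C.*-congˡ (C.sym (z v w))))

[A,A*] : ∀ {D} → Commutator (A {D}) A* Aᵋ
[A,A*] = transfer A-·ᵥ A*-lift Aᵋ-·ᵥ σxσz

[A*,Aᵋ] : ∀ {D} → Commutator (A* {D}) Aᵋ A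
[A*,Aᵋ] = transfer A*-lift Aᵋ-·ᵥ A-·ᵥ σzσy

[Aᵋ,A] : ∀ {D} → Commutator (Aᵋ {D}) A A*
[Aᵋ,A] = transfer Aᵋ-·ᵥ A-·ᵥ A*-lift σyσx

PA≈A*P : ∀ {D} (v : V D) → P ·ᵥ (A ·ᵥ v) ≈ᵥ A* ·ᵥ (P ·ᵥ v)
PA≈A*P v y = C.trans (·ᵥ-linear P .cong (A-·ᵥ v) y) (C.trans (P-σx v y) (C.sym (A*-lift _ y)))

PAᵋ≈AP : ∀ {D} (v : V D) → P ·ᵥ (Aᵋ ·ᵥ v) ≈ᵥ A ·ᵥ (P ·ᵥ v)
PAᵋ≈AP v y = C.trans (·ᵥ-linear P .cong (Aᵋ-·ᵥ v) y) (C.trans (P-σy v y) (C.sym (A-·ᵥ _ y)))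

P⁻¹P : ∀ {D} (v : V D) → P⁻¹ ·ᵥ (P ·ᵥ v) ≈ᵥ v
P⁻¹P v y = C.trans (C.sym (·ₘ-assoc-·ᵥ P⁻¹ P v y)) (C.trans (≈ₘ⇒≈ᵥ P-inverseˡ v y) (I-·ᵥ v y))

-- Spectral projections

-- What it takes for `π` to act as the spectral projections on eigenvectors of `Y`. No decomposition
-- of V is asked for: the projections are applied only to combinations of weight vectors of a
-- string.
record IsSpectral {D} (Y : Mat D) (π : ℕ → Mat D) : Set where
  field
    outside : ∀ {μ v} → (∀ j → j N.≤ D → ¬ μ ≈ ϑ D j) → Y ·ᵥ v ≈ᵥ μ •ᵥ v → v ≈ᵥ 0ᵥ
    same    : ∀ {i v} → i N.≤ D → Y ·ᵥ v ≈ᵥ ϑ D i •ᵥ v → π i ·ᵥ v ≈ᵥ v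
    other   : ∀ {i j v} → i N.≤ D → j N.≤ D → i ≢ j → Y ·ᵥ v ≈ᵥ ϑ D j •ᵥ v → π i ·ᵥ v ≈ᵥ 0ᵥ

0ᵥ-image : ∀ {D D′} {F : V D → V D′} → IsLinear F → F 0ᵥ ≈ᵥ 0ᵥ
0ᵥ-image L y = C.trans (L .cong (λ z → C.sym (C.zeroˡ 0#)) y) (C.trans (L .scale 0# 0ᵥ y) (C.zeroˡ _))

module _ {D} {K K⁻¹ Y Y′ : Mat D} (K⁻¹K : ∀ v → K⁻¹ ·ᵥ (K ·ᵥ v) ≈ᵥ v)
         (KY′≈YK : ∀ v → K ·ᵥ (Y′ ·ᵥ v) ≈ᵥ Y ·ᵥ (K ·ᵥ v)) where

  eigenvector-conjugate : ∀ {μ v} → Y′ ·ᵥ v ≈ᵥ μ •ᵥ v → Y ·ᵥ (K ·ᵥ v) ≈ᵥ μ •ᵥ (K ·ᵥ v)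
  eigenvector-conjugate {μ} {v} p y =
    C.trans (C.sym (KY′≈YK v y)) (C.trans (·ᵥ-linear K .cong p y) (·ᵥ-linear K .scale μ v y))

  zero-conjugate : ∀ {v} → K ·ᵥ v ≈ᵥ 0ᵥ → v ≈ᵥ 0ᵥ
  zero-conjugate {v} p y = C.trans (C.sym (K⁻¹K v y)) (C.trans (·ᵥ-linear K⁻¹ .cong p y) (0ᵥ-image (·ᵥ-linear K⁻¹) y))

  spectral-conjugate : ∀ {π π′} → (∀ i v → π′ i ·ᵥ v ≈ᵥ K⁻¹ ·ᵥ (π i ·ᵥ (K ·ᵥ v))) → IsSpectral Y π → IsSpectral Y′ π′
  spectral-conjugate π′≈ s = record
    { outside = λ μ≉ p → zero-conjugate (outside μ≉ (eigenvector-conjugate p))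
    ; same    = λ i≤D p y → C.trans (π′≈ _ _ y) (C.trans (·ᵥ-linear K⁻¹ .cong (same i≤D (eigenvector-conjugate p)) y) (K⁻¹K _ y))
    ; other   = λ i≤D j≤D i≢j p y → C.trans (π′≈ _ _ y)
        (C.trans (·ᵥ-linear K⁻¹ .cong (other i≤D j≤D i≢j (eigenvector-conjugate p)) y) (0ᵥ-image (·ᵥ-linear K⁻¹) y))
    }
    where open IsSpectral s

x≈y⇒x-y≈0 : ∀ {x y} → x ≈ y → x + - y ≈ 0#
x≈y⇒x-y≈0 x≈y = C.trans (C.+-congʳ x≈y) (C.-‿inverseʳ _)

x-y≈0⇒x≈y : ∀ {x y} → x + - y ≈ 0# → x ≈ y
x-y≈0⇒x≈y {x} {y} e = C.trans (solve 2 (λ x y → x := (x :- y) :+ y) C.refl x y) (C.trans (C.+-congʳ e) (C.+-identityˡ y))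

differences≤ : ∀ {D} (y z : X D) → differences y z N.≤ D
differences≤ []       []       = N.z≤n
differences≤ (a ∷ y)  (b ∷ z) with does (a Finₚ.≟ b)
... | true  = ℕₚ.m≤n⇒m≤1+n (differences≤ y z)
... | false = N.s≤s (differences≤ y z)

-- The factor for θₖ in the Lagrange polynomial of θᵢ, evaluated at θⱼ.
factorScalar : ℕ → ℕ → ℕ → ℕ → ℂ
factorScalar D j i k = fromℚ (reciprocal (θ D i Z.- θ D k)) * (ϑ D j + - ϑ D k)

indices≢ : ℕ → ℕ → List ℕ
indices≢ D i = List.filter (λ k → ¬? (k ℕₚ.≟ i)) (List.upTo (suc D))

product-·ᵥ : ∀ {D} (F : ℕ → Mat D) (s : ℕ → ℂ) v → (∀ k → F k ·ᵥ v ≈ᵥ s k •ᵥ v) → ∀ l →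
             List.foldr _·ₘ_ I (List.map F l) ·ᵥ v ≈ᵥ List.foldr (λ k c → s k * c) 1# l •ᵥ v
product-·ᵥ F s v eq List.[]       y = C.trans (I-·ᵥ v y) (C.sym (C.*-identityˡ _))
product-·ᵥ F s v eq (k List.∷ l) y = begin
  ((F k ·ₘ Fl) ·ᵥ v) y        ≈⟨ ·ₘ-assoc-·ᵥ (F k) Fl v y ⟩
  (F k ·ᵥ (Fl ·ᵥ v)) y        ≈⟨ ·ᵥ-linear (F k) .cong (product-·ᵥ F s v eq l) y ⟩
  (F k ·ᵥ (sl •ᵥ v)) y        ≈⟨ ·ᵥ-linear (F k) .scale sl v y ⟩
  sl * (F k ·ᵥ v) y           ≈⟨ C.*-congˡ (eq k y) ⟩
  sl * (s k * v y)            ≈⟨ solve 3 (λ a b c → a :* (b :* c) := (b :* a) :* c) C.refl sl (s k) (v y) ⟩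
  (s k * sl) * v y            ∎
  where
  Fl = List.foldr _·ₘ_ I (List.map F l)
  sl = List.foldr (λ k c → s k * c) 1# l

product-one : ∀ {s : ℕ → ℂ} {l} → All (λ k → s k ≈ 1#) l → List.foldr (λ k c → s k * c) 1# l ≈ 1#
product-one All.[]       = C.refl
product-one (p All.∷ ps) = C.trans (C.*-cong p (product-one ps)) (C.*-identityˡ 1#)

product-zero : ∀ {s : ℕ → ℂ} {k l} → k ∈ˡ l → s k ≈ 0# → List.foldr (λ k c → s k * c) 1# l ≈ 0#
product-zero (hereˡ ≡.refl) p = C.trans (C.*-congʳ p) (C.zeroˡ _)
product-zero (thereˡ k∈l)   p = C.trans (C.*-congˡ (product-zero k∈l p)) (C.zeroʳ _)

-- For `Y = A` this agrees by computation with the factors inside `E`; for `Y = A*` it gives the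
-- polynomial whose value is `E*`.
factor : ∀ {D} → Mat D → ℕ → ℕ → Mat D
factor {D} Y i k = fromℚ (reciprocal (θ D i Z.- θ D k)) •ₘ (Y -ₘ ϑ D k •ₘ I)

-- Stated at a single vertex to serve both eigenvectors of `A` and arbitrary vectors under `A*`,
-- where the scalar varies with the vertex.
factor-·ᵥ : ∀ {D} (Y : Mat D) {j} {v} {y} → (Y ·ᵥ v) y ≈ ϑ D j * v y →
            ∀ i k → (factor Y i k ·ᵥ v) y ≈ factorScalar D j i k * v y
factor-·ᵥ {D} Y {j} {v} {y} Yv i k = begin
  ((c •ₘ (Y -ₘ ϑ D k •ₘ I)) ·ᵥ v) y              ≈⟨ •ₘ-·ᵥ c (Y -ₘ ϑ D k •ₘ I) v y ⟩
  c * ((Y -ₘ ϑ D k •ₘ I) ·ᵥ v) y                 ≈⟨ C.*-congˡ (-ₘ-·ᵥ Y (ϑ D k •ₘ I) v y) ⟩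
  c * ((Y ·ᵥ v) y + - ((ϑ D k •ₘ I) ·ᵥ v) y)     ≈⟨ C.*-congˡ (C.+-cong Yv (C.-‿cong (C.trans (•ₘ-·ᵥ (ϑ D k) I v y) (C.*-congˡ (I-·ᵥ v y))))) ⟩
  c * (ϑ D j * v y + - (ϑ D k * v y))            ≈⟨ solve 4 (λ c a b v → c :* (a :* v :- b :* v) := (c :* (a :- b)) :* v) C.refl c (ϑ D j) (ϑ D k) (v y) ⟩
  (c * (ϑ D j + - ϑ D k)) * v y                  ∎
  where c = fromℚ (reciprocal (θ D i Z.- θ D k))

factorScalars-other : ∀ {D i j} → j N.≤ D → i ≢ j → List.foldr (λ k c → factorScalar D j i k * c) 1# (indices≢ D i) ≈ 0#
factorScalars-other {D} {i} {j} j≤D i≢j = product-zero {s = factorScalar D j i}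
  (∈-filter⁺ (λ k → ¬? (k ℕₚ.≟ i)) (∈-upTo⁺ (N.s≤s j≤D)) (i≢j ∘ ≡.sym))
  (C.trans (C.*-congˡ (C.-‿inverseʳ (ϑ D j))) (C.zeroʳ _))

factorScalars-same : ∀ {D i} → List.foldr (λ k c → factorScalar D i i k * c) 1# (indices≢ D i) ≈ 1#
factorScalars-same {D} {i} = product-one (All.map one (all-filter (λ k → ¬? (k ℕₚ.≟ i)) (List.upTo (suc D))))
  where
  one : ∀ {k} → k ≢ i → factorScalar D i i k ≈ 1#
  one {k} k≢i = C.trans (C.*-congˡ (C.sym (C.trans (fromℤ-+ (θ D i) (Z.- θ D k)) (C.+-congˡ (fromℤ-neg (θ D k))))))
    (fromℤ-reciprocal (θ D i Z.- θ D k) λ e → k≢i (≡.sym (ϑ-injective D (C.reflexive (≡.cong fromℤ (ℤₚ.i-j≡0⇒i≡j (θ D i) (θ D k) e))))))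

E-eigenvector : ∀ {D} i {j} {v : V D} → A ·ᵥ v ≈ᵥ ϑ D j •ᵥ v →
                E i ·ᵥ v ≈ᵥ List.foldr (λ k c → factorScalar D j i k * c) 1# (indices≢ D i) •ᵥ v
E-eigenvector {D} i {j} {v} Av = product-·ᵥ (factor A i) (factorScalar D j i) v (λ k y → factor-·ᵥ A {j} {v} (Av y) i k) (indices≢ D i)

E-other : ∀ {D i j} {v : V D} → j N.≤ D → i ≢ j → A ·ᵥ v ≈ᵥ ϑ D j •ᵥ v → E i ·ᵥ v ≈ᵥ 0ᵥ
E-other {i = i} {j} {v} j≤D i≢j Av y = C.trans (E-eigenvector i {j} {v} Av y) (C.trans (C.*-congʳ (factorScalars-other {i = i} {j} j≤D i≢j)) (C.zeroˡ _))

E-same : ∀ {D i} {v : V D} → A ·ᵥ v ≈ᵥ ϑ D i •ᵥ v → E i ·ᵥ v ≈ᵥ v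
E-same {D} {i} {v} Av y = C.trans (E-eigenvector i {i} {v} Av y) (C.trans (C.*-congʳ (factorScalars-same {D} {i})) (C.*-identityˡ _))

-- `E*` is defined as a diagonal matrix; written as a polynomial in `A*` it is seen to preserve
-- every T-module.
E*-product : ∀ {D} i (v : V D) → List.foldr _·ₘ_ I (List.map (factor A* i) (indices≢ D i)) ·ᵥ v ≈ᵥ E* i ·ᵥ v
E*-product {D} i v y = C.trans (product (indices≢ D i) v) (C.trans (C.*-congʳ (value (∂ x₀ y ℕₚ.≟ i))) (C.sym (E*-·ᵥ i v y)))
  where
  s : ℕ → ℂ
  s = factorScalar D (∂ x₀ y) i
  -- The vertex is fixed and the vector is general: at `y` every factor acts as a scalar, whatever
  -- vector it is applied to.
  product : ∀ l v → (List.foldr _·ₘ_ I (List.map (factor A* i) l) ·ᵥ v) y ≈ List.foldr (λ k c → s k * c) 1# l * v y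
  product List.[]       v = C.trans (I-·ᵥ v y) (C.sym (C.*-identityˡ _))
  product (k List.∷ l) v = begin
    ((factor A* i k ·ₘ Fl) ·ᵥ v) y   ≈⟨ ·ₘ-assoc-·ᵥ (factor A* i k) Fl v y ⟩
    (factor A* i k ·ᵥ (Fl ·ᵥ v)) y   ≈⟨ factor-·ᵥ A* {∂ x₀ y} {Fl ·ᵥ v} (A*-·ᵥ (Fl ·ᵥ v) y) i k ⟩
    s k * (Fl ·ᵥ v) y                ≈⟨ C.*-congˡ (product l v) ⟩
    s k * (_ * v y)                  ≈⟨ C.*-assoc _ _ _ ⟨
    (s k * _) * v y                  ∎
    where Fl = List.foldr _·ₘ_ I (List.map (factor A* i) l)
  value : (d : Dec (∂ x₀ y ≡ i)) → List.foldr (λ k c → s k * c) 1# (indices≢ D i) ≈ (if does d then 1# else 0#)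
  value (yes ≡.refl) = factorScalars-same {D} {i}
  value (no k≢i)     = factorScalars-other {D} {i} {∂ x₀ y} (differences≤ x₀ y) (k≢i ∘ ≡.sym)

module Spectra (lem : LEM) where

  open RealDomain lem using (domain)

  x*y≈z*y⇒y≈0 : ∀ {x y z} → x * y ≈ z * y → ¬ x ≈ z → y ≈ 0#
  x*y≈z*y⇒y≈0 {x} {y} {z} e x≉z = Sum.fromInj₂ (λ x-z≈0 → contradiction (x-y≈0⇒x≈y x-z≈0) x≉z)
    (domain (x + - z) y (C.trans (solve 3 (λ x y z → (x :- z) :* y := x :* y :- z :* y) C.refl x y z) (x≈y⇒x-y≈0 e)))

  A*-spectral : ∀ {D} → IsSpectral (A* {D}) E*
  A*-spectral {D} = record
    { outside = λ {μ} {v} μ≉ p y → x*y≈z*y⇒y≈0 (eigen v p y) λ e → μ≉ _ (differences≤ x₀ y) (C.sym e)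
    ; same    = λ {i} {v} _ p y → C.trans (E*-·ᵥ i v y) (same v p y (∂ x₀ y ℕₚ.≟ i))
    ; other   = λ {i} {j} {v} _ _ i≢j p y → C.trans (E*-·ᵥ i v y) (other v i≢j p y (∂ x₀ y ℕₚ.≟ i))
    }
    where
    eigen : ∀ {μ} v → A* ·ᵥ v ≈ᵥ μ •ᵥ v → ∀ y → ϑ D (∂ x₀ y) * v y ≈ μ * v y
    eigen v p y = C.trans (C.sym (A*-·ᵥ v y)) (p y)
    same : ∀ {i} v → A* ·ᵥ v ≈ᵥ ϑ D i •ᵥ v → ∀ y (d : Dec (∂ x₀ y ≡ i)) → (if does d then 1# else 0#) * v y ≈ v y
    same v p y (yes _)  = C.*-identityˡ _
    same v p y (no k≢i) = C.trans (C.zeroˡ _) (C.sym (x*y≈z*y⇒y≈0 (eigen v p y) (k≢i ∘ ϑ-injective D)))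
    other : ∀ {i j} v → i ≢ j → A* ·ᵥ v ≈ᵥ ϑ D j •ᵥ v → ∀ y (d : Dec (∂ x₀ y ≡ i)) → (if does d then 1# else 0#) * v y ≈ 0#
    other v i≢j p y (yes k≡i) = C.trans (C.*-identityˡ _) (x*y≈z*y⇒y≈0 (eigen v p y) λ e → i≢j (≡.trans (≡.sym k≡i) (ϑ-injective D e)))
    other v i≢j p y (no _)    = C.zeroˡ _

  -- Only the exclusion of other eigenvalues is carried over from the diagonal matrix `A*` by `P`;
  -- the rest is the evaluation of Lagrange polynomials at an eigenvalue.
  A-spectral : ∀ {D} → IsSpectral (A {D}) E
  A-spectral {D} = record
    { outside = λ μ≉ p → zero-conjugate {K = P} {P⁻¹} {A*} {A} P⁻¹P PA≈A*P
        (IsSpectral.outside A*-spectral μ≉ (eigenvector-conjugate {K = P} {P⁻¹} {A*} {A} P⁻¹P PA≈A*P p))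
    ; same    = λ {i} {v} _ p → E-same {D} {i} {v} p
    ; other   = λ {i} {j} {v} _ j≤D i≢j p → E-other {D} {i} {j} {v} j≤D i≢j p
    }

  Aᵋ-spectral : ∀ {D} → IsSpectral (Aᵋ {D}) Eᵋ
  Aᵋ-spectral = spectral-conjugate {K = P} {P⁻¹} {A} {Aᵋ} P⁻¹P PAᵋ≈AP
    (λ i v y → C.trans (·ₘ-assoc-·ᵥ P⁻¹ (E i ·ₘ P) v y) (·ᵥ-linear P⁻¹ .cong (·ₘ-assoc-·ᵥ (E i) P v) y)) A-spectral

-- Linear combinations

lincomb-cong : ∀ {D n} {c c′ : Fin n → ℂ} {v v′ : Fin n → V D} →
               (∀ i → c i ≈ c′ i) → (∀ i → v i ≈ᵥ v′ i) → lincomb c v ≈ᵥ lincomb c′ v′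
lincomb-cong {n = zero}  p q y = C.refl
lincomb-cong {n = suc n} p q y = C.+-cong (C.*-cong (p zero) (q zero y)) (lincomb-cong (p ∘ suc) (q ∘ suc) y)

lincomb-congˡ : ∀ {D n} {c c′ : Fin n → ℂ} (v : Fin n → V D) → (∀ i → c i ≈ c′ i) → lincomb c v ≈ᵥ lincomb c′ v
lincomb-congˡ v p = lincomb-cong {v = v} p λ _ _ → C.refl

lincomb-congʳ : ∀ {D n} (c : Fin n → ℂ) {v v′ : Fin n → V D} → (∀ i → v i ≈ᵥ v′ i) → lincomb c v ≈ᵥ lincomb c v′
lincomb-congʳ c = lincomb-cong {c = c} λ _ → C.refl

lincomb-zero : ∀ {D n} {c : Fin n → ℂ} {v : Fin n → V D} → (∀ i → c i •ᵥ v i ≈ᵥ 0ᵥ) → lincomb c v ≈ᵥ 0ᵥ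
lincomb-zero {n = zero}  p y = C.refl
lincomb-zero {n = suc n} p y = C.trans (C.+-cong (p zero y) (lincomb-zero (p ∘ suc) y)) (C.+-identityˡ 0#)

lincomb-single : ∀ {D n} {c : Fin n → ℂ} {v : Fin n → V D} i →
                 (∀ j → j ≢ i → c j •ᵥ v j ≈ᵥ 0ᵥ) → lincomb c v ≈ᵥ c i •ᵥ v i
lincomb-single zero    p y = C.trans (C.+-congˡ (lincomb-zero (λ j → p (suc j) λ ()) y)) (C.+-identityʳ _)
lincomb-single (suc i) p y = C.trans
  (C.+-cong (p zero (λ ()) y) (lincomb-single i (λ j j≢i → p (suc j) (j≢i ∘ Finₚ.suc-injective)) y)) (C.+-identityˡ _)

lincomb-+ : ∀ {D n} (c c′ : Fin n → ℂ) (v : Fin n → V D) → lincomb c v +ᵥ lincomb c′ v ≈ᵥ lincomb (λ i → c i + c′ i) v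
lincomb-+ {n = zero}  c c′ v y = C.+-identityˡ 0#
lincomb-+ {n = suc n} c c′ v y = C.trans
  (solve 5 (λ a b x p q → (a :* x :+ p) :+ (b :* x :+ q) := (a :+ b) :* x :+ (p :+ q)) C.refl (c zero) (c′ zero) (v zero y) _ _)
  (C.+-congˡ (lincomb-+ (c ∘ suc) (c′ ∘ suc) (v ∘ suc) y))

lincomb-• : ∀ {D n} a (c : Fin n → ℂ) (v : Fin n → V D) → a •ᵥ lincomb c v ≈ᵥ lincomb (λ i → a * c i) v
lincomb-• {n = zero}  a c v y = C.zeroʳ a
lincomb-• {n = suc n} a c v y = C.trans
  (solve 4 (λ a c x p → a :* (c :* x :+ p) := (a :* c) :* x :+ a :* p) C.refl a (c zero) (v zero y) _)
  (C.+-congˡ (lincomb-• a (c ∘ suc) (v ∘ suc) y))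

lincomb-scaled : ∀ {D n} (c a : Fin n → ℂ) (v : Fin n → V D) →
                 lincomb c (λ i → a i •ᵥ v i) ≈ᵥ lincomb (λ i → c i * a i) v
lincomb-scaled {n = zero}  c a v y = C.refl
lincomb-scaled {n = suc n} c a v y = C.+-cong (C.sym (C.*-assoc _ _ _)) (lincomb-scaled (c ∘ suc) (a ∘ suc) (v ∘ suc) y)

lincomb-image : ∀ {D D′ n} {F : V D → V D′} → IsLinear F → (c : Fin n → ℂ) (v : Fin n → V D) →
                F (lincomb c v) ≈ᵥ lincomb c (F ∘ v)
lincomb-image {n = zero}  L c v y = 0ᵥ-image L y
lincomb-image {n = suc n} L c v y = C.trans (L .add _ _ y)
  (C.+-cong (L .scale (c zero) (v zero) y) (lincomb-image L (c ∘ suc) (v ∘ suc) y))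

lincomb-∈ : ∀ {D n} {U : Pred (V D) 0ℓ} → IsSubspace U → (c : Fin n → ℂ) {v : Fin n → V D} →
            (∀ i → v i ∈ U) → lincomb c v ∈ U
lincomb-∈ {n = zero}  S c p = IsSubspace.0∈ S
lincomb-∈ {n = suc n} S c p = IsSubspace.+-closed S (IsSubspace.•-closed S (c zero) (p zero)) (lincomb-∈ S (c ∘ suc) (p ∘ suc))

-- Families indexed by ℕ let raising and lowering shift indices without bounds proofs.
combo : ∀ {D} n → (ℕ → ℂ) → (ℕ → V D) → V D
combo n c w = lincomb {n = n} (c ∘ toℕ) (w ∘ toℕ)

combo-last : ∀ {D} n (c : ℕ → ℂ) (w : ℕ → V D) → combo (suc n) c w ≈ᵥ combo n c w +ᵥ c n •ᵥ w n
combo-last zero    c w y = C.+-comm _ _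
combo-last (suc n) c w y = C.trans (C.+-congˡ (combo-last n (c ∘ suc) (w ∘ suc) y)) (C.sym (C.+-assoc _ _ _))

Span : ∀ {D} → ℕ → (ℕ → V D) → Pred (V D) 0ℓ
Span n w v = ∃ λ c → v ≈ᵥ combo n c w

Span-subspace : ∀ {D} n (w : ℕ → V D) → IsSubspace (Span n w)
Span-subspace n w = record
  { resp     = λ u≈v (c , p) → c , λ y → C.trans (C.sym (u≈v y)) (p y)
  ; 0∈       = (λ _ → 0#) , λ y → C.sym (lincomb-zero {n = n} {c = λ _ → 0#} {v = w ∘ toℕ} (λ i z → C.zeroˡ _) y)
  ; +-closed = λ (c , p) (c′ , p′) → (λ k → c k + c′ k) , λ y →
      C.trans (C.+-cong (p y) (p′ y)) (lincomb-+ {n = n} (c ∘ toℕ) (c′ ∘ toℕ) (w ∘ toℕ) y)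
  ; •-closed = λ a (c , p) → (λ k → a * c k) , λ y →
      C.trans (C.*-congˡ (p y)) (lincomb-• {n = n} a (c ∘ toℕ) (w ∘ toℕ) y)
  }

∈-Span : ∀ {D} {n} (w : ℕ → V D) {k} → k N.< n → w k ∈ Span n w
∈-Span {n = suc n} w {zero}  _           = (λ { zero → 1# ; (suc _) → 0# }) , λ y → C.sym (C.trans
  (C.+-cong (C.*-identityˡ _) (lincomb-zero {n = n} {c = λ _ → 0#} {v = w ∘ suc ∘ toℕ} (λ i z → C.zeroˡ _) y)) (C.+-identityʳ _))
∈-Span {n = suc n} w {suc k} (N.s≤s k<n) with ∈-Span (w ∘ suc) k<n
... | c , p = (λ { zero → 0# ; (suc i) → c i }) , λ y → C.trans (p y) (C.sym (C.trans (C.+-congʳ (C.zeroˡ _)) (C.+-identityˡ _)))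

-- Modules with three cyclically related operators and their 𝔰𝔩₂-triples

Stable : ∀ {D} → Mat D → Pred (V D) 0ℓ → Set
Stable M U = ∀ {u} → u ∈ U → M ·ᵥ u ∈ U

-- The three parts of the theorem differ by a cyclic rotation of the operators. This interface is
-- invariant under rotation, so one argument covers all of them. Irreducibility takes the form in
-- which it is applied: a nonzero invariant subspace exhausts W.
record CyclicModule {D} (W : Pred (V D) 0ℓ) (X Y Z : Mat D) : Set₁ where
  field
    subspace    : IsSubspace W
    [X,Y]       : Commutator X Y Z
    [Y,Z]       : Commutator Y Z X
    [Z,X]       : Commutator Z X Y
    X-stable    : Stable X W
    Y-stable    : Stable Y W
    Z-stable    : Stable Z W
    irreducible : ∀ U → IsSubspace U → U ⊆ W → Stable X U → Stable Y U → Stable Z U → IsNonzero U → W ⊆ U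

rotate : ∀ {D W} {X Y Z : Mat D} → CyclicModule W X Y Z → CyclicModule W Y Z X
rotate M = record
  { subspace = subspace ; [X,Y] = [Y,Z] ; [Y,Z] = [Z,X] ; [Z,X] = [X,Y]
  ; X-stable = Y-stable ; Y-stable = Z-stable ; Z-stable = X-stable
  ; irreducible = λ U S U⊆W y z x → irreducible U S U⊆W x y z
  }
  where open CyclicModule M

-- With h = Y, these complete an 𝔰𝔩₂-triple: X = raise + lower and Z = 𝐢 (raise - lower).
raise lower : ∀ {D} (X Z : Mat D) → Op D
raise X Z v = fromℚ ½ •ᵥ (X ·ᵥ v +ᵥ (- 𝐢) •ᵥ (Z ·ᵥ v))
lower X Z v = fromℚ ½ •ᵥ (X ·ᵥ v +ᵥ 𝐢 •ᵥ (Z ·ᵥ v))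

half-linear : ∀ {D} c (X Z : Mat D) → IsLinear (λ v → fromℚ ½ •ᵥ (X ·ᵥ v +ᵥ c •ᵥ (Z ·ᵥ v)))
half-linear c X Z .cong p y = C.*-congˡ (C.+-cong (·ᵥ-linear X .cong p y) (C.*-congˡ (·ᵥ-linear Z .cong p y)))
half-linear c X Z .add u v y = C.trans
  (C.*-congˡ (C.+-cong (·ᵥ-linear X .add u v y) (C.*-congˡ (·ᵥ-linear Z .add u v y))))
  (solve 6 (λ h c a b p q → h :* ((a :+ b) :+ c :* (p :+ q)) := h :* (a :+ c :* p) :+ h :* (b :+ c :* q)) C.refl
    (fromℚ ½) c _ _ _ _)
half-linear c X Z .scale a v y = C.trans
  (C.*-congˡ (C.+-cong (·ᵥ-linear X .scale a v y) (C.*-congˡ (·ᵥ-linear Z .scale a v y))))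
  (solve 5 (λ h c a p q → h :* (a :* p :+ c :* (a :* q)) := a :* (h :* (p :+ c :* q))) C.refl (fromℚ ½) c a _ _)

·ᵥ-half : ∀ {D} (Y : Mat D) c u v y → (Y ·ᵥ (fromℚ ½ •ᵥ (u +ᵥ c •ᵥ v))) y ≈ fromℚ ½ * ((Y ·ᵥ u) y + c * (Y ·ᵥ v) y)
·ᵥ-half Y c u v y = C.trans (·ᵥ-linear Y .scale _ _ y) (C.*-congˡ
  (C.trans (·ᵥ-linear Y .add _ _ y) (C.+-congˡ (·ᵥ-linear Y .scale c v y))))

x-y≈z⇒x≈y+z : ∀ {x y z} → x + - y ≈ z → x ≈ y + z
x-y≈z⇒x≈y+z {x} {y} e = C.trans (solve 2 (λ x y → x := y :+ (x :- y)) C.refl x y) (C.+-congˡ e)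

x-y≈z⇒y≈x-z : ∀ {x y z} → x + - y ≈ z → y ≈ x + - z
x-y≈z⇒y≈x-z {x} {y} e = C.trans (solve 2 (λ x y → y := x :- (x :- y)) C.refl x y) (C.+-congˡ (C.-‿cong e))

X-decompose : ∀ {D} (X Z : Mat D) v → X ·ᵥ v ≈ᵥ raise X Z v +ᵥ lower X Z v
X-decompose X Z v y = solve 2 (λ x z → x := :½ :* (x :+ (:- :𝐢) :* z) :+ :½ :* (x :+ :𝐢 :* z)) C.refl _ _

Z-decompose : ∀ {D} (X Z : Mat D) v → Z ·ᵥ v ≈ᵥ 𝐢 •ᵥ (raise X Z v +ᵥ (- 1#) •ᵥ lower X Z v)
Z-decompose X Z v y = solve 2 (λ x z → z := :𝐢 :* (:½ :* (x :+ (:- :𝐢) :* z) :+ (:- :1) :* (:½ :* (x :+ :𝐢 :* z)))) C.refl _ _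

module Triple {D} {W : Pred (V D) 0ℓ} {X Y Z : Mat D} (M : CyclicModule W X Y Z) where

  open CyclicModule M
  open IsSubspace subspace

  e f : Op D
  e = raise X Z
  f = lower X Z

  e-linear : IsLinear e
  e-linear = half-linear (- 𝐢) X Z

  f-linear : IsLinear f
  f-linear = half-linear 𝐢 X Z

  e-stable : ∀ {v} → v ∈ W → e v ∈ W
  e-stable v∈W = •-closed _ (+-closed (X-stable v∈W) (•-closed _ (Z-stable v∈W)))

  f-stable : ∀ {v} → v ∈ W → f v ∈ W
  f-stable v∈W = •-closed _ (+-closed (X-stable v∈W) (•-closed _ (Z-stable v∈W)))

  -- [Y, X + 𝐢Z] = -2𝐢Z - 2X = -2(X + 𝐢Z); replacing 𝐢 by -𝐢 in the combination changes the sign and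
  -- gives `Ye`.
  Yf : ∀ v y → (Y ·ᵥ f v) y ≈ f (Y ·ᵥ v) y + - (1# + 1#) * f v y
  Yf v y = begin
    (Y ·ᵥ f v) y ≈⟨ ·ᵥ-half Y 𝐢 (X ·ᵥ v) (Z ·ᵥ v) y ⟩
    fromℚ ½ * ((Y ·ᵥ (X ·ᵥ v)) y + 𝐢 * (Y ·ᵥ (Z ·ᵥ v)) y)
      ≈⟨ C.*-congˡ (C.+-cong (x-y≈z⇒y≈x-z ([X,Y] v y)) (C.*-congˡ (x-y≈z⇒x≈y+z ([Y,Z] v y)))) ⟩
    fromℚ ½ * (((X ·ᵥ (Y ·ᵥ v)) y + - (2𝐢 * (Z ·ᵥ v) y)) + 𝐢 * ((Z ·ᵥ (Y ·ᵥ v)) y + 2𝐢 * (X ·ᵥ v) y))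
      ≈⟨ solve 4 (λ xy zy x z → :½ :* ((xy :- (:𝐢 :+ :𝐢) :* z) :+ :𝐢 :* (zy :+ (:𝐢 :+ :𝐢) :* x))
           := :½ :* (xy :+ :𝐢 :* zy) :+ (:- (:1 :+ :1)) :* (:½ :* (x :+ :𝐢 :* z))) C.refl _ _ _ _ ⟩
    f (Y ·ᵥ v) y + - (1# + 1#) * f v y ∎

  Ye : ∀ v y → (Y ·ᵥ e v) y ≈ e (Y ·ᵥ v) y + (1# + 1#) * e v y
  Ye v y = begin
    (Y ·ᵥ e v) y ≈⟨ ·ᵥ-half Y (- 𝐢) (X ·ᵥ v) (Z ·ᵥ v) y ⟩
    fromℚ ½ * ((Y ·ᵥ (X ·ᵥ v)) y + (- 𝐢) * (Y ·ᵥ (Z ·ᵥ v)) y)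
      ≈⟨ C.*-congˡ (C.+-cong (x-y≈z⇒y≈x-z ([X,Y] v y)) (C.*-congˡ (x-y≈z⇒x≈y+z ([Y,Z] v y)))) ⟩
    fromℚ ½ * (((X ·ᵥ (Y ·ᵥ v)) y + - (2𝐢 * (Z ·ᵥ v) y)) + (- 𝐢) * ((Z ·ᵥ (Y ·ᵥ v)) y + 2𝐢 * (X ·ᵥ v) y))
      ≈⟨ solve 4 (λ xy zy x z → :½ :* ((xy :- (:𝐢 :+ :𝐢) :* z) :+ (:- :𝐢) :* (zy :+ (:𝐢 :+ :𝐢) :* x))
           := :½ :* (xy :+ (:- :𝐢) :* zy) :+ (:1 :+ :1) :* (:½ :* (x :+ (:- :𝐢) :* z))) C.refl _ _ _ _ ⟩
    e (Y ·ᵥ v) y + (1# + 1#) * e v y ∎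

  -- [X - 𝐢Z, X + 𝐢Z] = -2𝐢[Z, X] = 4Y, and the two halves contribute 1/4.
  ef : ∀ v y → e (f v) y ≈ f (e v) y + (Y ·ᵥ v) y
  ef v y = begin
    e (f v) y
      ≈⟨ C.*-congˡ (C.+-cong (·ᵥ-half X 𝐢 (X ·ᵥ v) (Z ·ᵥ v) y) (C.*-congˡ (·ᵥ-half Z 𝐢 (X ·ᵥ v) (Z ·ᵥ v) y))) ⟩
    fromℚ ½ * (fromℚ ½ * (xx + 𝐢 * xz) + (- 𝐢) * (fromℚ ½ * (zx + 𝐢 * zz)))
      -- The solver's variables commute, so ZX is first expressed by XZ; the same substitution is
      -- undone on the other side.
      ≈⟨ C.*-congˡ (C.+-congˡ (C.*-congˡ (C.*-congˡ (C.+-congʳ zx-eq)))) ⟩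
    fromℚ ½ * (fromℚ ½ * (xx + 𝐢 * xz) + (- 𝐢) * (fromℚ ½ * ((xz + 2𝐢 * h) + 𝐢 * zz)))
      ≈⟨ solve 4 (λ xx xz zz h → :½ :* (:½ :* (xx :+ :𝐢 :* xz) :+ (:- :𝐢) :* (:½ :* ((xz :+ (:𝐢 :+ :𝐢) :* h) :+ :𝐢 :* zz)))
           := :½ :* (:½ :* (xx :+ (:- :𝐢) :* xz) :+ :𝐢 :* (:½ :* ((xz :+ (:𝐢 :+ :𝐢) :* h) :+ (:- :𝐢) :* zz))) :+ h) C.refl xx xz zz h ⟩
    fromℚ ½ * (fromℚ ½ * (xx + (- 𝐢) * xz) + 𝐢 * (fromℚ ½ * ((xz + 2𝐢 * h) + (- 𝐢) * zz))) + h
      ≈⟨ C.+-congʳ (C.*-congˡ (C.+-congˡ (C.*-congˡ (C.*-congˡ (C.+-congʳ zx-eq))))) ⟨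
    fromℚ ½ * (fromℚ ½ * (xx + (- 𝐢) * xz) + 𝐢 * (fromℚ ½ * (zx + (- 𝐢) * zz))) + h
      ≈⟨ C.+-congʳ (C.*-congˡ (C.+-cong (·ᵥ-half X (- 𝐢) (X ·ᵥ v) (Z ·ᵥ v) y) (C.*-congˡ (·ᵥ-half Z (- 𝐢) (X ·ᵥ v) (Z ·ᵥ v) y)))) ⟨
    f (e v) y + (Y ·ᵥ v) y ∎
    where
    xx = (X ·ᵥ (X ·ᵥ v)) y
    xz = (X ·ᵥ (Z ·ᵥ v)) y
    zx = (Z ·ᵥ (X ·ᵥ v)) y
    zz = (Z ·ᵥ (Z ·ᵥ v)) y
    h  = (Y ·ᵥ v) y
    zx-eq : zx ≈ xz + 2𝐢 * h
    zx-eq = x-y≈z⇒x≈y+z ([Z,X] v y)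

-- Strings of divided powers

ϑ-+ : ∀ D r k → ϑ D (r N.+ k) ≈ ϑ D r + - (ι k + ι k)
ϑ-+ D r k = C.trans (ϑ-value D (r N.+ k)) (C.trans (C.+-congˡ (C.-‿cong (C.+-cong (ι-+ r k) (ι-+ r k))))
  (C.trans (solve 3 (λ d r k → d :- ((r :+ k) :+ (r :+ k)) := (d :- (r :+ r)) :- (k :+ k)) C.refl (ι D) (ι r) (ι k))
    (C.+-congʳ (C.sym (ϑ-value D r)))))

ϑ-top : ∀ {D} m r → D ≡ m N.+ (r N.+ r) → ϑ D r ≈ ι m
ϑ-top {D} m r ≡.refl = C.trans (ϑ-value D r) (C.trans (C.+-congʳ (C.trans (ι-+ m (r N.+ r)) (C.+-congˡ (ι-+ r r))))
  (solve 2 (λ m r → (m :+ (r :+ r)) :- (r :+ r) := m) C.refl (ι m) (ι r)))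

ϑ-top⁻¹ : ∀ {D} m r → ϑ D r ≈ ι m → D ≡ m N.+ (r N.+ r)
ϑ-top⁻¹ {D} m r e = ι-injective (begin
  ι D                               ≈⟨ solve 2 (λ d r → d := (d :- (r :+ r)) :+ (r :+ r)) C.refl (ι D) (ι r) ⟩
  (ι D + - (ι r + ι r)) + (ι r + ι r) ≈⟨ C.+-cong (C.trans (C.sym (ϑ-value D r)) e) (C.sym (ι-+ r r)) ⟩
  ι m + ι (r N.+ r)                 ≈⟨ ι-+ m (r N.+ r) ⟨
  ι (m N.+ (r N.+ r))               ∎)

-- The standard basis of divided powers lowerᵏ w₀ / k! of the irreducible
-- 𝔰𝔩₂-module of highest weight m.
record IsString {D} (W : Pred (V D) 0ℓ) (X Y Z : Mat D) (r m : ℕ) (w : ℕ → V D) : Set where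
  field
    dimension : D ≡ m N.+ (r N.+ r)
    member    : ∀ k → w k ∈ W
    nonzero   : w 0 ≉ᵥ 0ᵥ
    weight    : ∀ k → Y ·ᵥ w k ≈ᵥ ϑ D (r N.+ k) •ᵥ w k
    lowered   : ∀ k → lower X Z (w k) ≈ᵥ ι (suc k) •ᵥ w (suc k)
    raised₀   : raise X Z (w 0) ≈ᵥ 0ᵥ
    raised    : ∀ k → raise X Z (w (suc k)) ≈ᵥ (ι m + - ι k) •ᵥ w k
    vanish    : w (suc m) ≈ᵥ 0ᵥ

1/suc : ℕ → ℂ
1/suc k = fromℚ (reciprocal (+ suc k))

1/suc-inverse : ∀ k → 1/suc k * ι (suc k) ≈ 1#
1/suc-inverse k = fromℤ-reciprocal (+ suc k) λ ()

module DividedPowers {D} {W : Pred (V D) 0ℓ} {X Y Z : Mat D} (M : CyclicModule W X Y Z)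
  (r : ℕ) {u : V D} (u∈W : u ∈ W) (Yu : Y ·ᵥ u ≈ᵥ ϑ D r •ᵥ u) (eu : raise X Z u ≈ᵥ 0ᵥ) where

  open CyclicModule M
  open IsSubspace subspace
  open Triple M

  w : ℕ → V D
  w zero    = u
  w (suc k) = 1/suc k •ᵥ f (w k)

  w∈W : ∀ k → w k ∈ W
  w∈W zero    = u∈W
  w∈W (suc k) = •-closed _ (f-stable (w∈W k))

  w-lowered : ∀ k → f (w k) ≈ᵥ ι (suc k) •ᵥ w (suc k)
  w-lowered k y = C.trans (C.sym (C.*-identityˡ _)) (C.trans (C.*-congʳ (C.sym (1/suc-inverse k)))
    (solve 3 (λ a b x → (a :* b) :* x := b :* (a :* x)) C.refl (1/suc k) (ι (suc k)) (f (w k) y)))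

  w-weight : ∀ k → Y ·ᵥ w k ≈ᵥ ϑ D (r N.+ k) •ᵥ w k
  w-weight zero    y = C.trans (Yu y) (C.*-congʳ (C.reflexive (≡.cong (ϑ D) (≡.sym (ℕₚ.+-identityʳ r)))))
  w-weight (suc k) y = begin
    (Y ·ᵥ w (suc k)) y                                   ≈⟨ ·ᵥ-linear Y .scale (1/suc k) (f (w k)) y ⟩
    1/suc k * (Y ·ᵥ f (w k)) y                           ≈⟨ C.*-congˡ (Yf (w k) y) ⟩
    1/suc k * (f (Y ·ᵥ w k) y + - (1# + 1#) * f (w k) y) ≈⟨ C.*-congˡ (C.+-congʳ
        (C.trans (f-linear .cong (w-weight k) y) (f-linear .scale _ (w k) y))) ⟩
    1/suc k * (ϑ D (r N.+ k) * f (w k) y + - (1# + 1#) * f (w k) y)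
      ≈⟨ solve 3 (λ c t x → c :* (t :* x :+ (:- (:1 :+ :1)) :* x) := (t :- (:1 :+ :1)) :* (c :* x)) C.refl (1/suc k) (ϑ D (r N.+ k)) (f (w k) y) ⟩
    (ϑ D (r N.+ k) + - (1# + 1#)) * w (suc k) y          ≈⟨ C.*-congʳ (C.sym (ϑ-suc D (r N.+ k))) ⟩
    ϑ D (suc (r N.+ k)) * w (suc k) y                    ≈⟨ C.*-congʳ (C.reflexive (≡.cong (ϑ D) (ℕₚ.+-suc r k))) ⟨
    ϑ D (r N.+ suc k) * w (suc k) y                      ∎

  mutual
    fe-w : ∀ k y → f (e (w k)) y ≈ (ι k * ((ϑ D r + - ι k) + 1#)) * w k y
    fe-w zero    y = C.trans (C.trans (f-linear .cong eu y) (0ᵥ-image f-linear y))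
      (C.sym (C.trans (C.*-congʳ (C.zeroˡ _)) (C.zeroˡ _)))
    fe-w (suc k) y = begin
      f (e (w (suc k))) y                            ≈⟨ f-linear .cong (w-raised k) y ⟩
      f ((ϑ D r + - ι k) •ᵥ w k) y                   ≈⟨ f-linear .scale _ (w k) y ⟩
      (ϑ D r + - ι k) * f (w k) y                    ≈⟨ C.*-congˡ (w-lowered k y) ⟩
      (ϑ D r + - ι k) * (ι (suc k) * w (suc k) y)    ≈⟨ solve 4 (λ t k s x → (t :- k) :* (s :* x) := (s :* ((t :- (:1 :+ k)) :+ :1)) :* x) C.refl
                                                          (ϑ D r) (ι k) (ι (suc k)) (w (suc k) y) ⟩
      (ι (suc k) * ((ϑ D r + - (1# + ι k)) + 1#)) * w (suc k) y ≈⟨ C.*-congʳ (C.*-congˡ (C.+-congʳ (C.+-congˡ (C.-‿cong (ι-suc k))))) ⟨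
      (ι (suc k) * ((ϑ D r + - ι (suc k)) + 1#)) * w (suc k) y  ∎

    -- Let λ = θᵣ. By ef = fe + Y, the vector e(f wₖ) is k(λ - k + 1) + (λ - 2k) times wₖ. This
    -- factors as (k + 1)(λ - k), and the divided power removes k + 1. Applying f to the result
    -- gives `fe-w` at the next index.
    w-raised : ∀ k → e (w (suc k)) ≈ᵥ (ϑ D r + - ι k) •ᵥ w k
    w-raised k y = begin
      e (w (suc k)) y                              ≈⟨ e-linear .scale (1/suc k) (f (w k)) y ⟩
      1/suc k * e (f (w k)) y                      ≈⟨ C.*-congˡ (ef (w k) y) ⟩
      1/suc k * (f (e (w k)) y + (Y ·ᵥ w k) y)     ≈⟨ C.*-congˡ (C.+-cong (fe-w k y) (C.trans (w-weight k y) (C.*-congʳ (ϑ-+ D r k)))) ⟩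
      1/suc k * ((ι k * ((ϑ D r + - ι k) + 1#)) * w k y + (ϑ D r + - (ι k + ι k)) * w k y)
        ≈⟨ solve 4 (λ c k t x → c :* ((k :* ((t :- k) :+ :1)) :* x :+ (t :- (k :+ k)) :* x) := (c :* (:1 :+ k)) :* ((t :- k) :* x)) C.refl
             (1/suc k) (ι k) (ϑ D r) (w k y) ⟩
      (1/suc k * (1# + ι k)) * ((ϑ D r + - ι k) * w k y)  ≈⟨ C.*-congʳ (C.trans (C.*-congˡ (C.sym (ι-suc k))) (1/suc-inverse k)) ⟩
      1# * ((ϑ D r + - ι k) * w k y)               ≈⟨ C.*-identityˡ _ ⟩
      (ϑ D r + - ι k) * w k y                      ∎

module Strings (lem : LEM) {D} {W : Pred (V D) 0ℓ} {X Y Z : Mat D} (M : CyclicModule W X Y Z) where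

  open RealDomain lem using (domain)
  open CyclicModule M
  open IsSubspace subspace
  open Triple M

  scalar-zero : ∀ {c} {v : V D} → v ≉ᵥ 0ᵥ → c •ᵥ v ≈ᵥ 0ᵥ → c ≈ 0#
  scalar-zero {c} {v} v≉0 cv≈0 with lem (c ≈ 0#)
  ... | yes c≈0 = c≈0
  ... | no  c≉0 = contradiction v≈0 v≉0
    where
    v≈0 : v ≈ᵥ 0ᵥ
    v≈0 y = Sum.fromInj₂ (λ c≈0 → contradiction c≈0 c≉0) (domain c (v y) (cv≈0 y))

  last-nonzero : ∀ (w : ℕ → V D) n → w 0 ≉ᵥ 0ᵥ → w n ≈ᵥ 0ᵥ → ∃ λ m → w m ≉ᵥ 0ᵥ × w (suc m) ≈ᵥ 0ᵥ
  last-nonzero w zero    w₀≉0 wₙ≈0 = contradiction wₙ≈0 w₀≉0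
  last-nonzero w (suc n) w₀≉0 wₙ≈0 with lem (w n ≈ᵥ 0ᵥ)
  ... | yes p = last-nonzero w n w₀≉0 p
  ... | no ¬p = n , ¬p , wₙ≈0

  -- Applying raise to w (suc m) = 0 shows that the highest weight equals m,
  -- when w m is the last nonzero vector of the string.
  highest⇒string : ∀ {π r u} → IsSpectral Y π → u ∈ W → u ≉ᵥ 0ᵥ → Y ·ᵥ u ≈ᵥ ϑ D r •ᵥ u → raise X Z u ≈ᵥ 0ᵥ →
                   ∃ λ m → ∃ λ w → IsString W X Y Z r m w
  highest⇒string {π} {r} {u} spectral u∈W u≉0 Yu eu = m , w , record
    { dimension = ϑ-top⁻¹ m r top
    ; member    = w∈W
    ; nonzero   = u≉0
    ; weight    = w-weight
    ; lowered   = w-lowered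
    ; raised₀   = eu
    ; raised    = λ k y → C.trans (w-raised k y) (C.*-congʳ (C.+-congʳ top))
    ; vanish    = proj₂ (proj₂ lastw)
    }
    where
    open DividedPowers M r u∈W Yu eu
    -- The index r + D + 1 exceeds D, so its weight is no eigenvalue of `Y` and the string has ended
    -- by then.
    lastw = last-nonzero w (suc D) u≉0 (IsSpectral.outside spectral
      (λ j j≤D e → ℕₚ.<-irrefl (≡.sym (ϑ-injective D {r N.+ suc D} {j} e)) (ℕₚ.≤-<-trans j≤D (ℕₚ.m≤n+m (suc D) r))) (w-weight (suc D)))
    m = proj₁ lastw
    top : ϑ D r ≈ ι m
    top = x-y≈0⇒x≈y (scalar-zero (proj₁ (proj₂ lastw)) λ y → C.trans (C.sym (w-raised m y))
      (C.trans (e-linear .cong (proj₂ (proj₂ lastw)) y) (0ᵥ-image e-linear y)))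

if-yes : ∀ {P : Set} {x y : ℂ} (d : Dec P) → P → (if does d then x else y) ≈ x
if-yes (yes _) p = C.refl
if-yes (no ¬p) p = contradiction p ¬p

if-no : ∀ {P : Set} {x y : ℂ} (d : Dec P) → ¬ P → (if does d then x else y) ≈ y
if-no (yes p) ¬p = contradiction p ¬p
if-no (no _)  ¬p = C.refl

-- The second alternative is for the index just past a string, where the coefficient may be nonzero
-- but the vector is 0.
combo-single : ∀ {D} n {c : ℕ → ℂ} {w : ℕ → V D} p → (∀ k → k ≢ p → c k ≈ 0#) → p N.< n ⊎ w p ≈ᵥ 0ᵥ →
               combo n c w ≈ᵥ c p •ᵥ w p
combo-single n {c} {w} p c≈0 (inj₁ p<n) y = C.trans
  (lincomb-single {n = n} {c = c ∘ toℕ} {v = w ∘ toℕ} i (λ j j≢i z → C.trans (C.*-congʳ (c≈0 (toℕ j) (j≢i ∘ λ e → Finₚ.toℕ-injective (≡.trans e (≡.sym i≡p))))) (C.zeroˡ _)) y)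
  (C.reflexive (≡.cong (λ k → c k * w k y) i≡p))
  where
  i = fromℕ< p<n
  i≡p : toℕ i ≡ p
  i≡p = Finₚ.toℕ-fromℕ< p<n
combo-single n {c} {w} p c≈0 (inj₂ wp≈0) y = C.trans
  (lincomb-zero {n = n} {c = c ∘ toℕ} {v = w ∘ toℕ} (term ∘ toℕ) y) (C.sym (C.trans (C.*-congˡ (wp≈0 y)) (C.zeroʳ _)))
  where
  term : ∀ k → c k •ᵥ w k ≈ᵥ 0ᵥ
  term k z with k ℕₚ.≟ p
  ... | yes ≡.refl = C.trans (C.*-congˡ (wp≈0 z)) (C.zeroʳ _)
  ... | no k≢p     = C.trans (C.*-congʳ (c≈0 k k≢p)) (C.zeroˡ _)

module StringTheory (lem : LEM) {D} {W : Pred (V D) 0ℓ} {X Y Z : Mat D} (M : CyclicModule W X Y Z)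
  {r m w} (s : IsString W X Y Z r m w) where

  open RealDomain lem using (domain)
  open CyclicModule M
  open IsSubspace subspace
  open Triple M
  open Strings lem M using (scalar-zero)
  open IsString s

  weight≤ : ∀ {k} → k N.≤ m → r N.+ k N.≤ D
  weight≤ {k} k≤m = ℕₚ.≤-trans (ℕₚ.+-monoʳ-≤ r k≤m) (ℕₚ.≤-trans (ℕₚ.≤-reflexive (ℕₚ.+-comm r m))
    (ℕₚ.≤-trans (ℕₚ.+-monoʳ-≤ m (ℕₚ.m≤m+n r r)) (ℕₚ.≤-reflexive (≡.sym dimension))))

  weightᶠ≤ : (i : Fin (suc m)) → r N.+ toℕ i N.≤ D
  weightᶠ≤ i = weight≤ (Finₚ.toℕ≤pred[n] i)

  -- If wₖ₊₁ vanished, raising it would give (m - k)wₖ = 0 with m - k nonzero.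
  string-nonzero : ∀ {k} → k N.≤ m → w k ≉ᵥ 0ᵥ
  string-nonzero {zero}  _   = nonzero
  string-nonzero {suc k} k<m wₖ≈0 = ℕₚ.<-irrefl (≡.sym (ι-injective {m} {k} (x-y≈0⇒x≈y
    (scalar-zero (string-nonzero (ℕₚ.<⇒≤ k<m)) λ y → C.trans (C.sym (raised k y))
      (C.trans (e-linear .cong wₖ≈0 y) (0ᵥ-image e-linear y)))))) k<m

  private
    Span-s = Span (suc m) w

    Span-s-subspace : IsSubspace Span-s
    Span-s-subspace = Span-subspace (suc m) w

    module S = IsSubspace Span-s-subspace

    stable : ∀ {F : Op D} → IsLinear F → (∀ (i : Fin (suc m)) → F (w (toℕ i)) ∈ Span-s) → ∀ {v} → v ∈ Span-s → F v ∈ Span-s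
    stable L p (c , v≈) = S.resp (λ y → C.sym (C.trans (L .cong v≈ y) (lincomb-image {n = suc m} L (c ∘ toℕ) (w ∘ toℕ) y)))
      (lincomb-∈ {n = suc m} Span-s-subspace (c ∘ toℕ) p)

    string∈ : ∀ (i : Fin (suc m)) → w (toℕ i) ∈ Span-s
    string∈ i = ∈-Span w (Finₚ.toℕ<n i)

    e∈ : ∀ {v} → v ∈ Span-s → e v ∈ Span-s
    e∈ = stable e-linear e-string
      where
      e-string : ∀ (i : Fin (suc m)) → e (w (toℕ i)) ∈ Span-s
      e-string zero    = S.resp (λ y → C.sym (raised₀ y)) S.0∈
      e-string (suc i) = S.resp (λ y → C.sym (raised (toℕ i) y))
        (S.•-closed _ (∈-Span w (ℕₚ.m≤n⇒m≤1+n (Finₚ.toℕ<n i))))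

    f∈ : ∀ {v} → v ∈ Span-s → f v ∈ Span-s
    f∈ = stable f-linear λ i → S.resp (λ y → C.sym (lowered (toℕ i) y)) (S.•-closed _ (next (toℕ i) (Finₚ.toℕ≤pred[n] i)))
      where
      next : ∀ k → k N.≤ m → w (suc k) ∈ Span-s
      next k k≤m with ℕₚ.m≤n⇒m<n∨m≡n k≤m
      ... | inj₁ k<m    = ∈-Span w (N.s≤s k<m)
      -- Lowering the last vector leaves the index range, but the result is 0.
      ... | inj₂ ≡.refl = S.resp (λ y → C.sym (vanish y)) S.0∈

  -- The span is stable under e, f and Y, hence under X = e + f and Z = 𝐢(e - f), and it contains
  -- w₀; irreducibility does the rest.
  spans : ∀ {v} → v ∈ W → v ∈ Span (suc m) w
  spans = irreducible Span-s Span-s-subspace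
    (λ (c , v≈) → resp (λ y → C.sym (v≈ y)) (lincomb-∈ {n = suc m} subspace (c ∘ toℕ) (member ∘ toℕ)))
    (λ {v} v∈ → S.resp (λ y → C.sym (X-decompose X Z v y)) (S.+-closed (e∈ v∈) (f∈ v∈)))
    (stable (·ᵥ-linear Y) λ i → S.resp (λ y → C.sym (weight (toℕ i) y)) (S.•-closed _ (string∈ i)))
    (λ {v} v∈ → S.resp (λ y → C.sym (Z-decompose X Z v y)) (S.•-closed 𝐢 (S.+-closed (e∈ v∈) (S.•-closed (- 1#) (f∈ v∈)))))
    (w 0 , ∈-Span {n = suc m} w (N.s≤s N.z≤n) , nonzero)

  raise-combo : ∀ a → e (combo (suc m) a w) ≈ᵥ combo (suc m) (λ k → a (suc k) * (ι m + - ι k)) w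
  raise-combo a y = begin
    e (combo (suc m) a w) y                          ≈⟨ lincomb-image {n = suc m} e-linear (a ∘ toℕ) (w ∘ toℕ) y ⟩
    a 0 * e (w 0) y + combo m (a ∘ suc) (e ∘ w ∘ suc) y ≈⟨ C.+-cong (C.trans (C.*-congˡ (raised₀ y)) (C.zeroʳ _))
        (C.trans (lincomb-congʳ {n = m} (a ∘ suc ∘ toℕ) (raised ∘ toℕ) y)
          (lincomb-scaled {n = m} (a ∘ suc ∘ toℕ) (λ i → ι m + - ι (toℕ i)) (w ∘ toℕ) y)) ⟩
    0# + combo m g w y                               ≈⟨ C.+-comm _ _ ⟩
    -- The added term for k = m involves `a (suc m)`, a coefficient beyond the string, but its
    -- factor m - m is 0. The result thus has the length of the original combination.
    combo m g w y + 0#                               ≈⟨ C.+-congˡ (C.trans (C.*-congʳ (C.trans (C.*-congˡ (C.-‿inverseʳ (ι m))) (C.zeroʳ _))) (C.zeroˡ _)) ⟨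
    combo m g w y + g m * w m y                      ≈⟨ combo-last m g w y ⟨
    combo (suc m) g w y                              ∎
    where
    g : ℕ → ℂ
    g k = a (suc k) * (ι m + - ι k)

  lower-sum : f (combo (suc m) (λ _ → 1#) w) ≈ᵥ combo (suc m) ι w
  lower-sum y = begin
    f (combo (suc m) (λ _ → 1#) w) y             ≈⟨ lincomb-image {n = suc m} f-linear (λ _ → 1#) (w ∘ toℕ) y ⟩
    combo (suc m) (λ _ → 1#) (f ∘ w) y           ≈⟨ lincomb-congʳ {n = suc m} (λ _ → 1#) (lowered ∘ toℕ) y ⟩
    combo (suc m) (λ _ → 1#) (λ k → ι (suc k) •ᵥ w (suc k)) y
      ≈⟨ lincomb-scaled {n = suc m} (λ _ → 1#) (ι ∘ suc ∘ toℕ) (w ∘ suc ∘ toℕ) y ⟩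
    combo (suc m) (λ k → 1# * ι (suc k)) (w ∘ suc) y ≈⟨ lincomb-congˡ {n = suc m} (w ∘ suc ∘ toℕ) (λ i → C.*-identityˡ (ι (suc (toℕ i)))) y ⟩
    -- The shift of indices costs nothing at either end: the new first term has coefficient 0, and
    -- the surplus last vector is `w (suc m)`, which is 0.
    combo (suc m) (ι ∘ suc) (w ∘ suc) y          ≈⟨ C.+-identityˡ _ ⟨
    0# + combo (suc m) (ι ∘ suc) (w ∘ suc) y     ≈⟨ C.+-congʳ (C.zeroˡ (w 0 y)) ⟨
    combo (suc (suc m)) ι w y                    ≈⟨ combo-last (suc m) ι w y ⟩
    combo (suc m) ι w y + ι (suc m) * w (suc m) y ≈⟨ C.+-congˡ (C.trans (C.*-congˡ (vanish y)) (C.zeroʳ _)) ⟩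
    combo (suc m) ι w y + 0#                     ≈⟨ C.+-identityʳ _ ⟩
    combo (suc m) ι w y                          ∎

  weight-combo : ∀ a → Y ·ᵥ combo (suc m) a w ≈ᵥ combo (suc m) (λ k → a k * ϑ D (r N.+ k)) w
  weight-combo a y = C.trans (lincomb-image {n = suc m} (·ᵥ-linear Y) (a ∘ toℕ) (w ∘ toℕ) y)
    (C.trans (lincomb-congʳ {n = suc m} (a ∘ toℕ) (weight ∘ toℕ) y)
      (lincomb-scaled {n = suc m} (a ∘ toℕ) (λ i → ϑ D (r N.+ toℕ i)) (w ∘ toℕ) y))

  weight-value : ∀ k → ϑ D (r N.+ k) ≈ ι m + - (ι k + ι k)
  weight-value k = C.trans (ϑ-+ D r k) (C.+-congʳ (ϑ-top m r dimension))

  combo-member : ∀ a → combo (suc m) a w ∈ W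
  combo-member a = lincomb-∈ {n = suc m} subspace (a ∘ toℕ) (member ∘ toℕ)

  module Projections {π} (spectral : IsSpectral Y π) where

    open IsSpectral spectral

    -- The string vectors have pairwise different weights, so the projection keeps exactly one term.
    projection : ∀ (c : Fin (suc m) → ℂ) i → π (r N.+ toℕ i) ·ᵥ lincomb c (w ∘ toℕ) ≈ᵥ c i •ᵥ w (toℕ i)
    projection c i y = C.trans (lincomb-image (·ᵥ-linear πᵢ) c (w ∘ toℕ) y)
      (C.trans (lincomb-single {c = c} {v = λ j → πᵢ ·ᵥ w (toℕ j)} i (λ j j≢i z → C.trans (C.*-congˡ (other (weightᶠ≤ i) (weightᶠ≤ j)
          (λ eq → j≢i (≡.sym (Finₚ.toℕ-injective (ℕₚ.+-cancelˡ-≡ r _ _ eq)))) (weight (toℕ j)) z)) (C.zeroʳ _)) y)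
        (C.*-congˡ (same (weightᶠ≤ i) (weight (toℕ i)) y)))
      where πᵢ = π (r N.+ toℕ i)

    independent : ∀ (c : Fin (suc m) → ℂ) → lincomb c (w ∘ toℕ) ≈ᵥ 0ᵥ → ∀ i → c i ≈ 0#
    independent c p i = scalar-zero (string-nonzero (Finₚ.toℕ≤pred[n] i)) λ y → C.trans (C.sym (projection c i y))
      (C.trans (·ᵥ-linear (π (r N.+ toℕ i)) .cong p y) (0ᵥ-image (·ᵥ-linear (π (r N.+ toℕ i))) y))

    coefficients : ∀ (c c′ : Fin (suc m) → ℂ) → lincomb c (w ∘ toℕ) ≈ᵥ lincomb c′ (w ∘ toℕ) → ∀ i → c i ≈ c′ i
    coefficients c c′ p i = x-y≈0⇒x≈y (scalar-zero (string-nonzero (Finₚ.toℕ≤pred[n] i)) λ y → begin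
      (c i + - c′ i) * w (toℕ i) y                       ≈⟨ solve 3 (λ a b x → (a :- b) :* x := a :* x :- b :* x) C.refl (c i) (c′ i) (w (toℕ i) y) ⟩
      c i * w (toℕ i) y + - (c′ i * w (toℕ i) y)         ≈⟨ x≈y⇒x-y≈0 (C.trans (C.sym (projection c i y))
          (C.trans (·ᵥ-linear (π (r N.+ toℕ i)) .cong p y) (projection c′ i y))) ⟩
      0#                                                 ∎)

    -- In divided powers, the exponential of lower applied to w₀ is the sum of the
    -- string, and it turns the highest weight vector for Y into one for X.
    rotated-highest : ∃ λ u → u ∈ W × u ≉ᵥ 0ᵥ × X ·ᵥ u ≈ᵥ ϑ D r •ᵥ u × raise Z Y u ≈ᵥ 0ᵥ
    rotated-highest = u , combo-member (λ _ → 1#) , u≉0 , Xu , raise-u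
      where
      u = combo (suc m) (λ _ → 1#) w
      up : ℕ → ℂ
      up k = 1# * (ι m + - ι k)
      u≉0 : u ≉ᵥ 0ᵥ
      u≉0 p = string-nonzero N.z≤n λ y → C.trans (C.sym (C.*-identityˡ _)) (C.trans (C.*-congʳ (independent (λ _ → 1#) p zero)) (C.zeroˡ _))
      Xu : X ·ᵥ u ≈ᵥ ϑ D r •ᵥ u
      Xu y = begin
        (X ·ᵥ u) y                              ≈⟨ X-decompose X Z u y ⟩
        e u y + f u y                           ≈⟨ C.+-cong (raise-combo (λ _ → 1#) y) (lower-sum y) ⟩
        combo (suc m) up w y + combo (suc m) ι w y ≈⟨ lincomb-+ {n = suc m} (up ∘ toℕ) (ι ∘ toℕ) (w ∘ toℕ) y ⟩
        -- Every coefficient is (m - k) + k = m, the highest weight.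
        combo (suc m) (λ k → up k + ι k) w y    ≈⟨ lincomb-congˡ {n = suc m} (w ∘ toℕ) (λ i → C.trans
            (solve 2 (λ m k → :1 :* (m :- k) :+ k := m :* :1) C.refl (ι m) (ι (toℕ i))) (C.*-congʳ (C.sym (ϑ-top m r dimension)))) y ⟩
        combo (suc m) (λ k → ϑ D r * 1#) w y    ≈⟨ lincomb-• {n = suc m} (ϑ D r) (λ _ → 1#) (w ∘ toℕ) y ⟨
        ϑ D r * u y                             ∎
      -- On coefficients this is m - k = (m - 2k) + k. As Z = 𝐢(e - f), it amounts to Zu = 𝐢Yu,
      -- which is the vanishing of `raise Z Y u`.
      e≈Y+f : ∀ y → e u y ≈ (Y ·ᵥ u) y + f u y
      e≈Y+f y = begin
        e u y                        ≈⟨ raise-combo (λ _ → 1#) y ⟩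
        combo (suc m) up w y         ≈⟨ lincomb-congˡ {n = suc m} (w ∘ toℕ) (λ i → C.trans
            (solve 2 (λ m k → :1 :* (m :- k) := :1 :* (m :- (k :+ k)) :+ k) C.refl (ι m) (ι (toℕ i)))
            (C.+-congʳ (C.*-congˡ (C.sym (weight-value (toℕ i)))))) y ⟩
        combo (suc m) (λ k → 1# * ϑ D (r N.+ k) + ι k) w y ≈⟨ lincomb-+ {n = suc m} (λ i → 1# * ϑ D (r N.+ toℕ i)) (ι ∘ toℕ) (w ∘ toℕ) y ⟨
        combo (suc m) (λ k → 1# * ϑ D (r N.+ k)) w y + combo (suc m) ι w y ≈⟨ C.+-cong (weight-combo (λ _ → 1#) y) (lower-sum y) ⟨
        (Y ·ᵥ u) y + f u y           ∎
      raise-u : raise Z Y u ≈ᵥ 0ᵥ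
      raise-u y = begin
        fromℚ ½ * ((Z ·ᵥ u) y + (- 𝐢) * (Y ·ᵥ u) y)    ≈⟨ C.*-congˡ (C.+-congʳ (Z-decompose X Z u y)) ⟩
        fromℚ ½ * (𝐢 * (e u y + (- 1#) * f u y) + (- 𝐢) * (Y ·ᵥ u) y) ≈⟨ C.*-congˡ (C.+-congʳ (C.*-congˡ (C.+-congʳ (e≈Y+f y)))) ⟩
        fromℚ ½ * (𝐢 * (((Y ·ᵥ u) y + f u y) + (- 1#) * f u y) + (- 𝐢) * (Y ·ᵥ u) y)
          ≈⟨ solve 2 (λ h f → :½ :* (:𝐢 :* ((h :+ f) :+ (:- :1) :* f) :+ (:- :𝐢) :* h) := :0) C.refl ((Y ·ᵥ u) y) (f u y) ⟩
        0# ∎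

    -- Within W only multiples of w₀ have weight θᵣ, so u is one of them and inherits its highest
    -- weight conditions.
    highest-image : ∀ {u} → u ∈ image (π r) W → u ∈ W × Y ·ᵥ u ≈ᵥ ϑ D r •ᵥ u × raise X Z u ≈ᵥ 0ᵥ
    highest-image {u} (v , v∈W , u≈) = resp (λ y → C.sym (u≈c•w₀ y)) (•-closed c (member 0))
      , (λ y → begin
          (Y ·ᵥ u) y              ≈⟨ C.trans (·ᵥ-linear Y .cong u≈c•w₀ y) (·ᵥ-linear Y .scale c (w 0) y) ⟩
          c * (Y ·ᵥ w 0) y        ≈⟨ C.*-congˡ (C.trans (weight 0 y) (C.*-congʳ (C.reflexive (≡.cong (ϑ D) (ℕₚ.+-identityʳ r))))) ⟩
          c * (ϑ D r * w 0 y)     ≈⟨ solve 3 (λ c t x → c :* (t :* x) := t :* (c :* x)) C.refl c (ϑ D r) (w 0 y) ⟩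
          ϑ D r * (c * w 0 y)     ≈⟨ C.*-congˡ (u≈c•w₀ y) ⟨
          ϑ D r * u y             ∎)
      , λ y → C.trans (e-linear .cong u≈c•w₀ y) (C.trans (e-linear .scale c (w 0) y) (C.trans (C.*-congˡ (raised₀ y)) (C.zeroʳ c)))
      where
      a = proj₁ (spans v∈W)
      c = a 0
      u≈c•w₀ : u ≈ᵥ c •ᵥ w 0
      u≈c•w₀ y = C.trans (u≈ y) (C.trans (·ᵥ-linear (π r) .cong (proj₂ (spans v∈W)) y)
        (≡.subst (λ k → (π k ·ᵥ combo (suc m) a w) y ≈ c * w 0 y) (ℕₚ.+-identityʳ r) (projection (a ∘ toℕ) zero y)))

    image-string : ∀ {k} → k N.≤ m → IsNonzero (image (π (r N.+ k)) W)
    image-string {k} k≤m = w k , (w k , member k , λ y → C.sym (same (weight≤ k≤m) (weight k) y)) , string-nonzero k≤m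

    -- A projection whose index lies outside r, ..., r + m kills every vector of the spanning
    -- string.
    image-index : ∀ {i} → i N.≤ D → IsNonzero (image (π i) W) → r N.≤ i × i N.≤ r N.+ m
    image-index {i} i≤D (v , (v′ , v′∈W , v≈) , v≉0) = bounds (r ℕₚ.≤? i) (i ℕₚ.≤? r N.+ m)
      where
      a = proj₁ (spans v′∈W)
      absent : ¬ (r N.≤ i × i N.≤ r N.+ m) → v ≈ᵥ 0ᵥ
      absent out y = C.trans (v≈ y) (C.trans (·ᵥ-linear (π i) .cong (proj₂ (spans v′∈W)) y)
        (C.trans (lincomb-image {n = suc m} (·ᵥ-linear (π i)) (a ∘ toℕ) (w ∘ toℕ) y)
          (lincomb-zero {n = suc m} {c = a ∘ toℕ} {v = λ j → π i ·ᵥ w (toℕ j)} (λ j z → C.trans (C.*-congˡ (other i≤D (weightᶠ≤ j)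
            (λ { ≡.refl → out (ℕₚ.m≤m+n r (toℕ j) , ℕₚ.+-monoʳ-≤ r (Finₚ.toℕ≤pred[n] j)) }) (weight (toℕ j)) z)) (C.zeroʳ _)) y)))
      bounds : Dec (r N.≤ i) → Dec (i N.≤ r N.+ m) → r N.≤ i × i N.≤ r N.+ m
      bounds (yes p) (yes q) = p , q
      bounds (no ¬p) _       = contradiction (absent (¬p ∘ proj₁)) v≉0
      bounds _       (no ¬q) = contradiction (absent (¬q ∘ proj₂)) v≉0

-- The tridiagonal representation

[-𝐢]^ 𝐢^ : ℕ → ℂ
[-𝐢]^ zero    = 1#
[-𝐢]^ (suc k) = - 𝐢 * [-𝐢]^ k
𝐢^ zero    = 1#
𝐢^ (suc k) = 𝐢 * 𝐢^ k

𝐢^-inverse : ∀ k → 𝐢^ k * [-𝐢]^ k ≈ 1#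
𝐢^-inverse zero    = C.*-identityˡ 1#
𝐢^-inverse (suc k) = C.trans (solve 2 (λ a b → (:𝐢 :* a) :* ((:- :𝐢) :* b) := a :* b) C.refl (𝐢^ k) ([-𝐢]^ k)) (𝐢^-inverse k)

Represents-cong : ∀ {D n} {W : Pred (V D) 0ℓ} {b : Fin n → Fin n → ℂ} {Y : Mat D} {v v′ : Fin n → V D} →
                  IsSubspace W → (∀ i → v i ≈ᵥ v′ i) → Represents W b Y v → Represents W b Y v′
Represents-cong {b = b} {Y} {v} {v′} S v≈v′ (basis , rep) = record
  { members     = λ i → IsSubspace.resp S (v≈v′ i) (members i)
  ; independent = λ c p → independent c λ y → C.trans (lincomb-congʳ c v≈v′ y) (p y)
  ; spanning    = λ w∈W → let c , p = spanning w∈W in c , λ y → C.trans (p y) (lincomb-congʳ c v≈v′ y)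
  } , λ j y → C.trans (·ᵥ-linear Y .cong (λ z → C.sym (v≈v′ j z)) y) (C.trans (rep j y) (lincomb-congʳ (λ i → b i j) v≈v′ y))
  where open IsBasis basis

module Representation (lem : LEM) {D} {W : Pred (V D) 0ℓ} {X Y Z : Mat D} (M : CyclicModule W X Y Z)
  {π} (spectral : IsSpectral Y π) where

  open RealDomain lem using (domain)
  open CyclicModule M
  open IsSubspace subspace
  open Triple M
  open Strings lem M using (scalar-zero)

  -- Absorbs the free constant a₀ of an arbitrary highest weight vector into the string.
  string-scale : ∀ {r m w c} → IsString W X Y Z r m w → ¬ c ≈ 0# → IsString W X Y Z r m (λ k → c •ᵥ w k)
  string-scale {r} {m} {w} {c} s c≉0 = record
    { dimension = dimension
    ; member    = λ k → •-closed c (member k)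
    ; nonzero   = λ p → c≉0 (scalar-zero nonzero p)
    ; weight    = λ k y → C.trans (·ᵥ-linear Y .scale c (w k) y) (commute (weight k y))
    ; lowered   = λ k y → C.trans (f-linear .scale c (w k) y) (commute (lowered k y))
    ; raised₀   = λ y → C.trans (e-linear .scale c (w 0) y) (C.trans (C.*-congˡ (raised₀ y)) (C.zeroʳ c))
    ; raised    = λ k y → C.trans (e-linear .scale c (w (suc k)) y) (commute (raised k y))
    ; vanish    = λ y → C.trans (C.*-congˡ (vanish y)) (C.zeroʳ c)
    }
    where
    open IsString s
    commute : ∀ {x a z} → x ≈ a * z → c * x ≈ a * (c * z)
    commute {x} {a} {z} p = C.trans (C.*-congˡ p) (solve 3 (λ c a z → c :* (a :* z) := a :* (c :* z)) C.refl c a z)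

  module Twist {r m w} (s : IsString W X Y Z r m w) where

    open IsString s
    open StringTheory lem M s
    open Projections spectral

    -- These powers of -𝐢 give f the coefficients 𝐢(k + 1), because 𝐢(-𝐢) = 1, and e the
    -- coefficients -𝐢(m - k) = 𝐢(k - m): the two nonzero diagonals of `B`.
    twisted : ℕ → V D
    twisted k = [-𝐢]^ k •ᵥ w k

    twisted-basis : IsBasis {n = suc m} W (twisted ∘ toℕ)
    twisted-basis = record
      { members     = λ i → •-closed _ (member (toℕ i))
      ; independent = λ c p i → cancel (toℕ i) (independent (λ j → c j * [-𝐢]^ (toℕ j))
          (λ y → C.trans (C.sym (lincomb-scaled c ([-𝐢]^ ∘ toℕ) (w ∘ toℕ) y)) (p y)) i)
      ; spanning    = λ v∈W → let c , p = spans v∈W in (λ i → c (toℕ i) * 𝐢^ (toℕ i)) , λ y → C.trans (p y)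
          (C.sym (C.trans (lincomb-scaled {n = suc m} (λ i → c (toℕ i) * 𝐢^ (toℕ i)) ([-𝐢]^ ∘ toℕ) (w ∘ toℕ) y)
            (lincomb-congˡ {n = suc m} (w ∘ toℕ) (λ i → C.trans (C.*-assoc (c (toℕ i)) (𝐢^ (toℕ i)) ([-𝐢]^ (toℕ i)))
              (C.trans (C.*-congˡ (𝐢^-inverse (toℕ i))) (C.*-identityʳ _))) y)))
      }
      where
      cancel : ∀ k {c} → c * [-𝐢]^ k ≈ 0# → c ≈ 0#
      cancel k {c} p = begin
        c                          ≈⟨ C.*-identityʳ c ⟨
        c * 1#                     ≈⟨ C.*-congˡ (𝐢^-inverse k) ⟨
        c * (𝐢^ k * [-𝐢]^ k)       ≈⟨ solve 3 (λ a b c → a :* (b :* c) := b :* (a :* c)) C.refl c (𝐢^ k) ([-𝐢]^ k) ⟩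
        𝐢^ k * (c * [-𝐢]^ k)       ≈⟨ C.*-congˡ p ⟩
        𝐢^ k * 0#                  ≈⟨ C.zeroʳ _ ⟩
        0#                         ∎

    -- Column j of `B m`, cut into the part below the diagonal, which comes from f, and the part
    -- above it, which comes from e.
    below above : ℕ → ℕ → ℂ
    below j k = if does (k ℕₚ.≟ suc j) then 𝐢 * fromℤ (+ k) else 0#
    above j k = if does (j ℕₚ.≟ suc k) then 𝐢 * fromℤ (+ k Z.- + m) else 0#

    column-split : ∀ j k → (if does (k ℕₚ.≟ suc j) then 𝐢 * fromℤ (+ k) else
      if does (j ℕₚ.≟ suc k) then 𝐢 * fromℤ (+ k Z.- + m) else 0#) ≈ below j k + above j k
    column-split j k = split (k ℕₚ.≟ suc j) (j ℕₚ.≟ suc k)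
      where
      split : ∀ {x y} (p : Dec (k ≡ suc j)) (q : Dec (j ≡ suc k)) →
              (if does p then x else if does q then y else 0#) ≈ (if does p then x else 0#) + (if does q then y else 0#)
      split (yes k≡) (yes j≡) = contradiction (≡.trans k≡ (≡.cong suc j≡)) (ℕₚ.m≢1+n+m k {1})
      split (yes _)  (no _)   = C.sym (C.+-identityʳ _)
      split (no _)   (yes _)  = C.sym (C.+-identityˡ _)
      split (no _)   (no _)   = C.sym (C.+-identityˡ _)

    below-combo : ∀ {j} → j N.≤ m → f (twisted j) ≈ᵥ combo (suc m) (below j) twisted
    below-combo {j} j≤m y = begin
      f (twisted j) y                                        ≈⟨ f-linear .scale ([-𝐢]^ j) (w j) y ⟩
      [-𝐢]^ j * f (w j) y                                    ≈⟨ C.*-congˡ (lowered j y) ⟩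
      [-𝐢]^ j * (ι (suc j) * w (suc j) y)                    ≈⟨ solve 3 (λ p n x → p :* (n :* x) := (:𝐢 :* n) :* (((:- :𝐢) :* p) :* x)) C.refl
                                                                  ([-𝐢]^ j) (ι (suc j)) (w (suc j) y) ⟩
      (𝐢 * ι (suc j)) * twisted (suc j) y                    ≈⟨ C.*-congʳ (if-yes (suc j ℕₚ.≟ suc j) ≡.refl) ⟨
      below j (suc j) * twisted (suc j) y                    ≈⟨ combo-single (suc m) {below j} {twisted} (suc j)
          (λ k k≢ → if-no (k ℕₚ.≟ suc j) k≢) (next (ℕₚ.m≤n⇒m<n∨m≡n j≤m)) y ⟨
      combo (suc m) (below j) twisted y                      ∎
      where
      next : j N.< m ⊎ j ≡ m → suc j N.< suc m ⊎ twisted (suc j) ≈ᵥ 0ᵥ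
      next (inj₁ j<m)    = inj₁ (N.s≤s j<m)
      -- In the last column the entry below the diagonal falls outside the matrix; the vector it
      -- would multiply is 0.
      next (inj₂ ≡.refl) = inj₂ λ z → C.trans (C.*-congˡ (vanish z)) (C.zeroʳ _)

    above-combo : ∀ {j} → j N.≤ m → e (twisted j) ≈ᵥ combo (suc m) (above j) twisted
    above-combo {zero} _ y = C.trans (e-linear .scale 1# (w 0) y) (C.trans (C.*-congˡ (raised₀ y)) (C.trans (C.zeroʳ 1#)
      (C.sym (lincomb-zero {n = suc m} {c = above 0 ∘ toℕ} {v = twisted ∘ toℕ}
        (λ i z → C.zeroˡ _) y))))
    above-combo {suc j} j<m y = begin
      e (twisted (suc j)) y                                  ≈⟨ e-linear .scale ([-𝐢]^ (suc j)) (w (suc j)) y ⟩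
      [-𝐢]^ (suc j) * e (w (suc j)) y                        ≈⟨ C.*-congˡ (raised j y) ⟩
      [-𝐢]^ (suc j) * ((ι m + - ι j) * w j y)                ≈⟨ solve 4 (λ p m j x → ((:- :𝐢) :* p) :* ((m :- j) :* x) := (:𝐢 :* (j :- m)) :* (p :* x)) C.refl
                                                                  ([-𝐢]^ j) (ι m) (ι j) (w j y) ⟩
      (𝐢 * (ι j + - ι m)) * twisted j y                      ≈⟨ C.*-congʳ (C.*-congˡ (C.trans (fromℤ-+ (+ j) (Z.- + m)) (C.+-congˡ (fromℤ-neg (+ m))))) ⟨
      (𝐢 * fromℤ (+ j Z.- + m)) * twisted j y                ≈⟨ C.*-congʳ (if-yes (suc j ℕₚ.≟ suc j) ≡.refl) ⟨
      above (suc j) j * twisted j y                          ≈⟨ combo-single (suc m) {above (suc j)} {twisted} j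
          (λ k k≢ → if-no (suc j ℕₚ.≟ suc k) λ e → k≢ (≡.sym (ℕₚ.suc-injective e))) (inj₁ (ℕₚ.m≤n⇒m≤1+n j<m)) y ⟨
      combo (suc m) (above (suc j)) twisted y                ∎

    twisted-represents : Represents W (B m) X (twisted ∘ toℕ)
    twisted-represents = twisted-basis , λ j y → begin
      (X ·ᵥ twisted (toℕ j)) y                            ≈⟨ X-decompose X Z (twisted (toℕ j)) y ⟩
      e (twisted (toℕ j)) y + f (twisted (toℕ j)) y       ≈⟨ C.+-cong (above-combo (Finₚ.toℕ≤pred[n] j) y) (below-combo (Finₚ.toℕ≤pred[n] j) y) ⟩
      combo (suc m) (above (toℕ j)) twisted y + combo (suc m) (below (toℕ j)) twisted y ≈⟨ C.+-comm (combo (suc m) (above (toℕ j)) twisted y) _ ⟩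
      combo (suc m) (below (toℕ j)) twisted y + combo (suc m) (above (toℕ j)) twisted y
        ≈⟨ lincomb-+ {n = suc m} (below (toℕ j) ∘ toℕ) (above (toℕ j) ∘ toℕ) (twisted ∘ toℕ) y ⟩
      combo (suc m) (λ k → below (toℕ j) k + above (toℕ j) k) twisted y
        ≈⟨ lincomb-congˡ {n = suc m} {c = λ i → B m i j} (twisted ∘ toℕ) (λ i → column-split (toℕ j) (toℕ i)) y ⟨
      lincomb {n = suc m} (λ i → B m i j) (twisted ∘ toℕ) y           ∎

  -- The projections of u onto the weight spaces of `Y` turn out to be the twisted string, scaled by
  -- the first coefficient of u.
  represents : ∀ {r m w u} → IsString W X Y Z r m w → u ∈ W → u ≉ᵥ 0ᵥ → Z ·ᵥ u ≈ᵥ ϑ D r •ᵥ u → raise Y X u ≈ᵥ 0ᵥ →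
               Represents W (B m) X (λ i → π (r N.+ toℕ i) ·ᵥ u)
  represents {r} {m} {w} {u} s u∈W u≉0 Zu raise-u = Represents-cong {b = B m} subspace
    (λ i y → C.trans (C.trans (solve 3 (λ p a x → p :* (a :* x) := (p :* a) :* x) C.refl ([-𝐢]^ (toℕ i)) (a 0) (w (toℕ i) y))
      (C.*-congʳ (C.sym (a-power (Finₚ.toℕ≤pred[n] i))))) (C.sym (projected i y)))
    (Twist.twisted-represents (string-scale s a₀≉0))
    where
    open IsString s
    open StringTheory lem M s
    open Projections spectral
    a = proj₁ (spans u∈W)
    u≈ : u ≈ᵥ combo (suc m) a w
    u≈ = proj₂ (spans u∈W)
    projected : ∀ i → π (r N.+ toℕ i) ·ᵥ u ≈ᵥ a (toℕ i) •ᵥ w (toℕ i)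
    projected i y = C.trans (·ᵥ-linear (π (r N.+ toℕ i)) .cong u≈ y) (projection (a ∘ toℕ) i y)
    -- The constant of the identity (X - 𝐢Z)/2 = c(Y + Z) + 𝐢(Y - 𝐢X)/2, whose last summand kills u.
    c : ℂ
    c = fromℚ ½ * - 𝐢
    right : ℕ → ℂ
    right k = c * (a k * ϑ D (r N.+ k) + ϑ D r * a k)
    e-u : ∀ y → e u y ≈ c * ((Y ·ᵥ u) y + ϑ D r * u y)
    e-u y = begin
      fromℚ ½ * ((X ·ᵥ u) y + (- 𝐢) * (Z ·ᵥ u) y)
        ≈⟨ solve 3 (λ x h z → :½ :* (x :+ (:- :𝐢) :* z) := (:½ :* (:- :𝐢)) :* (h :+ z) :+ :𝐢 :* (:½ :* (h :+ (:- :𝐢) :* x))) C.refl _ ((Y ·ᵥ u) y) _ ⟩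
      c * ((Y ·ᵥ u) y + (Z ·ᵥ u) y) + 𝐢 * raise Y X u y ≈⟨ C.+-cong (C.*-congˡ (C.+-congˡ (Zu y))) (C.trans (C.*-congˡ (raise-u y)) (C.zeroʳ 𝐢)) ⟩
      c * ((Y ·ᵥ u) y + ϑ D r * u y) + 0#               ≈⟨ C.+-identityʳ _ ⟩
      c * ((Y ·ᵥ u) y + ϑ D r * u y)                    ∎
    recurrence : ∀ (i : Fin (suc m)) → a (suc (toℕ i)) * (ι m + - ι (toℕ i)) ≈ right (toℕ i)
    recurrence = coefficients (λ i → a (suc (toℕ i)) * (ι m + - ι (toℕ i))) (right ∘ toℕ) λ y → begin
      combo (suc m) (λ k → a (suc k) * (ι m + - ι k)) w y   ≈⟨ raise-combo a y ⟨
      e (combo (suc m) a w) y                               ≈⟨ e-linear .cong u≈ y ⟨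
      e u y                                                 ≈⟨ e-u y ⟩
      c * ((Y ·ᵥ u) y + ϑ D r * u y)                        ≈⟨ C.*-congˡ (C.+-cong
          (C.trans (·ᵥ-linear Y .cong u≈ y) (weight-combo a y))
          (C.trans (C.*-congˡ (u≈ y)) (lincomb-• {n = suc m} (ϑ D r) (a ∘ toℕ) (w ∘ toℕ) y))) ⟩
      c * (combo (suc m) (λ k → a k * ϑ D (r N.+ k)) w y + combo (suc m) (λ k → ϑ D r * a k) w y)
        ≈⟨ C.*-congˡ (lincomb-+ {n = suc m} (λ i → a (toℕ i) * ϑ D (r N.+ toℕ i)) (λ i → ϑ D r * a (toℕ i)) (w ∘ toℕ) y) ⟩
      c * combo (suc m) (λ k → a k * ϑ D (r N.+ k) + ϑ D r * a k) w y
        ≈⟨ lincomb-• {n = suc m} c (λ i → a (toℕ i) * ϑ D (r N.+ toℕ i) + ϑ D r * a (toℕ i)) (w ∘ toℕ) y ⟩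
      combo (suc m) right w y                               ∎
    a-step : ∀ {k} → k N.< m → a (suc k) ≈ - 𝐢 * a k
    -- The recurrence is the desired relation multiplied by m - k; cancelling this factor uses k <
    -- m.
    a-step {k} k<m = x-y≈0⇒x≈y (Sum.fromInj₂
      (λ p → contradiction (ι-injective {m} {k} (x-y≈0⇒x≈y p)) λ m≡k → ℕₚ.<-irrefl (≡.sym m≡k) k<m)
      (domain (ι m + - ι k) (a (suc k) + - (- 𝐢 * a k)) (begin
        (ι m + - ι k) * (a (suc k) + - (- 𝐢 * a k))
          ≈⟨ solve 4 (λ m k a b → (m :- k) :* (b :- (:- :𝐢) :* a) := b :* (m :- k) :- (:½ :* (:- :𝐢)) :* (a :* (m :- (k :+ k)) :+ m :* a)) C.refl
               (ι m) (ι k) (a k) (a (suc k)) ⟩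
        a (suc k) * (ι m + - ι k) + - (c * (a k * (ι m + - (ι k + ι k)) + ι m * a k))
          ≈⟨ C.+-congˡ (C.-‿cong (C.*-congˡ (C.+-cong (C.*-congˡ (weight-value k)) (C.*-congʳ (ϑ-top m r dimension))))) ⟨
        a (suc k) * (ι m + - ι k) + - right k
          ≈⟨ x≈y⇒x-y≈0 (≡.subst (λ n → a (suc n) * (ι m + - ι n) ≈ right n) (Finₚ.toℕ-fromℕ< (ℕₚ.m≤n⇒m≤1+n k<m)) (recurrence (fromℕ< (ℕₚ.m≤n⇒m≤1+n k<m)))) ⟩
        0# ∎)))
    a-power : ∀ {k} → k N.≤ m → a k ≈ [-𝐢]^ k * a 0
    a-power {zero}  _   = C.sym (C.*-identityˡ _)
    a-power {suc k} k<m = C.trans (a-step k<m) (C.trans (C.*-congˡ (a-power (ℕₚ.<⇒≤ k<m))) (C.sym (C.*-assoc _ _ _)))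
    a₀≉0 : ¬ a 0 ≈ 0#
    -- All coefficients are multiples of a₀, so a₀ = 0 would make u vanish.
    a₀≉0 a₀≈0 = u≉0 λ y → C.trans (u≈ y) (lincomb-zero {n = suc m} {c = a ∘ toℕ} {v = w ∘ toℕ} (λ i z →
      C.trans (C.*-congʳ (C.trans (a-power (Finₚ.toℕ≤pred[n] i)) (C.trans (C.*-congˡ a₀≈0) (C.zeroʳ _)))) (C.zeroˡ _)) y)

-- Irreducible T-modules

module _ {D} {W : Pred (V D) 0ℓ} (tmod : IsTModule W) where

  private
    S = proj₁ tmod
    open IsSubspace S

  -- The nonzero vector w is the test: it lies in `U` exactly when Q holds, so collapse of `U`
  -- refutes Q and exhaustion of W proves it.
  irreducible⇒LEM : IsNonzero W → (∀ U → IsTModule U → U ⊆ W → (U ⊆ zeroSubspace) ⊎ (W ⊆ U)) → LEM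
  irreducible⇒LEM (w , w∈W , w≉0) simple Q with simple U (U-subspace , U-stable) proj₁
    where
    U : Pred (V D) 0ℓ
    U v = v ∈ W × (v ≈ᵥ 0ᵥ ⊎ Q)
    U-subspace : IsSubspace U
    U-subspace = record
      { resp     = λ u≈v (u∈W , p) → resp u≈v u∈W , Sum.map₁ (λ u≈0 y → C.trans (C.sym (u≈v y)) (u≈0 y)) p
      ; 0∈       = 0∈ , inj₁ λ _ → C.refl
      ; +-closed = λ { (u∈W , inj₁ p) (v∈W , inj₁ q) → +-closed u∈W v∈W , inj₁ λ y → C.trans (C.+-cong (p y) (q y)) (C.+-identityˡ 0#)
                     ; (u∈W , inj₂ q) (v∈W , _)      → +-closed u∈W v∈W , inj₂ q
                     ; (u∈W , _)      (v∈W , inj₂ q) → +-closed u∈W v∈W , inj₂ q }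
      ; •-closed = λ c (v∈W , p) → •-closed c v∈W , Sum.map₁ (λ v≈0 y → C.trans (C.*-congˡ (v≈0 y)) (C.zeroʳ c)) p
      }
    U-stable : ∀ {M v} → M ∈ T → v ∈ U → M ·ᵥ v ∈ U
    U-stable {M} M∈T (v∈W , p) = proj₂ tmod M∈T v∈W
      , Sum.map₁ (λ v≈0 y → C.trans (·ᵥ-linear M .cong v≈0 y) (0ᵥ-image (·ᵥ-linear M) y)) p
  ... | inj₁ U⊆0 = no λ q → w≉0 (U⊆0 (w∈W , inj₂ q))
  ... | inj₂ W⊆U = [ (λ w≈0 → contradiction w≈0 w≉0) , yes ] (proj₂ (W⊆U w∈W))

stable⇒TModule : ∀ {D} {U : Pred (V D) 0ℓ} → IsSubspace U → Stable A U → Stable A* U → IsTModule U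
stable⇒TModule {D} {U} S A-stable A*-stable = S , stable
  where
  open IsSubspace S
  stable : ∀ {M v} → M ∈ T → v ∈ U → M ·ᵥ v ∈ U
  stable {v = v} (equal M≈N M∈T)    v∈U = resp (≈ₘ⇒≈ᵥ M≈N v) (stable M∈T v∈U)
  stable {v = v} unit               v∈U = resp (λ y → C.sym (I-·ᵥ v y)) v∈U
  stable         gen-A              v∈U = A-stable v∈U
  stable         gen-A*             v∈U = A*-stable v∈U
  stable {v = v} (sums {M} {N} p q) v∈U = resp (λ y → C.sym (+ₘ-·ᵥ M N v y)) (+-closed (stable p v∈U) (stable q v∈U))
  stable {v = v} (scalars c {M} p)  v∈U = resp (λ y → C.sym (•ₘ-·ᵥ c M v y)) (•-closed c (stable p v∈U))
  stable {v = v} (products {M} {N} p q) v∈U = resp (λ y → C.sym (·ₘ-assoc-·ᵥ M N v y)) (stable p (stable q v∈U))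

-ₘ∈T : ∀ {D} {M N : Mat D} → M ∈ T → N ∈ T → M -ₘ N ∈ T
-ₘ∈T {M = M} {N} p q = equal (-ₘ-as-+ₘ M N) (sums p (scalars (- 1#) q))

Aᵋ∈T : ∀ {D} → Aᵋ {D} ∈ T
Aᵋ∈T = scalars _ (-ₘ∈T (products gen-A gen-A*) (products gen-A* gen-A))

-- On vectors `E* i` acts as a Lagrange polynomial in `A*`, and that polynomial belongs to `T`.
E*-stable : ∀ {D} {W : Pred (V D) 0ℓ} → IsTModule W → ∀ i → Stable (E* i) W
E*-stable {D} (S , stable) i {v} v∈W = IsSubspace.resp S (E*-product i v) (stable (product∈T (indices≢ D i)) v∈W)
  where
  product∈T : ∀ l → List.foldr _·ₘ_ I (List.map (factor A* i) l) ∈ T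
  product∈T List.[]       = unit
  product∈T (k List.∷ l) = products (scalars _ (-ₘ∈T gen-A* (scalars _ unit))) (product∈T l)

-- The diameter is given as a cardinality, whereas a string supplies an interval of indices; this
-- converts one into the other.
∣interval∣ : ∀ {n} (S : Subset n) a l → a N.+ l N.≤ n → (∀ {i} → i Subset.∈ S → a N.≤ toℕ i × toℕ i N.< a N.+ l) →
             (∀ {i} → a N.≤ toℕ i → toℕ i N.< a N.+ l → i Subset.∈ S) → Subset.∣ S ∣ ≡ l
∣interval∣ []            zero    zero    _ to from = ≡.refl
∣interval∣ (Subset.inside ∷ S)  zero    zero    _ to from = contradiction (proj₂ (to here)) λ ()
∣interval∣ (Subset.inside ∷ S)  zero    (suc l) p to from = ≡.cong suc (∣interval∣ S zero l (N.s≤s⁻¹ p)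
  (λ i∈S → N.z≤n , N.s≤s⁻¹ (proj₂ (to (there i∈S)))) (λ _ i<l → drop-there (from N.z≤n (N.s≤s i<l))))
∣interval∣ (Subset.inside ∷ S)  (suc a) l       p to from = contradiction (proj₁ (to here)) λ ()
∣interval∣ (Subset.outside ∷ S) zero    zero    p to from = ∣interval∣ S zero zero N.z≤n
  (λ i∈S → contradiction (proj₂ (to (there i∈S))) λ ()) (λ _ ())
∣interval∣ (Subset.outside ∷ S) zero    (suc l) p to from = contradiction (from {zero} N.z≤n (N.s≤s N.z≤n)) λ ()
∣interval∣ (Subset.outside ∷ S) (suc a) l       p to from = ∣interval∣ S a l (N.s≤s⁻¹ p)
  (λ i∈S → let a≤ , <l = to (there i∈S) in N.s≤s⁻¹ a≤ , N.s≤s⁻¹ <l)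
  (λ a≤ <l → drop-there (from (N.s≤s a≤) (N.s≤s <l)))

module Irreducible {D} {W : Pred (V D) 0ℓ} (irr : IsIrreducible W) where

  private
    tmod = proj₁ irr

    simple : ∀ U → IsTModule U → U ⊆ W → (U ⊆ zeroSubspace) ⊎ (W ⊆ U)
    simple U U-tmod U⊆W with proj₂ (proj₂ irr) U U-tmod U⊆W
    ... | inj₁ (U⊆0 , _) = inj₁ U⊆0
    ... | inj₂ (_ , W⊆U) = inj₂ W⊆U

    exhausts : ∀ U → IsTModule U → U ⊆ W → IsNonzero U → W ⊆ U
    exhausts U U-tmod U⊆W (u , u∈U , u≉0) with simple U U-tmod U⊆W
    ... | inj₁ U⊆0 = contradiction (U⊆0 u∈U) u≉0
    ... | inj₂ W⊆U = W⊆U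

  lem : LEM
  lem = irreducible⇒LEM tmod (proj₁ (proj₂ irr)) simple

  A-A*-Aᵋ : CyclicModule W A A* Aᵋ
  A-A*-Aᵋ = record
    { subspace = proj₁ tmod
    ; [X,Y] = [A,A*] ; [Y,Z] = [A*,Aᵋ] ; [Z,X] = [Aᵋ,A]
    ; X-stable = proj₂ tmod gen-A ; Y-stable = proj₂ tmod gen-A* ; Z-stable = proj₂ tmod Aᵋ∈T
    ; irreducible = λ U S U⊆W A-stable A*-stable _ → exhausts U (stable⇒TModule S A-stable A*-stable) U⊆W
    }

  A*-Aᵋ-A : CyclicModule W A* Aᵋ A
  A*-Aᵋ-A = rotate A-A*-Aᵋ

  Aᵋ-A-A* : CyclicModule W Aᵋ A A*
  Aᵋ-A-A* = rotate A*-Aᵋ-A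

  open Spectra lem

  private
    open Triple A-A*-Aᵋ

    A*-E* : ∀ i (v : V D) → A* ·ᵥ (E* i ·ᵥ v) ≈ᵥ ϑ D i •ᵥ (E* i ·ᵥ v)
    A*-E* i v y = C.trans (A*-·ᵥ (E* i ·ᵥ v) y) (C.trans (C.*-congˡ (E*-·ᵥ i v y))
      (C.trans (eigen (∂ x₀ y ℕₚ.≟ i)) (C.*-congˡ (C.sym (E*-·ᵥ i v y)))))
      where
      eigen : (p : Dec (∂ x₀ y ≡ i)) → ϑ D (∂ x₀ y) * ((if does p then 1# else 0#) * v y) ≈ ϑ D i * ((if does p then 1# else 0#) * v y)
      eigen (yes ≡.refl) = C.refl
      eigen (no _)       = solve 3 (λ a b x → a :* (:0 :* x) := b :* (:0 :* x)) C.refl (ϑ D (∂ x₀ y)) (ϑ D i) (v y)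

    -- raise shifts the A*-eigenvalue from θᵣ to θᵣ₋₁, which lies below the endpoint
    -- (or, for r = 0, outside the spectrum).
    endpoint-raised : ∀ {r u} → IsEndpoint W r → u ∈ W → A* ·ᵥ u ≈ᵥ ϑ D r •ᵥ u → e u ≈ᵥ 0ᵥ
    endpoint-raised {r} {u} (endpoint≤D , _ , lowest) u∈W A*u = vanishes r endpoint≤D lowest shifted
      where
      shifted : A* ·ᵥ e u ≈ᵥ (ϑ D r + (1# + 1#)) •ᵥ e u
      shifted y = C.trans (Ye u y) (C.trans (C.+-congʳ (C.trans (e-linear .cong A*u y) (e-linear .scale (ϑ D r) u y)))
        (C.sym (C.distribʳ (e u y) (ϑ D r) (1# + 1#))))
      vanishes : ∀ r → r N.≤ D → (∀ i → i N.≤ D → IsNonzero (image (E* i) W) → r N.≤ i) →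
                 A* ·ᵥ e u ≈ᵥ (ϑ D r + (1# + 1#)) •ᵥ e u → e u ≈ᵥ 0ᵥ
      -- The raised weight is D + 2; equality with D - 2j would force 2 + 2j = 0.
      vanishes zero    _   _       p = IsSpectral.outside A*-spectral (λ j _ eq → ℕₚ.1+n≢0 (ι-injective {2 N.+ (j N.+ j)} {0} (begin
        ι (2 N.+ (j N.+ j))                       ≈⟨ C.trans (ι-+ 2 (j N.+ j)) (C.+-congˡ (ι-+ j j)) ⟩
        ι 2 + (ι j + ι j)                         ≈⟨ solve 3 (λ a d j → a :+ (j :+ j) := (((d :- (:0 :+ :0)) :+ a) :- (d :- (j :+ j)))) C.refl (ι 2) (ι D) (ι j) ⟩
        ((ι D + - (0# + 0#)) + ι 2) + - (ι D + - (ι j + ι j)) ≈⟨ C.+-cong (C.+-cong (C.sym (ϑ-value D 0)) (ι-+ 1 1)) (C.-‿cong (C.sym (ϑ-value D j))) ⟩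
        (ϑ D 0 + (1# + 1#)) + - ϑ D j             ≈⟨ x≈y⇒x-y≈0 eq ⟩
        0#                                        ∎))) p
      vanishes (suc r) r<D minimal p = decidable-stable (lem _) λ eu≉0 → ℕₚ.<-irrefl ≡.refl
        (minimal r r≤D (e u , (e u , e-stable u∈W , λ y → C.sym (IsSpectral.same A*-spectral {i = r} r≤D p′ y)) , eu≉0))
        where
        r≤D = ℕₚ.<⇒≤ r<D
        p′ : A* ·ᵥ e u ≈ᵥ ϑ D r •ᵥ e u
        p′ y = C.trans (p y) (C.*-congʳ (C.trans (C.+-congʳ (ϑ-suc D r)) (solve 1 (λ t → (t :- (:1 :+ :1)) :+ (:1 :+ :1) := t) C.refl (ϑ D r))))

  A*-string : ∀ {r} → IsEndpoint W r → ∃ λ m → ∃ λ w → IsString W A A* Aᵋ r m w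
  A*-string {r} end@(_ , (v , (v′ , v′∈W , v≈) , v≉0) , _) =
    Strings.highest⇒string lem A-A*-Aᵋ A*-spectral u∈W (λ u≈0 → v≉0 λ y → C.trans (v≈ y) (u≈0 y)) (A*-E* r v′)
      (endpoint-raised end u∈W (A*-E* r v′))
    where
    u∈W = E*-stable tmod r v′∈W

  -- The indices with nonzero `E*`-image are exactly r, ..., r + m, so the counted set has m + 1
  -- elements.
  string-length : ∀ {r m d w} → IsString W A A* Aᵋ r m w → IsDiameter W d → m ≡ d
  string-length {r} {m} s (S , S-spec , ∣S∣) = ℕₚ.suc-injective (≡.trans (≡.sym (∣interval∣ S r (suc m) fits to from)) ∣S∣)
    where
    open StringTheory lem A-A*-Aᵋ s
    open Projections A*-spectral
    fits : r N.+ suc m N.≤ suc D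
    fits = ℕₚ.≤-trans (ℕₚ.≤-reflexive (ℕₚ.+-suc r m)) (N.s≤s (weight≤ ℕₚ.≤-refl))
    to : ∀ {i} → i Subset.∈ S → r N.≤ toℕ i × toℕ i N.< r N.+ suc m
    to {i} i∈S = let r≤ , ≤r+m = image-index (Finₚ.toℕ≤pred[n] i) (Equivalence.to (S-spec i) i∈S) in
      r≤ , ℕₚ.≤-trans (N.s≤s ≤r+m) (ℕₚ.≤-reflexive (≡.sym (ℕₚ.+-suc r m)))
    from : ∀ {i} → r N.≤ toℕ i → toℕ i N.< r N.+ suc m → i Subset.∈ S
    from {i} r≤i i< = Equivalence.from (S-spec i) (≡.subst (λ n → IsNonzero (image (E* n) W)) (ℕₚ.m+[n∸m]≡n r≤i)
      (image-string {toℕ i N.∸ r} (ℕₚ.m≤n+o⇒m∸n≤o (toℕ i) r (N.s≤s⁻¹ (ℕₚ.≤-trans i< (ℕₚ.≤-reflexive (ℕₚ.+-suc r m)))))))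

-- Rotation of strings and the three representations

rotate-string : (lem : LEM) → ∀ {D} {W : Pred (V D) 0ℓ} {X Y Z : Mat D} (M : CyclicModule W X Y Z) {π π′ r m w} →
                IsSpectral Y π → IsSpectral X π′ → IsString W X Y Z r m w → ∃ λ w′ → IsString W Z X Y r m w′
rotate-string lem {X = X} {Y} {Z} M {r = r} {m} spectral spectral′ s =
  let u , u∈W , u≉0 , Xu , raise-u = StringTheory.Projections.rotated-highest lem M s spectral
      m′ , w′ , s′ = Strings.highest⇒string lem (rotate (rotate M)) spectral′ u∈W u≉0 Xu raise-u
  in w′ , ≡.subst (λ n → IsString _ Z X Y r n w′)
       -- Both lengths solve D = m + 2r for the same D and r.
       (ℕₚ.+-cancelʳ-≡ (r N.+ r) m′ m (≡.trans (≡.sym (IsString.dimension s′)) (IsString.dimension s))) s′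

theorem10p4 :
    ∀ (D : ℕ) .{{_ : N.NonZero D}} (W : Pred (V D) 0ℓ) → IsIrreducible W →
    ∀ (r d : ℕ) → IsEndpoint W r → IsDiameter W d →
    ∀ (u u* uᵋ : V D) →
    u  ∈ image (E r) W  → u  ≉ᵥ 0ᵥ →
    u* ∈ image (E* r) W → u* ≉ᵥ 0ᵥ →
    uᵋ ∈ image (Eᵋ r) W → uᵋ ≉ᵥ 0ᵥ →
    Represents W (B d) A  (λ i → E* (r N.+ toℕ i) ·ᵥ uᵋ) ×
    Represents W (B d) A* (λ i → Eᵋ (r N.+ toℕ i) ·ᵥ u) ×
    Represents W (B d) Aᵋ (λ i → E (r N.+ toℕ i) ·ᵥ u*)
theorem10p4 D W irr r d end diam u u* uᵋ u∈ u≉0 u*∈ u*≉0 uᵋ∈ uᵋ≉0 = part-i , part-ii , part-iii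
  where
  open Irreducible irr
  open Spectra lem
  string = A*-string end
  s : IsString W A A* Aᵋ r d (proj₁ (proj₂ string))
  s = ≡.subst (λ m → IsString W A A* Aᵋ r m _) (string-length (proj₂ (proj₂ string)) diam) (proj₂ (proj₂ string))
  -- Each rotation passes from a string of weight vectors of `Y` to one of weight vectors of `X`:
  -- from `A*` to `A`, and then from `A` to `Aᵋ`.
  s-A : ∃ λ w′ → IsString W Aᵋ A A* r d w′
  s-A = rotate-string lem A-A*-Aᵋ A*-spectral A-spectral s
  s-Aᵋ : ∃ λ w′ → IsString W A* Aᵋ A r d w′
  s-Aᵋ = rotate-string lem Aᵋ-A-A* A-spectral Aᵋ-spectral (proj₂ s-A)
  part-i : Represents W (B d) A (λ i → E* (r N.+ toℕ i) ·ᵥ uᵋ)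
  -- Two strings enter each part: the one for `Z`, here `Aᵋ`, makes the given vector a highest
  -- weight vector, and the one for `Y`, here `A*`, supplies the basis.
  part-i = let uᵋ∈W , eigen , raised = StringTheory.Projections.highest-image lem A*-Aᵋ-A (proj₂ s-Aᵋ) Aᵋ-spectral uᵋ∈
    in Representation.represents lem A-A*-Aᵋ A*-spectral s uᵋ∈W uᵋ≉0 eigen raised
  part-ii : Represents W (B d) A* (λ i → Eᵋ (r N.+ toℕ i) ·ᵥ u)
  part-ii = let u∈W , eigen , raised = StringTheory.Projections.highest-image lem Aᵋ-A-A* (proj₂ s-A) A-spectral u∈
    in Representation.represents lem A*-Aᵋ-A Aᵋ-spectral (proj₂ s-Aᵋ) u∈W u≉0 eigen raised
  part-iii : Represents W (B d) Aᵋ (λ i → E (r N.+ toℕ i) ·ᵥ u*)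
  part-iii = let u*∈W , eigen , raised = StringTheory.Projections.highest-image lem A-A*-Aᵋ s A*-spectral u*∈
    in Representation.represents lem Aᵋ-A-A* A-spectral (proj₂ s-A) u*∈W u*≉0 eigen raised
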